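{- For each nonnegative integer $k$, the map $\pi\mapsto\mathrm{DL}_k(\mathrm{swl}(\pi))$ is well defined on $\mathcal U_{2k+1}(132)$ and is a bijection $\mathrm{DL}_k\circ\mathrm{swl}:\mathcal U_{2k+1}(132)\to\mathrm{Int}(\mathcal L_k^T)$.
   Context: Permutations are finite words of distinct positive integers; $S_n$ is the set of permutations of $[n]$. The stack-sorting map $s$: $s(\text{empty})=\text{empty}$, and if $\pi=LnR$ with $n$ the largest entry, $s(\pi)=s(L)s(R)n$. $\pi$ is uniquely sorted if it has exactly one preimage under $s$. A permutation avoids $\tau$ if no subsequence has the same relative order as $\tau$; $\mathcal U_n(\tau)$ is the set of uniquely sorted permutations in $S_n$ avoiding $\tau$. A descent of $\pi$ is an index $i$ with $\pi_i>\pi_{i+1}$; $\mathrm{Des}(\pi)$ is the set of descents. $\mathrm{rev}$ reverses a word, $\pi^{ -1}$ is the group inverse, $\mathrm{rot}(\pi)=\mathrm{rev}(\pi^{ -1})$, and $\mathrm{rot}^{ -1}$ is its inverse. Sliding operators: for $\pi\in S_n$, $i\in[n]$, let $L_i$ (resp. $R_i$) be the set of elements of $[i-1]$ to the left (resp. right) of the entry $i$ in $\pi$. $\mathrm{swu}_i(\pi)$ has $j$-th entry $\pi_j$ if $\pi_j\ge i$, $m$ if $\pi_j$ is the $m$-th smallest element of $R_i$, and $i-m$ if $\pi_j$ is the $m$-th largest element of $L_i$. $\mathrm{swl}_i=\mathrm{rot}^{ -1}\circ\mathrm{swu}_i\circ\mathrm{rot}$ and $\mathrm{swl}=\mathrm{swl}_1\circ\cdots\circ\mathrm{swl}_n$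 on $S_n$. Dyck paths: $\mathbf D_k$ is the set of words in $\{U,D\}$ with $k$ of each letter whose every prefix has at least as many $U$'s as $D$'s. Writing $\Lambda=UD^{\gamma_1}\cdots UD^{\gamma_k}$, $\mathrm{lon}_j(\Lambda)$ is the least $t\ge0$ with $\gamma_j+\cdots+\gamma_{j+t}>t$. The Tamari lattice $\mathcal L_k^T$ is $\mathbf D_k$ with $\Lambda\le_T\Lambda'$ iff $\mathrm{lon}_j(\Lambda)\le\mathrm{lon}_j(\Lambda')$ for all $j\in[k]$. $\mathrm{Int}(P)$ is the set of pairs $(x,y)$ with $x\le y$ in $P$. For $\pi\in\mathcal U_{2k+1}(312)$, $n=2k+1$, let $\Lambda_i=D$ if $n-i\in\mathrm{Des}(\pi)$ and $U$ otherwise, $\Lambda'_i=U$ if $i\in\mathrm{Des}(\mathrm{rot}(\pi))$ and $D$ otherwise ($1\le i\le 2k$), and $\mathrm{DL}_k(\pi)=(\Lambda_1\cdots\Lambda_{2k},\Lambda'_1\cdots\Lambda'_{2k})$. -}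

module Defs where

open import Data.Nat using (ℕ; zero; suc; _+_; _∸_; _<_; _≤_; _⊔_; _≡ᵇ_; _<ᵇ_)
open import Data.Bool using (Bool; true; false; if_then_else_; _∧_; not)
open import Data.List using (List; []; _∷_; _++_; map; length; reverse; upTo; foldr; take; drop; filter)
open import Data.Nat.ListAction using (sum)
open import Data.List.Relation.Binary.Sublist.Propositional using (_⊆_)
open import Data.List.Relation.Binary.Permutation.Propositional using (_↭_)
open import Data.List.Relation.Binary.Pointwise using (Pointwise)
open import Data.Product using (_×_; _,_; proj₁; proj₂; Σ; ∃)
open import Data.Unit using (⊤)
open import Data.Empty using (⊥)
open import Relation.Nullary using (¬_)
open import Relation.Binary.PropositionalEquality using (_≡_)
open import Function.Bundles using (_⇔_)

range1 : ℕ → List ℕ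
range1 n = map suc (upTo n)

IsPerm : ℕ → List ℕ → Set
IsPerm n π = π ↭ range1 n

maxL : List ℕ → ℕ
maxL = foldr _⊔_ 0

splitOn : ℕ → List ℕ → List ℕ × List ℕ
splitOn m [] = [] , []
splitOn m (x ∷ xs) with x ≡ᵇ m
... | true  = [] , xs
... | false = x ∷ proj₁ (splitOn m xs) , proj₂ (splitOn m xs)

-- stack-sorting map, by the recursion s(LnR) = s(L) s(R) n; the fuel
-- argument (initialised to the length) only serves structural termination.
stackSortF : ℕ → List ℕ → List ℕ
stackSortF zero    π = []
stackSortF (suc f) [] = []
stackSortF (suc f) (x ∷ xs) =
  let m = maxL (x ∷ xs)
      p = splitOn m (x ∷ xs)
  in stackSortF f (proj₁ p) ++ stackSortF f (proj₂ p) ++ (m ∷ [])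

s : List ℕ → List ℕ
s π = stackSortF (length π) π

UniquelySorted : ℕ → List ℕ → Set
UniquelySorted n π =
  Σ (List ℕ) λ σ → IsPerm n σ × s σ ≡ π × (∀ τ → IsPerm n τ → s τ ≡ π → τ ≡ σ)

-- two words of distinct entries have the same relative order
SameOrder : List ℕ → List ℕ → Set
SameOrder [] [] = ⊤
SameOrder [] (_ ∷ _) = ⊥
SameOrder (_ ∷ _) [] = ⊥
SameOrder (x ∷ xs) (y ∷ ys) =
  Pointwise (λ x′ y′ → (x < x′) ⇔ (y < y′)) xs ys × SameOrder xs ys

Avoids : List ℕ → List ℕ → Set
Avoids π τ = ∀ σ → σ ⊆ π → ¬ SameOrder σ τ

InU : ℕ → List ℕ → List ℕ → Set
InU n τ π = IsPerm n π × UniquelySorted n π × Avoids π τ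

isDes : List ℕ → ℕ → Bool
isDes (x ∷ y ∷ r) (suc zero)    = y <ᵇ x
isDes (x ∷ r)     (suc (suc i)) = isDes r (suc i)
isDes _           _             = false

pos : List ℕ → ℕ → ℕ
pos [] j = 0
pos (x ∷ xs) j = if x ≡ᵇ j then 1 else suc (pos xs j)

inv : List ℕ → List ℕ
inv π = map (pos π) (range1 (length π))

rot : List ℕ → List ℕ
rot π = reverse (inv π)

rotInv : List ℕ → List ℕ
rotInv π = inv (reverse π)

countL : (ℕ → Bool) → List ℕ → ℕ
countL p xs = length (filter (λ y → Data.Bool.T? (p y)) xs)
  where import Data.Bool

swu : ℕ → List ℕ → List ℕ
swu i π =
  let L = proj₁ (splitOn i π)
      R = proj₂ (splitOn i π)
      fL : ℕ → ℕ
      fL x = if x <ᵇ i then i ∸ suc (countL (λ y → (y <ᵇ i) ∧ (x <ᵇ y)) L) else x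
      fR : ℕ → ℕ
      fR x = if x <ᵇ i then suc (countL (λ y → (y <ᵇ i) ∧ (y <ᵇ x)) R) else x
  in map fL L ++ (i ∷ map fR R)

swlᵢ : ℕ → List ℕ → List ℕ
swlᵢ i = λ π → rotInv (swu i (rot π))

composeSwl : List ℕ → List ℕ → List ℕ
composeSwl [] π = π
composeSwl (i ∷ is) π = swlᵢ i (composeSwl is π)

swl : List ℕ → List ℕ
swl π = composeSwl (range1 (length π)) π

data Step : Set where
  U D : Step

countS : Step → List Step → ℕ
countS U [] = 0
countS D [] = 0
countS U (U ∷ w) = suc (countS U w)
countS U (D ∷ w) = countS U w
countS D (D ∷ w) = suc (countS D w)
countS D (U ∷ w) = countS D w

PrefixOK : List Step → Set
PrefixOK w = ∀ j → countS D (take j w) ≤ countS U (take j w)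

IsDyck : ℕ → List Step → Set
IsDyck k w = countS U w ≡ k × countS D w ≡ k × PrefixOK w

-- for Λ = U D^{γ₁} ⋯ U D^{γ_k}: gammas Λ = γ₁ ∷ ⋯ ∷ γ_k ∷ []
gammasAux : List Step → ℕ × List ℕ
gammasAux [] = 0 , []
gammasAux (D ∷ w) = suc (proj₁ (gammasAux w)) , proj₂ (gammasAux w)
gammasAux (U ∷ w) = 0 , proj₁ (gammasAux w) ∷ proj₂ (gammasAux w)

gammas : List Step → List ℕ
gammas w = proj₂ (gammasAux w)

partialSum : List Step → ℕ → ℕ → ℕ
partialSum Λ j t = sum (take (suc t) (drop (j ∸ 1) (gammas Λ)))

IsLon : List Step → ℕ → ℕ → Set
IsLon Λ j t = t < partialSum Λ j t × (∀ t′ → t′ < t → partialSum Λ j t′ ≤ t′)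

TamariLe : ℕ → List Step → List Step → Set
TamariLe k Λ Λ′ = ∀ j → 1 ≤ j → j ≤ k → ∀ t t′ → IsLon Λ j t → IsLon Λ′ j t′ → t ≤ t′

InInt : ℕ → List Step × List Step → Set
InInt k (Λ , Λ′) = IsDyck k Λ × IsDyck k Λ′ × TamariLe k Λ Λ′

DL : ℕ → List ℕ → List Step × List Step
DL k π =
  map (λ i → if isDes π ((suc (k + k)) ∸ i) then D else U) (range1 (k + k)) ,
  map (λ i → if isDes (rot π) i then U else D) (range1 (k + k))

p132 p312 : List ℕ
p132 = 1 ∷ 3 ∷ 2 ∷ []
p312 = 3 ∷ 1 ∷ 2 ∷ []

-- The operator swlᵢ stably moves the letters smaller than the i-th one to the front of the first
-- i - 1 positions. Hence a 132-avoiding permutation, which is a binary search tree T read in the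
-- order right subtree, left subtree, root, is sent by swl to T read in the order left, right, root.
-- Coding T as a plane forest, the two words of DL record the inner vertices and leaves of the
-- forest in preorder and in postorder, that is, the run lengths of the Dyck path of the forest,
-- and these determine it.
--
-- The preimages of π under s are the decreasing binary trees with postorder π. The preimage is
-- unique exactly if the tree is full and each left child is a descent of π, so that a stack machine
-- which pushes at a descent and merges at an ascent rebuilds the tree. On the reading 132 of T the
-- machine succeeds if and only if in T the later siblings of each vertex contain at least as many
-- inner vertices as leaves. In terms of the pair of Dyck paths, this condition says that each
-- step of the lower path returns no later than the corresponding step of the upper path, which is
-- the Tamari order. On the reading 312 the machine only needs the lower path to be a Dyck path.

module Submission where

open import Defs
open import Data.Bool using (Bool; true; false; if_then_else_; _∧_; T?)
open import Data.Empty using (⊥; ⊥-elim)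
open import Data.List using (List; []; _∷_; _++_; [_]; map; length; reverse; applyUpTo; take; drop; filter; replicate; initLast; _∷ʳ′_)
open import Data.List.Properties hiding (sum-++)
open import Data.List.Membership.Propositional using (_∈_; _∉_)
open import Data.List.Membership.Propositional.Properties using (∈-++⁺ˡ; ∈-++⁺ʳ; ∈-++⁻; ∈-∃++; ∈-map⁻)
open import Data.List.Relation.Binary.Permutation.Propositional using (_↭_; ↭-refl; ↭-reflexive; ↭-sym; ↭-trans; prep; swap)
import Data.List.Relation.Binary.Permutation.Propositional as Perm
open import Data.List.Relation.Binary.Permutation.Propositional.Properties as Permₚ
  using (All-resp-↭; ∈-resp-↭; ↭-length; filter-↭; ↭-reverse; shift)
open import Data.List.Relation.Binary.Pointwise using ([]; _∷_)
open import Data.List.Relation.Binary.Sublist.Propositional using (_⊆_; []; _∷_; _∷ʳ_; ⊆-refl; ⊆-trans; from∈; lookup)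
import Data.List.Relation.Binary.Sublist.Propositional.Properties as Subₚ
open import Data.List.Relation.Unary.All as All using (All; []; _∷_)
import Data.List.Relation.Unary.All.Properties as Allₚ
open import Data.List.Relation.Unary.AllPairs using ([]; _∷_)
open import Data.List.Relation.Unary.Any using (here; there)
open import Data.List.Relation.Unary.Unique.Propositional using (Unique)
open import Data.Nat using (ℕ; zero; suc; _+_; _∸_; _⊓_; _≤_; _<_; _≡ᵇ_; _<ᵇ_; z≤n; s≤s; z<s; s≤s⁻¹; _≟_; _≤?_; _<?_; _≮_)
open import Data.Nat.ListAction using (sum)
open import Data.Nat.ListAction.Properties using (sum-++)
open import Data.Nat.Properties
open import Data.Nat.Tactic.RingSolver using (solve-∀)
open import Data.Product using (_×_; _,_; proj₁; proj₂; Σ; ∃-syntax)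
open import Data.Sum using (_⊎_; inj₁; inj₂)
open import Data.Unit using (⊤; tt)
open import Function using (_∘_; id; flip; case_of_)
open import Function.Bundles using (_⇔_; mk⇔; Equivalence)
open import Relation.Binary.PropositionalEquality hiding ([_])
open import Relation.Nullary using (¬_; Dec; yes; no)
open import Relation.Binary using (tri<; tri≈; tri>)
open import Level using (Level)

-- Plane forests and their Dyck paths

-- A permutation of 2k + 1 letters has to match words of length 2k. The surplus is the first leaf: a
-- single tree left on the stack forces the forest to be `node ε B`, and the interval is read off B.
-- Hence conditions on a forest are stated for the suffixes obtained by dropping at least one peak;
-- for `node ε B` these are all suffixes of `peaks B`, and at their starting points the Tamari order
-- compares returns.
--
-- The obstacle is that the sibling condition concerns whole groups of siblings, the Tamari
-- condition suffixes that cross the borders of groups. A suffix inside a group of children is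
-- followed by other vertices, so its balance is not given; it is regained from the additional end
-- of the parent that closes there. For surjectivity the two words must moreover come from some
-- forest, for which the Tamari order has to imply containment of the paths.
--
-- That every preimage of a word is tight as soon as one is follows by counting: among decreasing
-- trees, tight ones are those whose postorder word has exactly one letter more than twice its
-- descents.

module _ {a : Level} {A : Set a} where

  take-++ : ∀ n (xs ys : List A) → take n (xs ++ ys) ≡ take n xs ++ take (n ∸ length xs) ys
  take-++ zero    []       ys = refl
  take-++ zero    (x ∷ xs) ys = refl
  take-++ (suc n) []       ys = refl
  take-++ (suc n) (x ∷ xs) ys = cong (x ∷_) (take-++ n xs ys)

  drop-++ : ∀ n (xs ys : List A) → drop n (xs ++ ys) ≡ drop n xs ++ drop (n ∸ length xs) ys
  drop-++ zero    []       ys = refl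
  drop-++ zero    (x ∷ xs) ys = refl
  drop-++ (suc n) []       ys = refl
  drop-++ (suc n) (x ∷ xs) ys = drop-++ n xs ys

  drop-length-++ : ∀ n (xs ys : List A) → drop (length xs + n) (xs ++ ys) ≡ drop n ys
  drop-length-++ n []       ys = refl
  drop-length-++ n (x ∷ xs) ys = drop-length-++ n xs ys

  take-++-≤ : ∀ n (xs : List A) {ys} → n ≤ length xs → take n (xs ++ ys) ≡ take n xs
  take-++-≤ zero    xs       n≤       = refl
  take-++-≤ (suc n) (x ∷ xs) (s≤s n≤) = cong (x ∷_) (take-++-≤ n xs n≤)

  length-drop-< : ∀ t (xs : List A) {u} → u < length (drop t xs) → t + u < length xs
  length-drop-< zero    xs       u< = u<
  length-drop-< (suc t) []       ()
  length-drop-< (suc t) (x ∷ xs) u< = s≤s (length-drop-< t xs u<)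

-- A plane forest is coded as a binary tree: `node A B` is a root whose children
-- form the forest A, followed by its later siblings B.
data Forest : Set where
  ε    : Forest
  node : Forest → Forest → Forest

size : Forest → ℕ
size ε          = 0
size (node A B) = size B + suc (size A)

Peaks : Set
Peaks = List (ℕ × ℕ)

incLast : Peaks → Peaks
incLast []             = []
incLast ((a , b) ∷ []) = (a , suc b) ∷ []
incLast (p ∷ q ∷ ps)   = p ∷ incLast (q ∷ ps)

-- A root without children is itself the leaf and counts in neither coordinate; otherwise it starts
-- at its first leaf and ends at its last.
enclose : Peaks → Peaks
enclose []             = (0 , 0) ∷ []
enclose ((a , b) ∷ ps) = incLast ((suc a , b) ∷ ps)

-- One pair (number of inner vertices starting, number of inner vertices ending) per leaf.
peaks : Forest → Peaks
peaks ε          = []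
peaks (node A B) = enclose (peaks A) ++ peaks B

starts ends : Peaks → ℕ
starts ps = sum (map proj₁ ps)
ends   ps = sum (map proj₂ ps)

starts-++ : ∀ ps qs → starts (ps ++ qs) ≡ starts ps + starts qs
starts-++ ps qs = trans (cong sum (map-++ proj₁ ps qs)) (sum-++ (map proj₁ ps) (map proj₁ qs))

ends-++ : ∀ ps qs → ends (ps ++ qs) ≡ ends ps + ends qs
ends-++ ps qs = trans (cong sum (map-++ proj₂ ps qs)) (sum-++ (map proj₂ ps) (map proj₂ qs))

starts-split : ∀ t ps → starts (take t ps) + starts (drop t ps) ≡ starts ps
starts-split t ps = trans (sym (starts-++ (take t ps) (drop t ps))) (cong starts (take++drop≡id t ps))

ends-split : ∀ t ps → ends (take t ps) + ends (drop t ps) ≡ ends ps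
ends-split t ps = trans (sym (ends-++ (take t ps) (drop t ps))) (cong ends (take++drop≡id t ps))

length-incLast : ∀ ps → length (incLast ps) ≡ length ps
length-incLast []           = refl
length-incLast (p ∷ [])     = refl
length-incLast (p ∷ q ∷ ps) = cong suc (length-incLast (q ∷ ps))

starts-take-incLast : ∀ t ps → starts (take t (incLast ps)) ≡ starts (take t ps)
starts-take-incLast zero          ps           = refl
starts-take-incLast (suc t)       []           = refl
starts-take-incLast (suc zero)    (p ∷ [])     = refl
starts-take-incLast (suc (suc t)) (p ∷ [])     = refl
starts-take-incLast (suc t)       (p ∷ q ∷ ps) = cong (proj₁ p +_) (starts-take-incLast t (q ∷ ps))

drop-incLast : ∀ t ps → drop t (incLast ps) ≡ incLast (drop t ps)
drop-incLast zero          ps           = refl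
drop-incLast (suc t)       []           = refl
drop-incLast (suc zero)    (p ∷ [])     = refl
drop-incLast (suc (suc t)) (p ∷ [])     = refl
drop-incLast (suc t)       (p ∷ q ∷ ps) = drop-incLast t (q ∷ ps)

starts-incLast : ∀ ps → starts (incLast ps) ≡ starts ps
starts-incLast ps = begin
  starts (incLast ps)                        ≡⟨ cong starts (take-all (length ps) (incLast ps) (≤-reflexive (length-incLast ps))) ⟨
  starts (take (length ps) (incLast ps))     ≡⟨ starts-take-incLast (length ps) ps ⟩
  starts (take (length ps) ps)               ≡⟨ cong starts (take-all (length ps) ps ≤-refl) ⟩
  starts ps                                  ∎
  where open ≡-Reasoning

ends-incLast : ∀ ps → ps ≢ [] → ends (incLast ps) ≡ suc (ends ps)
ends-incLast []           ps≢[] = ⊥-elim (ps≢[] refl)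
ends-incLast (p ∷ [])     _     = refl
ends-incLast (p ∷ q ∷ ps) _     =
  trans (cong (proj₂ p +_) (ends-incLast (q ∷ ps) (λ ()))) (+-suc (proj₂ p) (ends (q ∷ ps)))

take-incLast : ∀ t ps → t < length ps → take t (incLast ps) ≡ take t ps
take-incLast zero    ps           _           = refl
take-incLast (suc t) (p ∷ [])     (s≤s ())
take-incLast (suc t) (p ∷ q ∷ ps) (s≤s t<) = cong (p ∷_) (take-incLast t (q ∷ ps) t<)

ends-take-incLast-≤ : ∀ t ps → ends (take t (incLast ps)) ≤ suc (ends (take t ps))
ends-take-incLast-≤ zero          ps           = z≤n
ends-take-incLast-≤ (suc t)       []           = z≤n
ends-take-incLast-≤ (suc zero)    (p ∷ [])     = ≤-refl
ends-take-incLast-≤ (suc (suc t)) (p ∷ [])     = ≤-refl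
ends-take-incLast-≤ (suc t)       (p ∷ q ∷ ps) = begin
  proj₂ p + ends (take t (incLast (q ∷ ps)))   ≤⟨ +-monoʳ-≤ (proj₂ p) (ends-take-incLast-≤ t (q ∷ ps)) ⟩
  proj₂ p + suc (ends (take t (q ∷ ps)))       ≡⟨ +-suc (proj₂ p) _ ⟩
  suc (proj₂ p + ends (take t (q ∷ ps)))       ∎
  where open ≤-Reasoning

ends-take-incLast-≥ : ∀ t ps → ends (take t ps) ≤ ends (take t (incLast ps))
ends-take-incLast-≥ zero          ps           = z≤n
ends-take-incLast-≥ (suc t)       []           = z≤n
ends-take-incLast-≥ (suc zero)    (p ∷ [])     = n≤1+n _
ends-take-incLast-≥ (suc (suc t)) (p ∷ [])     = n≤1+n _
ends-take-incLast-≥ (suc t)       (p ∷ q ∷ ps) = +-monoʳ-≤ (proj₂ p) (ends-take-incLast-≥ t (q ∷ ps))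

-- The start of the root is recorded in the first peak only, so a proper suffix sees nothing of the
-- root but its end.
drop-enclose : ∀ t ps → drop (suc t) (enclose ps) ≡ incLast (drop (suc t) ps)
drop-enclose zero    []                 = refl
drop-enclose (suc t) []                 = refl
drop-enclose t       ((a , b) ∷ [])     = drop-incLast (suc t) ((suc a , b) ∷ [])
drop-enclose t       ((a , b) ∷ q ∷ ps) = drop-incLast t (q ∷ ps)

length-enclose : ∀ ps → ps ≢ [] → length (enclose ps) ≡ length ps
length-enclose []             ps≢[] = ⊥-elim (ps≢[] refl)
length-enclose ((a , b) ∷ ps) _     = length-incLast ((suc a , b) ∷ ps)

0<length-enclose : ∀ ps → 0 < length (enclose ps)
0<length-enclose []                 = z<s
0<length-enclose ((a , b) ∷ [])     = z<s
0<length-enclose ((a , b) ∷ q ∷ ps) = z<s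

enclose≢[] : ∀ ps → enclose ps ≢ []
enclose≢[] ps eq = <-irrefl refl (subst (λ xs → 0 < length xs) eq (0<length-enclose ps))

starts-enclose : ∀ ps → ps ≢ [] → starts (enclose ps) ≡ suc (starts ps)
starts-enclose []             ps≢[] = ⊥-elim (ps≢[] refl)
starts-enclose ((a , b) ∷ ps) _     = starts-incLast ((suc a , b) ∷ ps)

ends-enclose : ∀ ps → ps ≢ [] → ends (enclose ps) ≡ suc (ends ps)
ends-enclose []             ps≢[] = ⊥-elim (ps≢[] refl)
ends-enclose ((a , b) ∷ ps) _     = ends-incLast ((suc a , b) ∷ ps) (λ ())

peaks≢[] : ∀ A B → peaks (node A B) ≢ []
peaks≢[] A B eq = enclose≢[] (peaks A) (++-conicalˡ _ _ eq)

starts≡ends : ∀ T → starts (peaks T) ≡ ends (peaks T)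
starts≡ends ε          = refl
starts≡ends (node A B) = begin
  starts (enclose (peaks A) ++ peaks B)           ≡⟨ starts-++ (enclose (peaks A)) (peaks B) ⟩
  starts (enclose (peaks A)) + starts (peaks B)   ≡⟨ cong₂ _+_ (closed A) (starts≡ends B) ⟩
  ends (enclose (peaks A)) + ends (peaks B)       ≡⟨ ends-++ (enclose (peaks A)) (peaks B) ⟨
  ends (enclose (peaks A) ++ peaks B)             ∎
  where
  open ≡-Reasoning
  closed : ∀ A → starts (enclose (peaks A)) ≡ ends (enclose (peaks A))
  closed ε              = refl
  closed A@(node A₁ A₂) = begin
    starts (enclose (peaks A))   ≡⟨ starts-enclose (peaks A) (peaks≢[] A₁ A₂) ⟩
    suc (starts (peaks A))       ≡⟨ cong suc (starts≡ends A) ⟩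
    suc (ends (peaks A))         ≡⟨ ends-enclose (peaks A) (peaks≢[] A₁ A₂) ⟨
    ends (enclose (peaks A))     ∎

-- The Dyck condition on `path ps`, tested after each complete block: both step counts exceed these
-- sums by the same number of leaves.
Dominated : Peaks → Set
Dominated ps = ∀ t → ends (take t ps) ≤ starts (take t ps)

dominated-++ : ∀ ps qs → Dominated ps → Dominated qs → Dominated (ps ++ qs)
dominated-++ ps qs dp dq t = begin
  ends (take t (ps ++ qs))                                  ≡⟨ cong ends (take-++ t ps qs) ⟩
  ends (take t ps ++ take (t ∸ length ps) qs)               ≡⟨ ends-++ (take t ps) _ ⟩
  ends (take t ps) + ends (take (t ∸ length ps) qs)         ≤⟨ +-mono-≤ (dp t) (dq (t ∸ length ps)) ⟩
  starts (take t ps) + starts (take (t ∸ length ps) qs)     ≡⟨ starts-++ (take t ps) _ ⟨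
  starts (take t ps ++ take (t ∸ length ps) qs)             ≡⟨ cong starts (take-++ t ps qs) ⟨
  starts (take t (ps ++ qs))                                ∎
  where open ≤-Reasoning

dominated-enclose : ∀ ps → Dominated ps → Dominated (enclose ps)
dominated-enclose []             d zero          = z≤n
dominated-enclose []             d (suc zero)    = z≤n
dominated-enclose []             d (suc (suc t)) = z≤n
dominated-enclose ((a , b) ∷ ps) d zero    = z≤n
dominated-enclose ((a , b) ∷ ps) d (suc t) = begin
  ends (take (suc t) (incLast ((suc a , b) ∷ ps)))   ≤⟨ ends-take-incLast-≤ (suc t) ((suc a , b) ∷ ps) ⟩
  suc (ends (take (suc t) ((a , b) ∷ ps)))           ≤⟨ s≤s (d (suc t)) ⟩
  suc (starts (take (suc t) ((a , b) ∷ ps)))         ≡⟨ starts-take-incLast (suc t) ((suc a , b) ∷ ps) ⟨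
  starts (take (suc t) (incLast ((suc a , b) ∷ ps))) ∎
  where open ≤-Reasoning

dominated-peaks : ∀ T → Dominated (peaks T)
dominated-peaks ε zero    = z≤n
dominated-peaks ε (suc t) = z≤n
dominated-peaks (node A B) =
  dominated-++ (enclose (peaks A)) (peaks B) (dominated-enclose (peaks A) (dominated-peaks A)) (dominated-peaks B)

starts-drop≤ends-drop : ∀ ps → starts ps ≡ ends ps → Dominated ps → ∀ t → starts (drop t ps) ≤ ends (drop t ps)
starts-drop≤ends-drop ps total dom t = +-cancelˡ-≤ (ends (take t ps)) _ _ (begin
  ends (take t ps) + starts (drop t ps)     ≤⟨ +-monoˡ-≤ _ (dom t) ⟩
  starts (take t ps) + starts (drop t ps)   ≡⟨ starts-split t ps ⟩
  starts ps                                 ≡⟨ total ⟩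
  ends ps                                   ≡⟨ ends-split t ps ⟨
  ends (take t ps) + ends (drop t ps)       ∎)
  where open ≤-Reasoning

-- Balance and first returns of suffixes

Balanced : Peaks → Set
Balanced ps = length ps ≤ starts ps

balanced-++ : ∀ ps qs → Balanced ps → Balanced qs → Balanced (ps ++ qs)
balanced-++ ps qs bp bq = begin
  length (ps ++ qs)       ≡⟨ length-++ ps ⟩
  length ps + length qs   ≤⟨ +-mono-≤ bp bq ⟩
  starts ps + starts qs   ≡⟨ starts-++ ps qs ⟨
  starts (ps ++ qs)       ∎
  where open ≤-Reasoning

balanced-incLast : ∀ ps → Balanced ps → Balanced (incLast ps)
balanced-incLast ps b = subst₂ _≤_ (sym (length-incLast ps)) (sym (starts-incLast ps)) b

balanced-incLast⁻ : ∀ ps → Balanced (incLast ps) → Balanced ps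
balanced-incLast⁻ ps b = subst₂ _≤_ (length-incLast ps) (starts-incLast ps) b

-- The later siblings of any vertex have at least as many inner vertices as leaves.
Good : Forest → Set
Good ε          = ⊤
Good (node A B) = Good A × Good B × Balanced (peaks B)

-- The step of index m is the first return of the upper path; the lower path returns no later.
ReturnsBefore : Peaks → Set
ReturnsBefore ps = ∀ m → m < length ps → m < ends (take (suc m) ps) →
                   ∃[ m′ ] m′ ≤ m × m′ < starts (take (suc m′) ps)

-- Cutting a forest behind a leaf leaves the groups of later siblings of the vertices above the cut,
-- one after another. Each group is balanced, and the ends added by ancestors affect neither length
-- nor starts.
good⇒balanced-drop : ∀ T → Good T → ∀ t → Balanced (drop (suc t) (peaks T))
good⇒balanced-drop ε          _              t = z≤n
good⇒balanced-drop (node A B) (gA , gB , bB) t =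
  subst Balanced (sym (drop-++ (suc t) (enclose (peaks A)) (peaks B)))
    (balanced-++ (drop (suc t) (enclose (peaks A))) _
      (subst Balanced (sym (drop-enclose t (peaks A)))
        (balanced-incLast (drop (suc t) (peaks A)) (good⇒balanced-drop A gA t)))
      (rest (suc t ∸ length (enclose (peaks A)))))
  where
  rest : ∀ u → Balanced (drop u (peaks B))
  rest zero    = bB
  rest (suc u) = good⇒balanced-drop B gB u

-- In a whole forest the starts dominate the ends, so m itself serves. In a suffix that begins among
-- the children A, an index before the last leaf of A does not see the end of the parent and falls
-- to induction; any later index is served by that last leaf, because the part inside A is balanced.
good⇒returnsBefore : ∀ T → Good T → ∀ t → ReturnsBefore (drop (suc t) (peaks T))
good⇒returnsBefore ε          _              t m m<   = ⊥-elim (n≮0 m<)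
good⇒returnsBefore (node A B) (gA , gB , bB) t =
  subst ReturnsBefore (sym (drop-++ (suc t) (enclose (peaks A)) (peaks B)))
    (subst (λ xs → ReturnsBefore (xs ++ drop u (peaks B))) (sym (drop-enclose t (peaks A)))
      (goal (drop (suc t) (peaks A)) refl))
  where
  u = suc t ∸ length (enclose (peaks A))

  fromB : ∀ u → ReturnsBefore (drop u (peaks B))
  fromB zero    m m< h = m , ≤-refl , ≤-trans h (dominated-peaks B (suc m))
  fromB (suc u) = good⇒returnsBefore B gB u

  goal : ∀ xs → xs ≡ drop (suc t) (peaks A) → ReturnsBefore (incLast xs ++ drop u (peaks B))
  goal []       eq = fromB u
  goal (x ∷ xs) eq m m< h with suc m <? length (x ∷ xs)
  ... | yes sm< =
    let m′ , m′≤m , h′ = subst ReturnsBefore (sym eq) (good⇒returnsBefore A gA t) m (<⇒≤ sm<)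
                           (subst (λ ys → m < ends ys)
                             (trans (take-++-≤ (suc m) (incLast (x ∷ xs)) (subst (suc m ≤_) (sym (length-incLast (x ∷ xs))) (<⇒≤ sm<)))
                                    (take-incLast (suc m) (x ∷ xs) sm<)) h)
        m′<  = ≤-<-trans m′≤m (<⇒≤ sm<)
        m′<′ = subst (suc m′ ≤_) (sym (length-incLast (x ∷ xs))) m′<
    in m′ , m′≤m ,
       subst (m′ <_) (sym (trans (cong starts (take-++-≤ (suc m′) (incLast (x ∷ xs)) m′<′)) (starts-take-incLast (suc m′) (x ∷ xs)))) h′
  ... | no sm≮ =
    length xs , s≤s⁻¹ (≮⇒≥ sm≮) ,
    subst (length xs <_)
      (sym (trans (cong starts (take-++-≤ (length (x ∷ xs)) (incLast (x ∷ xs)) (≤-reflexive (sym (length-incLast (x ∷ xs))))))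
        (trans (starts-take-incLast (length (x ∷ xs)) (x ∷ xs)) (cong starts (take-all (length (x ∷ xs)) (x ∷ xs) ≤-refl)))))
      (subst Balanced (sym eq) (good⇒balanced-drop A gA t))

-- Read from the right, each suffix is closed off by a return followed by a shorter balanced suffix.
returnsBefore⇒balanced :
  ∀ n ps → length ps ≤ n → (∀ t → ReturnsBefore (drop t ps)) →
  (∀ t → Balanced (drop (suc t) ps) → t < length ps → length (drop t ps) ≤ ends (drop t ps)) → Balanced ps
returnsBefore⇒balanced n       []       _        ret suff = z≤n
returnsBefore⇒balanced (suc n) (p ∷ ps) (s≤s l≤) ret suff =
  let tail = λ t → returnsBefore⇒balanced n (drop t ps) (≤-trans (≤-trans (≤-reflexive (length-drop t ps)) (m∸n≤m (length ps) t)) l≤)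
                (λ t′ → subst ReturnsBefore (sym (drop-drop t t′ ps)) (ret (suc (t + t′))))
                (λ t′ b t′< → subst (λ xs → length xs ≤ ends xs) (sym (drop-drop t t′ ps))
                   (suff (suc (t + t′)) (subst Balanced (trans (drop-drop t (suc t′) ps) (cong (λ v → drop v ps) (+-suc t t′))) b)
                     (s≤s (length-drop-< t ps t′<))))
      m′ , m′≤m , h = ret 0 (length ps) ≤-refl
                        (subst (λ xs → length ps < ends xs) (sym (take-all (length (p ∷ ps)) (p ∷ ps) ≤-refl))
                          (suff 0 (tail 0) z<s))
  in begin
    length (p ∷ ps)                                                ≡⟨ cong length (take++drop≡id (suc m′) (p ∷ ps)) ⟨
    length (take (suc m′) (p ∷ ps) ++ drop m′ ps)                  ≡⟨ length-++ (take (suc m′) (p ∷ ps)) ⟩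
    length (take (suc m′) (p ∷ ps)) + length (drop m′ ps)          ≤⟨ +-mono-≤ (≤-trans (≤-reflexive (length-take (suc m′) (p ∷ ps))) (≤-trans (m⊓n≤m (suc m′) _) h)) (tail m′) ⟩
    starts (take (suc m′) (p ∷ ps)) + starts (drop m′ ps)          ≡⟨ starts-split (suc m′) (p ∷ ps) ⟩
    starts (p ∷ ps)                                                ∎
  where
  open ≤-Reasoning

returnsBefore-++⁻ˡ : ∀ ps {qs} → ReturnsBefore (ps ++ qs) → ReturnsBefore ps
returnsBefore-++⁻ˡ ps ret m m< h =
    let m′ , m′≤m , h′ = ret m (≤-trans m< (length-++-≤ˡ ps)) (subst (λ xs → m < ends xs) (sym (take-++-≤ (suc m) ps m<)) h)
    in m′ , m′≤m , subst (λ xs → m′ < starts xs) (take-++-≤ (suc m′) ps (≤-<-trans m′≤m m<)) h′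

returnsBefore-incLast⁻ : ∀ ps → ReturnsBefore (incLast ps) → ReturnsBefore ps
returnsBefore-incLast⁻ ps ret m m< h =
  let m′ , m′≤m , h′ = ret m (subst (m <_) (sym (length-incLast ps)) m<) (≤-trans h (ends-take-incLast-≥ (suc m) ps))
  in m′ , m′≤m , subst (m′ <_) (starts-take-incLast (suc m′) ps) h′

-- Suffixes of `peaks B` are proper suffixes of the whole list, so B inherits both hypotheses.
-- Suffixes of `peaks A` are followed by `peaks B` and inherit only the returns; `goodA` regains
-- their balance. No parent closes the top level, so balance is a hypothesis there.
returnsBefore⇒good : ∀ T → (∀ t → Balanced (drop (suc t) (peaks T))) →
                     (∀ t → ReturnsBefore (drop (suc t) (peaks T))) → Good T
returnsBefore⇒good ε          _   _   = tt
returnsBefore⇒good (node A B) bal ret = goodA A refl , returnsBefore⇒good B balB retB , subst Balanced (dropB 0) (bal′ 0)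
  where
  a = enclose (peaks A)
  n = length a

  dropB : ∀ t → drop (n + t) (a ++ peaks B) ≡ drop t (peaks B)
  dropB t = drop-length-++ t a (peaks B)

  n+ : ∀ t → ∃[ v ] n + t ≡ suc v
  n+ t with n | 0<length-enclose (peaks A)
  ... | suc v | _ = v + t , refl

  bal′ : ∀ t → Balanced (drop (n + t) (a ++ peaks B))
  bal′ t = subst (λ v → Balanced (drop v (a ++ peaks B))) (sym (proj₂ (n+ t))) (bal (proj₁ (n+ t)))

  balB : ∀ t → Balanced (drop (suc t) (peaks B))
  balB t = subst Balanced (dropB (suc t)) (bal′ (suc t))

  retB : ∀ t → ReturnsBefore (drop (suc t) (peaks B))
  retB t = subst ReturnsBefore (dropB (suc t))
    (subst (λ v → ReturnsBefore (drop v (a ++ peaks B))) (sym (proj₂ (n+ (suc t)))) (ret (proj₁ (n+ (suc t)))))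

  retA : ∀ t → ReturnsBefore (incLast (drop (suc t) (peaks A)))
  retA t = subst ReturnsBefore (drop-enclose t (peaks A))
    (returnsBefore-++⁻ˡ (drop (suc t) a) (subst ReturnsBefore (drop-++ (suc t) a (peaks B)) (ret t)))

  -- An inner vertex with children A ends at the last leaf of A without starting in a proper
  -- suffix, which gives the suffixes one more end than starts.
  goodA : ∀ A′ → A ≡ A′ → Good A′
  goodA ε              _    = tt
  goodA A′@(node _ _) refl = returnsBefore⇒good A′ balA (λ t → returnsBefore-incLast⁻ (drop (suc t) (peaks A)) (retA t))
    where
    suffix : ∀ qs → starts qs ≤ ends qs → Balanced (drop 1 (incLast qs)) → 0 < length qs → length (incLast qs) ≤ ends (incLast qs)
    suffix qs@(q ∷ qs′) s≤e b _ = begin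
      length (incLast qs)     ≡⟨ length-incLast qs ⟩
      suc (length qs′)        ≤⟨ s≤s (balanced-incLast⁻ qs′ (subst Balanced (drop-incLast 1 qs) b)) ⟩
      suc (starts qs′)        ≤⟨ s≤s (m≤n+m (starts qs′) (proj₁ q)) ⟩
      suc (starts qs)         ≤⟨ s≤s s≤e ⟩
      suc (ends qs)           ≡⟨ ends-incLast qs (λ ()) ⟨
      ends (incLast qs)       ∎
      where open ≤-Reasoning

    balA : ∀ t → Balanced (drop (suc t) (peaks A))
    balA t = balanced-incLast⁻ (drop (suc t) (peaks A)) (returnsBefore⇒balanced _ (incLast (drop (suc t) (peaks A))) ≤-refl
      (λ t′ → subst ReturnsBefore (sym (shiftA t′)) (retA (t + t′)))
      (λ t′ b t′< → subst (λ xs → length xs ≤ ends xs) (sym (shiftA t′))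
        (suffix (drop (suc (t + t′)) (peaks A))
          (starts-drop≤ends-drop (peaks A) (starts≡ends A) (dominated-peaks A) (suc (t + t′)))
          (subst Balanced (trans (shiftA (suc t′)) (trans (cong (λ v → incLast (drop v (peaks A))) (cong suc (+-suc t t′)))
              (sym (trans (drop-incLast 1 (drop (suc (t + t′)) (peaks A)))
                (cong incLast (trans (drop-drop (suc (t + t′)) 1 (peaks A)) (cong (λ v → drop v (peaks A)) (+-comm (suc (t + t′)) 1))))))) ) b)
          (positive t′ t′<))))
      where
      shiftA : ∀ t′ → drop t′ (incLast (drop (suc t) (peaks A))) ≡ incLast (drop (suc (t + t′)) (peaks A))
      shiftA t′ = trans (drop-incLast t′ (drop (suc t) (peaks A))) (cong incLast (drop-drop (suc t) t′ (peaks A)))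

      positive : ∀ t′ → t′ < length (incLast (drop (suc t) (peaks A))) → 0 < length (drop (suc (t + t′)) (peaks A))
      positive t′ t′< = subst (0 <_) (trans (sym (length-drop t′ _)) (trans (cong length (shiftA t′)) (length-incLast (drop (suc (t + t′)) (peaks A)))))
                          (m<n⇒0<n∸m t′<)

-- The number of up-steps of a lattice word left unmatched is the maximum over its suffixes of
-- length minus number of down-steps; an up-step unmatched on the lower path is unmatched on the
-- upper one.
unmatched-≤ : ∀ n ps → length ps ≤ n → (∀ t → ReturnsBefore (drop t ps)) →
              ∃[ t ] length ps + ends (drop t ps) ≤ length (drop t ps) + starts ps
unmatched-≤ n       []       _        ret = 0 , z≤n
unmatched-≤ (suc n) (p ∷ ps) (s≤s l≤) ret
  with anyUpTo? (λ m → m <? starts (take (suc m) (p ∷ ps))) (length (p ∷ ps))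
... | yes (m , m< , h) =
  let t , ih = unmatched-≤ n (drop m ps) (≤-trans (≤-trans (≤-reflexive (length-drop m ps)) (m∸n≤m (length ps) m)) l≤)
                 (λ t′ → subst ReturnsBefore (sym (drop-drop m t′ ps)) (ret (suc (m + t′))))
      q   = drop t (drop m ps)
      eq  = drop-drop m t ps
  in suc (m + t) , subst (λ xs → length (p ∷ ps) + ends xs ≤ length xs + starts (p ∷ ps)) eq (begin
    length (p ∷ ps) + ends q                            ≡⟨ cong (λ xs → length xs + ends q) (take++drop≡id (suc m) (p ∷ ps)) ⟨
    length (prefix m ++ drop m ps) + ends q             ≡⟨ cong (_+ ends q) (length-++ (prefix m)) ⟩
    length (prefix m) + length (drop m ps) + ends q     ≡⟨ +-assoc (length (prefix m)) _ _ ⟩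
    length (prefix m) + (length (drop m ps) + ends q)   ≤⟨ +-mono-≤ (≤-trans (≤-reflexive (length-take (suc m) (p ∷ ps))) (≤-trans (m⊓n≤m (suc m) _) h)) ih ⟩
    starts (prefix m) + (length q + starts (drop m ps)) ≡⟨ x+[y+z] (starts (prefix m)) (length q) _ ⟩
    length q + (starts (prefix m) + starts (drop m ps)) ≡⟨ cong (length q +_) (starts-split (suc m) (p ∷ ps)) ⟩
    length q + starts (p ∷ ps)                          ∎)
  where
  open ≤-Reasoning
  prefix : ℕ → Peaks
  prefix m = take (suc m) (p ∷ ps)
  x+[y+z] : ∀ x y z → x + (y + z) ≡ y + (x + z)
  x+[y+z] = solve-∀
-- The lower path has no return, hence neither has the upper one, and every nonempty prefix has
-- fewer ends than peaks. This spare unit pays for the peak p, so the whole word is the maximizing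
-- suffix.
... | no ∄m =
  let t , ih = unmatched-≤ n ps l≤ (λ t′ → ret (suc t′))
      q = drop t ps
      p′ = take (suc t) (p ∷ ps)
  in 0 , +-monoʳ-≤ (length (p ∷ ps)) (≤-trans (+-cancelˡ-≤ (length (p ∷ ps)) _ _ (begin
    length (p ∷ ps) + ends (p ∷ ps)         ≡⟨ cong (length (p ∷ ps) +_) (ends-split (suc t) (p ∷ ps)) ⟨
    length (p ∷ ps) + (ends p′ + ends q)    ≡⟨ suc-shift (length ps) (ends p′) (ends q) ⟩
    suc (ends p′) + (length ps + ends q)    ≤⟨ +-mono-≤ (short t) ih ⟩
    length p′ + (length q + starts ps)      ≡⟨ +-assoc (length p′) (length q) (starts ps) ⟨
    length p′ + length q + starts ps        ≡⟨ cong (_+ starts ps) (length-++ p′) ⟨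
    length (p′ ++ q) + starts ps            ≡⟨ cong (λ xs → length xs + starts ps) (take++drop≡id (suc t) (p ∷ ps)) ⟩
    length (p ∷ ps) + starts ps             ∎)) (m≤n+m (starts ps) (proj₁ p)))
  where
  open ≤-Reasoning
  suc-shift : ∀ x y z → suc x + (y + z) ≡ suc y + (x + z)
  suc-shift = solve-∀

  short′ : ∀ t → t < length (p ∷ ps) → ends (take (suc t) (p ∷ ps)) ≤ t
  short′ t t< = ≮⇒≥ λ h → let m′ , m′≤t , h′ = ret 0 t t< h in ∄m (m′ , ≤-<-trans m′≤t t< , h′)

  short : ∀ t → ends (take (suc t) (p ∷ ps)) < length (take (suc t) (p ∷ ps))
  short t with t <? length (p ∷ ps)
  ... | yes t< = subst (ends (take (suc t) (p ∷ ps)) <_) (sym (trans (length-take (suc t) (p ∷ ps)) (m≤n⇒m⊓n≡m t<))) (s≤s (short′ t t<))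
  ... | no  t≮ = subst (λ xs → ends xs < length xs)
                   (trans (take-all (length (p ∷ ps)) (p ∷ ps) ≤-refl) (sym (take-all (suc t) (p ∷ ps) (m≤n⇒m≤1+n (≮⇒≥ t≮)))))
                   (subst (λ xs → ends (p ∷ take (length ps) ps) < length xs) (sym (take-all (length (p ∷ ps)) (p ∷ ps) ≤-refl))
                     (s≤s (short′ (length ps) ≤-refl)))

-- The Tamari order implies containment of the paths. On a prefix, the up-steps unmatched on the
-- lower path are bounded by `unmatched-≤` through some final part q of the upper path; the ballot
-- condition on the initial part p extends the bound to the whole prefix.
returnsBefore⇒dominated : ∀ ps → (∀ t → ends (take t ps) ≤ length (take t ps)) →
                          (∀ t → ReturnsBefore (drop t ps)) → Dominated ps
returnsBefore⇒dominated ps ballot ret t with unmatched-≤ (length (take t ps)) (take t ps) ≤-refl ret′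
  where
  ret′ : ∀ u → ReturnsBefore (drop u (take t ps))
  ret′ u = returnsBefore-++⁻ˡ (drop u (take t ps))
    (subst ReturnsBefore (trans (cong (drop u) (sym (take++drop≡id t ps))) (drop-++ u (take t ps) (drop t ps))) (ret u))
... | u , le = +-cancelˡ-≤ (length ys) _ _ (begin
    length ys + ends ys             ≡⟨ cong (length ys +_) (ends-split u ys) ⟨
    length ys + (ends p + ends q)   ≡⟨ x+[y+z] (length ys) (ends p) (ends q) ⟩
    ends p + (length ys + ends q)   ≤⟨ +-mono-≤ ballot′ le ⟩
    length p + (length q + starts ys) ≡⟨ +-assoc (length p) (length q) (starts ys) ⟨
    length p + length q + starts ys ≡⟨ cong (_+ starts ys) (length-++ p) ⟨
    length (p ++ q) + starts ys     ≡⟨ cong (λ xs → length xs + starts ys) (take++drop≡id u ys) ⟩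
    length ys + starts ys           ∎)
  where
  open ≤-Reasoning
  ys = take t ps
  p  = take u ys
  q  = drop u ys
  x+[y+z] : ∀ x y z → x + (y + z) ≡ y + (x + z)
  x+[y+z] = solve-∀
  ballot′ : ends p ≤ length p
  ballot′ = subst (λ xs → ends xs ≤ length xs) (sym (take-take u t ps)) (ballot (u ⊓ t))

-- Parenthesis words, their unique reading and their parsing

parens : Forest → List Step
parens ε          = []
parens (node A B) = U ∷ parens A ++ D ∷ parens B

path : Peaks → List Step
path []             = []
path ((a , b) ∷ ps) = U ∷ replicate a U ++ D ∷ replicate b D ++ path ps

replicate-∷ʳ : ∀ {a} {A : Set a} n (x : A) ys → replicate n x ++ x ∷ ys ≡ x ∷ replicate n x ++ ys
replicate-∷ʳ zero    x ys = refl
replicate-∷ʳ (suc n) x ys = cong (x ∷_) (replicate-∷ʳ n x ys)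

path-++ : ∀ ps qs → path (ps ++ qs) ≡ path ps ++ path qs
path-++ []             qs = refl
path-++ ((a , b) ∷ ps) qs = cong (U ∷_) (begin
  replicate a U ++ D ∷ replicate b D ++ path (ps ++ qs)             ≡⟨ cong (λ w → replicate a U ++ D ∷ replicate b D ++ w) (path-++ ps qs) ⟩
  replicate a U ++ D ∷ replicate b D ++ path ps ++ path qs          ≡⟨ cong (λ w → replicate a U ++ D ∷ w) (++-assoc (replicate b D) (path ps) (path qs)) ⟨
  replicate a U ++ D ∷ (replicate b D ++ path ps) ++ path qs        ≡⟨ ++-assoc (replicate a U) (D ∷ replicate b D ++ path ps) (path qs) ⟨
  (replicate a U ++ D ∷ replicate b D ++ path ps) ++ path qs        ∎)
  where open ≡-Reasoning

path-incLast : ∀ p ps → path (incLast (p ∷ ps)) ≡ path (p ∷ ps) ++ [ D ]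
path-incLast (a , b) [] = cong (U ∷_) (begin
  replicate a U ++ D ∷ D ∷ replicate b D ++ []           ≡⟨ cong (λ w → replicate a U ++ D ∷ w) (replicate-∷ʳ b D []) ⟨
  replicate a U ++ D ∷ replicate b D ++ [ D ]            ≡⟨ cong (λ w → replicate a U ++ D ∷ w ++ [ D ]) (++-identityʳ (replicate b D)) ⟨
  replicate a U ++ D ∷ (replicate b D ++ []) ++ [ D ]    ≡⟨ ++-assoc (replicate a U) (D ∷ replicate b D ++ []) [ D ] ⟨
  (replicate a U ++ D ∷ replicate b D ++ []) ++ [ D ]    ∎)
  where open ≡-Reasoning
path-incLast p (q ∷ ps) = begin
  path (p ∷ incLast (q ∷ ps))        ≡⟨ path-++ [ p ] (incLast (q ∷ ps)) ⟩
  path [ p ] ++ path (incLast (q ∷ ps)) ≡⟨ cong (path [ p ] ++_) (path-incLast q ps) ⟩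
  path [ p ] ++ path (q ∷ ps) ++ [ D ] ≡⟨ ++-assoc (path [ p ]) (path (q ∷ ps)) [ D ] ⟨
  (path [ p ] ++ path (q ∷ ps)) ++ [ D ] ≡⟨ cong (_++ [ D ]) (path-++ [ p ] (q ∷ ps)) ⟨
  path (p ∷ q ∷ ps) ++ [ D ]         ∎
  where open ≡-Reasoning

path-enclose : ∀ ps → path (enclose ps) ≡ U ∷ path ps ++ [ D ]
path-enclose []             = refl
path-enclose ((a , b) ∷ ps) = path-incLast (suc a , b) ps

path-peaks : ∀ T → path (peaks T) ≡ parens T
path-peaks ε          = refl
path-peaks (node A B) = begin
  path (enclose (peaks A) ++ peaks B)           ≡⟨ path-++ (enclose (peaks A)) (peaks B) ⟩
  path (enclose (peaks A)) ++ path (peaks B)    ≡⟨ cong₂ _++_ (path-enclose (peaks A)) (path-peaks B) ⟩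
  U ∷ (path (peaks A) ++ [ D ]) ++ parens B     ≡⟨ cong (U ∷_) (++-assoc (path (peaks A)) [ D ] (parens B)) ⟩
  U ∷ path (peaks A) ++ D ∷ parens B            ≡⟨ cong (λ w → U ∷ w ++ D ∷ parens B) (path-peaks A) ⟩
  U ∷ parens A ++ D ∷ parens B                  ∎
  where open ≡-Reasoning

NotU : List Step → Set
NotU []      = ⊤
NotU (U ∷ _) = ⊥
NotU (D ∷ _) = ⊤

-- A following letter other than U marks where the forest stops. Both the down-step that closes a
-- vertex and the outer tail are of this kind, so the induction can pass from the children to the
-- siblings.
parens-prefix : ∀ T T′ {v v′} → NotU v → NotU v′ → parens T ++ v ≡ parens T′ ++ v′ → T ≡ T′ × v ≡ v′
parens-prefix ε          ε            _  _  eq   = refl , eq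
parens-prefix ε          (node _ _)   nv _  refl = ⊥-elim nv
parens-prefix (node _ _) ε            _  nv refl = ⊥-elim nv
parens-prefix (node A B) (node A′ B′) {v} {v′} nv nv′ eq
  with refl , eqB ← parens-prefix A A′ {D ∷ parens B ++ v} {D ∷ parens B′ ++ v′} tt tt
         (trans (sym (++-assoc (parens A) (D ∷ parens B) v)) (trans (∷-injectiveʳ eq) (++-assoc (parens A′) (D ∷ parens B′) v′)))
  with refl , eqv ← parens-prefix B B′ nv nv′ (∷-injectiveʳ eqB)
  = refl , eqv

peaks-injective : ∀ T T′ → peaks T ≡ peaks T′ → T ≡ T′
peaks-injective T T′ eq = proj₁ (parens-prefix T T′ {[]} {[]} tt tt
  (trans (++-identityʳ (parens T)) (trans (trans (sym (path-peaks T)) (trans (cong path eq) (path-peaks T′))) (sym (++-identityʳ (parens T′))))))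

NotD : List Step → Set
NotD []      = ⊤
NotD (U ∷ _) = ⊤
NotD (D ∷ _) = ⊥

path-notD : ∀ ps → NotD (path ps)
path-notD []       = tt
path-notD (p ∷ ps) = tt

replicate-U-injective : ∀ a a′ {v v′} → NotU v → NotU v′ → replicate a U ++ v ≡ replicate a′ U ++ v′ → a ≡ a′ × v ≡ v′
replicate-U-injective zero    zero     _  _  eq   = refl , eq
replicate-U-injective zero    (suc a′) nv _  refl = ⊥-elim nv
replicate-U-injective (suc a) zero     _  nv refl = ⊥-elim nv
replicate-U-injective (suc a) (suc a′) nv nv′ eq with refl , eq′ ← replicate-U-injective a a′ nv nv′ (∷-injectiveʳ eq) = refl , eq′

replicate-D-injective : ∀ a a′ {v v′} → NotD v → NotD v′ → replicate a D ++ v ≡ replicate a′ D ++ v′ → a ≡ a′ × v ≡ v′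
replicate-D-injective zero    zero     _  _  eq   = refl , eq
replicate-D-injective zero    (suc a′) nv _  refl = ⊥-elim nv
replicate-D-injective (suc a) zero     _  nv refl = ⊥-elim nv
replicate-D-injective (suc a) (suc a′) nv nv′ eq with refl , eq′ ← replicate-D-injective a a′ nv nv′ (∷-injectiveʳ eq) = refl , eq′

path-injective : ∀ ps qs → path ps ≡ path qs → ps ≡ qs
path-injective []             []               _  = refl
path-injective []             (_ ∷ _)          ()
path-injective (_ ∷ _)        []               ()
path-injective ((a , b) ∷ ps) ((a′ , b′) ∷ qs) eq
  with refl , eq₁ ← replicate-U-injective a a′ {D ∷ replicate b D ++ path ps} {D ∷ replicate b′ D ++ path qs} tt tt (∷-injectiveʳ eq)
  with refl , eq₂ ← replicate-D-injective b b′ (path-notD ps) (path-notD qs) (∷-injectiveʳ eq₁)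
  = cong ((a , b) ∷_) (path-injective ps qs eq₂)

-- A forest followed by a stack of forests, each preceded by an unmatched down-step.
stackWord : Forest → List Forest → List Step
stackWord T []       = parens T
stackWord T (S ∷ st) = parens T ++ D ∷ stackWord S st

stackWord-node : ∀ A B st → stackWord (node A B) st ≡ U ∷ parens A ++ D ∷ stackWord B st
stackWord-node A B []       = refl
stackWord-node A B (S ∷ st) = cong (U ∷_) (++-assoc (parens A) (D ∷ parens B) (D ∷ stackWord S st))

parse-U : ∀ a T st {d} → length st ≡ a + d → ∃[ T′ ] ∃[ st′ ] length st′ ≡ d × stackWord T′ st′ ≡ replicate a U ++ stackWord T st
parse-U zero    T st       eq = T , st , eq , refl
parse-U (suc a) T (S ∷ st) eq =
  let T′ , st′ , eq′ , w = parse-U a (node T S) st (suc-injective eq)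
  in T′ , st′ , eq′ , trans w (trans (cong (replicate a U ++_) (stackWord-node T S st)) (replicate-∷ʳ a U _))

parse-D : ∀ b T st → ∃[ T′ ] ∃[ st′ ] length st′ ≡ b + length st × stackWord T′ st′ ≡ replicate b D ++ stackWord T st
parse-D zero    T st = T , st , refl , refl
parse-D (suc b) T st =
  let T′ , st′ , eq , w = parse-D b T st
  in ε , T′ ∷ st′ , cong suc eq , cong (D ∷_) w

-- Read from the right, a down-step puts the current forest on the stack and opens an empty one; an
-- up-step joins the current forest, as children, to the top of the stack, as later siblings. The
-- hypothesis on suffixes keeps the stack deep enough. In `suc a` and `suc b` the additional steps
-- are those of the leaf itself.
parse : ∀ ps → (∀ t → starts (drop t ps) ≤ ends (drop t ps)) →
        ∃[ T ] ∃[ st ] length st + starts ps ≡ ends ps × stackWord T st ≡ path ps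
parse []             _   = ε , [] , refl , refl
parse ((a , b) ∷ ps) dom =
  let T₁ , st₁ , eq₁ , w₁ = parse ps (λ t → dom (suc t))
      T₂ , st₂ , eq₂ , w₂ = parse-D (suc b) T₁ st₁
      d = b + length st₁ ∸ a
      T₃ , st₃ , eq₃ , w₃ = parse-U (suc a) T₂ st₂ {d} (trans eq₂ (cong suc (sym (m+[n∸m]≡n (a≤ st₁ eq₁)))))
  in T₃ , st₃ ,
     (begin
       length st₃ + (a + starts ps)         ≡⟨ cong (_+ (a + starts ps)) eq₃ ⟩
       d + (a + starts ps)                  ≡⟨ +-assoc d a (starts ps) ⟨
       d + a + starts ps                    ≡⟨ cong (_+ starts ps) (m∸n+n≡m (a≤ st₁ eq₁)) ⟩
       b + length st₁ + starts ps           ≡⟨ +-assoc b _ _ ⟩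
       b + (length st₁ + starts ps)         ≡⟨ cong (b +_) eq₁ ⟩
       b + ends ps                          ∎) ,
     trans w₃ (cong (λ w → U ∷ replicate a U ++ w) (trans w₂ (cong (λ w → D ∷ replicate b D ++ w) w₁)))
  where
  open ≡-Reasoning
  a≤ : ∀ (st : List Forest) → length st + starts ps ≡ ends ps → a ≤ b + length st
  a≤ st eq = +-cancelʳ-≤ (starts ps) a (b + length st)
    (≤-trans (dom 0) (≤-reflexive (trans (cong (b +_) (sym eq)) (sym (+-assoc b (length st) (starts ps))))))

peaks-surjective : ∀ ps → starts ps ≡ ends ps → Dominated ps → ∃[ T ] peaks T ≡ ps
peaks-surjective ps total dom with parse ps (starts-drop≤ends-drop ps total dom)
... | T , []     , eq , w = T , path-injective (peaks T) ps (trans (path-peaks T) w)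
-- An unmatched down-step would make the ends outnumber the starts.
... | T , S ∷ st , eq , w = ⊥-elim (<-irrefl total (≤-trans (s≤s (m≤n+m (starts ps) (length st))) (≤-reflexive eq)))

-- Tamari intervals as lists of peaks

word : List ℕ → List Step
word []      = []
word (a ∷ g) = U ∷ replicate a D ++ word g

lower upper : Peaks → List Step
lower ps = word (map proj₁ ps)
upper ps = word (map proj₂ ps)

gammasAux-replicate : ∀ a w → gammasAux (replicate a D ++ w) ≡ (a + proj₁ (gammasAux w) , proj₂ (gammasAux w))
gammasAux-replicate zero    w = refl
gammasAux-replicate (suc a) w rewrite gammasAux-replicate a w = refl

gammasAux-word : ∀ g → gammasAux (word g) ≡ (0 , g)
gammasAux-word []      = refl
gammasAux-word (a ∷ g) rewrite gammasAux-replicate a (word g) | gammasAux-word g | +-identityʳ a = refl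

gammas-word : ∀ g → gammas (word g) ≡ g
gammas-word g = cong proj₂ (gammasAux-word g)

word-gammasAux : ∀ w → replicate (proj₁ (gammasAux w)) D ++ word (gammas w) ≡ w
word-gammasAux []      = refl
word-gammasAux (U ∷ w) = cong (U ∷_) (word-gammasAux w)
word-gammasAux (D ∷ w) = cong (D ∷_) (word-gammasAux w)

word-gammas : ∀ w → PrefixOK w → word (gammas w) ≡ w
word-gammas []      _  = refl
word-gammas (U ∷ w) _  = word-gammasAux (U ∷ w)
word-gammas (D ∷ w) ok = ⊥-elim (n≮0 (ok 1))

countS-++ : ∀ c v w → countS c (v ++ w) ≡ countS c v + countS c w
countS-++ U []      w = refl
countS-++ U (U ∷ v) w = cong suc (countS-++ U v w)
countS-++ U (D ∷ v) w = countS-++ U v w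
countS-++ D []      w = refl
countS-++ D (U ∷ v) w = countS-++ D v w
countS-++ D (D ∷ v) w = cong suc (countS-++ D v w)

countU-replicate : ∀ a → countS U (replicate a D) ≡ 0
countU-replicate zero    = refl
countU-replicate (suc a) = countU-replicate a

countD-replicate : ∀ a → countS D (replicate a D) ≡ a
countD-replicate zero    = refl
countD-replicate (suc a) = cong suc (countD-replicate a)

countU-word : ∀ g → countS U (word g) ≡ length g
countU-word []      = refl
countU-word (a ∷ g) = cong suc (trans (countS-++ U (replicate a D) (word g)) (cong₂ _+_ (countU-replicate a) (countU-word g)))

countD-word : ∀ g → countS D (word g) ≡ sum g
countD-word []      = refl
countD-word (a ∷ g) = trans (countS-++ D (replicate a D) (word g)) (cong₂ _+_ (countD-replicate a) (countD-word g))

take-word : ∀ t g → ∃[ j ] take j (word g) ≡ word (take t g)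
take-word zero    g       = 0 , refl
take-word (suc t) []      = 0 , refl
take-word (suc t) (a ∷ g) with take-word t g
... | j , eq = suc (a + j) , cong (U ∷_) (trans (go a) (cong (replicate a D ++_) eq))
  where
  go : ∀ a → take (a + j) (replicate a D ++ word g) ≡ replicate a D ++ take j (word g)
  go zero    = refl
  go (suc a) = cong (D ∷_) (go a)

Ballot : List ℕ → Set
Ballot g = ∀ t → sum (take t g) ≤ length (take t g)

prefixOK⇒ballot : ∀ g → PrefixOK (word g) → Ballot g
prefixOK⇒ballot g ok t = let j , eq = take-word t g in
  subst₂ _≤_ (trans (cong (countS D) eq) (countD-word (take t g))) (trans (cong (countS U) eq) (countU-word (take t g))) (ok j)

countD-take-replicate : ∀ j a → countS D (take j (replicate a D)) ≤ a
countD-take-replicate zero    a       = z≤n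
countD-take-replicate (suc j) zero    = z≤n
countD-take-replicate (suc j) (suc a) = s≤s (countD-take-replicate j a)

countU-take-replicate : ∀ j a → countS U (take j (replicate a D)) ≡ 0
countU-take-replicate zero    a       = refl
countU-take-replicate (suc j) zero    = refl
countU-take-replicate (suc j) (suc a) = countU-take-replicate j a

-- A cut inside a run of D only lowers the number of D, so the Dyck condition need only be tested at
-- the ends of blocks.
count-take-word : ∀ g j → ∃[ t ] countS U (take j (word g)) ≡ length (take t g) × countS D (take j (word g)) ≤ sum (take t g)
count-take-word []      zero    = 0 , refl , z≤n
count-take-word []      (suc j) = 0 , refl , z≤n
count-take-word (a ∷ g) zero    = 0 , refl , z≤n
count-take-word (a ∷ g) (suc j) with count-take-word g (j ∸ length (replicate a D))
... | t , eq , le = suc t ,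
  cong suc (trans (cong (countS U) (take-++ j (replicate a D) (word g)))
             (trans (countS-++ U (take j (replicate a D)) _) (cong₂ _+_ (countU-take-replicate j a) eq))) ,
  ≤-trans (≤-reflexive (trans (cong (countS D) (take-++ j (replicate a D) (word g))) (countS-++ D (take j (replicate a D)) _)))
          (+-mono-≤ (countD-take-replicate j a) le)

ballot⇒prefixOK : ∀ g → Ballot g → PrefixOK (word g)
ballot⇒prefixOK g ok j = let t , eq , le = count-take-word g j in ≤-trans le (≤-trans (ok t) (≤-reflexive (sym eq)))

ballot⇒isDyck : ∀ {k} g → length g ≡ k → sum g ≡ k → Ballot g → IsDyck k (word g)
ballot⇒isDyck g l s ok = trans (countU-word g) l , trans (countD-word g) s , ballot⇒prefixOK g ok

isDyck⇒ballot : ∀ {k} w → IsDyck k w → ∃[ g ] word g ≡ w × length g ≡ k × sum g ≡ k × Ballot g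
isDyck⇒ballot w (u , d , ok) = gammas w , eq ,
  trans (sym (countU-word (gammas w))) (trans (cong (countS U) eq) u) ,
  trans (sym (countD-word (gammas w))) (trans (cong (countS D) eq) d) ,
  prefixOK⇒ballot (gammas w) (subst PrefixOK (sym eq) ok)
  where eq = word-gammas w ok

unzipped : ∀ (g g′ : List ℕ) → length g ≡ length g′ → ∃[ ps ] map proj₁ ps ≡ g × map proj₂ ps ≡ g′
unzipped []      []       _  = [] , refl , refl
unzipped (a ∷ g) (b ∷ g′) eq with unzipped g g′ (suc-injective eq)
... | ps , refl , refl = (a , b) ∷ ps , refl , refl

ballot⇒balanced-drop : ∀ ps → length ps ≡ starts ps → (∀ t → starts (take t ps) ≤ length (take t ps)) →
                       ∀ t → Balanced (drop t ps)
ballot⇒balanced-drop ps total ballot t = +-cancelˡ-≤ (length (take t ps)) _ _ (begin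
  length (take t ps) + length (drop t ps)   ≡⟨ length-++ (take t ps) ⟨
  length (take t ps ++ drop t ps)           ≡⟨ cong length (take++drop≡id t ps) ⟩
  length ps                                 ≡⟨ total ⟩
  starts ps                                 ≡⟨ starts-split t ps ⟨
  starts (take t ps) + starts (drop t ps)   ≤⟨ +-monoˡ-≤ _ (ballot t) ⟩
  length (take t ps) + starts (drop t ps)   ∎)
  where open ≤-Reasoning

-- `InInt` for the words of `ps`, restated on peaks so that inductions on forests apply; the Tamari
-- order becomes `returnsBefore`.
record Interval (k : ℕ) (ps : Peaks) : Set where
  field
    length≡       : length ps ≡ k
    starts≡       : starts ps ≡ k
    ends≡         : ends ps ≡ k
    lowerBallot   : ∀ t → starts (take t ps) ≤ length (take t ps)
    upperBallot   : ∀ t → ends (take t ps) ≤ length (take t ps)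
    returnsBefore : ∀ t → ReturnsBefore (drop t ps)

  balanced-drop : ∀ t → Balanced (drop t ps)
  balanced-drop = ballot⇒balanced-drop ps (trans length≡ (sym starts≡)) lowerBallot

-- If 0 does not qualify, t + 1 < f (t + 1) is the same problem for the function shifted by one in
-- argument and value.
least : ∀ (f : ℕ → ℕ) t → t < f t → ∃[ t₀ ] t₀ ≤ t × t₀ < f t₀ × (∀ t′ → t′ < t₀ → f t′ ≤ t′)
least f t h with 0 <? f 0
least f t       h | yes p = 0 , z≤n , p , λ t′ ()
least f zero    h | no ¬p = ⊥-elim (¬p h)
least f (suc t) h | no ¬p with least (λ i → f (suc i) ∸ 1) t (0<∸ h)
  where
  0<∸ : ∀ {m n} → suc m < n → m < n ∸ 1
  0<∸ (s≤s h) = h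
... | t₀ , t₀≤ , h₀ , min = suc t₀ , s≤s t₀≤ , <∸1 h₀ , λ where
    zero     _         → ≮⇒≥ ¬p
    (suc t′) (s≤s t′<) → ∸1≤ (min t′ t′<)
  where
  <∸1 : ∀ {m n} → m < n ∸ 1 → suc m < n
  <∸1 {n = suc n} h = s≤s h
  ∸1≤ : ∀ {m n} → n ∸ 1 ≤ m → n ≤ suc m
  ∸1≤ {n = zero}  _ = z≤n
  ∸1≤ {n = suc n} h = s≤s h

module _ (ps : Peaks) where

  partialSum-lower : ∀ u t → partialSum (lower ps) (suc u) t ≡ starts (take (suc t) (drop u ps))
  partialSum-lower u t = cong sum (trans (cong (λ g → take (suc t) (drop u g)) (gammas-word (map proj₁ ps)))
    (trans (cong (take (suc t)) (drop-map u ps)) (take-map (suc t) (drop u ps))))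

  partialSum-upper : ∀ u t → partialSum (upper ps) (suc u) t ≡ ends (take (suc t) (drop u ps))
  partialSum-upper u t = cong sum (trans (cong (λ g → take (suc t) (drop u g)) (gammas-word (map proj₂ ps)))
    (trans (cong (take (suc t)) (drop-map u ps)) (take-map (suc t) (drop u ps))))

balanced⇒return : ∀ ps {l} → Balanced ps → length ps ≡ suc l → l < starts (take (suc l) ps)
balanced⇒return ps {l} b eq = subst (λ xs → l < starts xs) (sym (take-all (suc l) ps (≤-reflexive eq))) (subst (_≤ starts ps) eq b)

module _ {k : ℕ} {ps : Peaks} (length≡ : length ps ≡ k) where

  -- `TamariLe` compares only values of lon that are exhibited. On the lower path, balance makes the
  -- last index l of the suffix qualify, so a least one exists; on the upper path the given index m
  -- does this.
  tamariLe⇒returnsBefore : (∀ t → Balanced (drop t ps)) → TamariLe k (lower ps) (upper ps) → ∀ t → ReturnsBefore (drop t ps)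
  tamariLe⇒returnsBefore bal tam u m m< h with length (drop u ps) in eq
  ... | suc l =
    let t  , t≤  , h₁ , min₁ = least (partialSum (lower ps) (suc u)) l (subst (l <_) (sym (partialSum-lower ps u l)) (balanced⇒return (drop u ps) (bal u) eq))
        t′ , t′≤ , h₂ , min₂ = least (partialSum (upper ps) (suc u)) m (subst (m <_) (sym (partialSum-upper ps u m)) h)
        u<k = subst (u <_) length≡ (subst (_< length ps) (+-identityʳ u) (length-drop-< u ps (subst (0 <_) (sym eq) z<s)))
    in t , ≤-trans (tam (suc u) (s≤s z≤n) u<k t t′ (h₁ , min₁) (h₂ , min₂)) t′≤ , subst (t <_) (partialSum-lower ps u t) h₁

  returnsBefore⇒tamariLe : (∀ t → Balanced (drop t ps)) → (∀ t → ReturnsBefore (drop t ps)) → TamariLe k (lower ps) (upper ps)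
  returnsBefore⇒tamariLe bal ret (suc u) _ j≤ t t′ (_ , min) (h′ , _) = go (length (drop u ps)) refl
    where
    below : ∀ {m} → m < starts (take (suc m) (drop u ps)) → t ≤ m
    below {m} h = ≮⇒≥ λ m<t → <⇒≱ h (subst (_≤ m) (partialSum-lower ps u m) (min m m<t))

    go : ∀ l → length (drop u ps) ≡ l → t ≤ t′
    go zero    eq = ⊥-elim (<-irrefl (sym eq) (subst (0 <_) (sym (length-drop u ps)) (m<n⇒0<n∸m (subst (u <_) (sym length≡) j≤))))
    go (suc l) eq with t′ ≤? l
    ... | yes t′≤l = let m′ , m′≤ , h = ret u t′ (subst (t′ <_) (sym eq) (s≤s t′≤l)) (subst (t′ <_) (partialSum-upper ps u t′) h′)
                     in ≤-trans (below h) m′≤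
    -- `partialSum` is defined beyond the end of the path. For such a t′ it is enough that the lower
    -- path has returned by the last index l.
    ... | no  t′≰l = ≤-trans (below (balanced⇒return (drop u ps) (bal u) eq)) (<⇒≤ (≰⇒> t′≰l))

map-ballot : ∀ (f : ℕ × ℕ → ℕ) ps → Ballot (map f ps) → ∀ t → sum (map f (take t ps)) ≤ length (take t ps)
map-ballot f ps b t = subst₂ _≤_ (cong sum (take-map t ps)) (trans (cong length (take-map t ps)) (length-map f (take t ps))) (b t)

map-ballot⁻ : ∀ (f : ℕ × ℕ → ℕ) ps → (∀ t → sum (map f (take t ps)) ≤ length (take t ps)) → Ballot (map f ps)
map-ballot⁻ f ps b t = subst₂ _≤_ (cong sum (sym (take-map t ps))) (sym (trans (cong length (take-map t ps)) (length-map f (take t ps)))) (b t)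

interval⇒InInt : ∀ {k ps} → Interval k ps → InInt k (lower ps , upper ps)
interval⇒InInt {k} {ps} I =
  ballot⇒isDyck (map proj₁ ps) (trans (length-map proj₁ ps) length≡) starts≡ (map-ballot⁻ proj₁ ps lowerBallot) ,
  ballot⇒isDyck (map proj₂ ps) (trans (length-map proj₂ ps) length≡) ends≡ (map-ballot⁻ proj₂ ps upperBallot) ,
  returnsBefore⇒tamariLe length≡ balanced-drop returnsBefore
  where open Interval I

InInt⇒interval : ∀ {k Λ Λ′} → InInt k (Λ , Λ′) → ∃[ ps ] Interval k ps × lower ps ≡ Λ × upper ps ≡ Λ′
InInt⇒interval {k} {Λ} {Λ′} (dyck , dyck′ , tam)
  with g , refl , lg , sg , bg ← isDyck⇒ballot Λ dyck
  with g′ , refl , lg′ , sg′ , bg′ ← isDyck⇒ballot Λ′ dyck′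
  with ps , refl , refl ← unzipped g g′ (trans lg (sym lg′))
  = ps , I , refl , refl
  where
  l  = trans (sym (length-map proj₁ ps)) lg
  bl = map-ballot proj₁ ps bg
  I : Interval k ps
  I = record
    { length≡       = l
    ; starts≡       = sg
    ; ends≡         = sg′
    ; lowerBallot   = bl
    ; upperBallot   = map-ballot proj₂ ps bg′
    ; returnsBefore = tamariLe⇒returnsBefore l (ballot⇒balanced-drop ps (trans l (sym sg)) bl) tam
    }

-- Permutations read off a forest

range : ℕ → ℕ → List ℕ
range o zero    = []
range o (suc n) = suc o ∷ range (suc o) n

range1≡range : ∀ n → range1 n ≡ range 0 n
range1≡range n = go 0 id (λ _ → refl) n
  where
  go : ∀ o (f : ℕ → ℕ) → (∀ i → f i ≡ o + i) → ∀ n → map suc (applyUpTo f n) ≡ range o n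
  go o f f≗ zero    = refl
  go o f f≗ (suc n) = cong₂ _∷_ (cong suc (trans (f≗ 0) (+-identityʳ o))) (go (suc o) (f ∘ suc) (λ i → trans (f≗ (suc i)) (+-suc o i)) n)

length-range : ∀ o n → length (range o n) ≡ n
length-range o zero    = refl
length-range o (suc n) = cong suc (length-range (suc o) n)

range-++ : ∀ o m n → range o (m + n) ≡ range o m ++ range (o + m) n
range-++ o zero    n = cong (λ v → range v n) (sym (+-identityʳ o))
range-++ o (suc m) n = cong (suc o ∷_) (trans (range-++ (suc o) m n) (cong (λ v → range (suc o) m ++ range v n) (sym (+-suc o m))))

map-suc-range : ∀ o n → map suc (range o n) ≡ range (suc o) n
map-suc-range o zero    = refl
map-suc-range o (suc n) = cong (suc (suc o) ∷_) (map-suc-range (suc o) n)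

Between : ℕ → ℕ → ℕ → Set
Between o m y = o < y × y ≤ m

range-between : ∀ o n → All (Between o (o + n)) (range o n)
range-between o zero    = []
range-between o (suc n) = (≤-refl , ≤-trans (s≤s (m≤m+n o n)) (≤-reflexive (sym (+-suc o n)))) ∷
  All.map (λ (l , u) → <-trans ≤-refl l , ≤-trans u (≤-reflexive (sym (+-suc o n)))) (range-between (suc o) n)

rootLabel : ℕ → Forest → ℕ
rootLabel o B = suc (o + size B)

-- Readings of the binary search tree with labels o + 1, …, o + size T in which A is the right
-- and B the left subtree of `node A B`.
perm132 perm312 : ℕ → Forest → List ℕ
perm132 o ε          = []
perm132 o (node A B) = perm132 (rootLabel o B) A ++ perm132 o B ++ [ rootLabel o B ]
perm312 o ε          = []
perm312 o (node A B) = perm312 o B ++ perm312 (rootLabel o B) A ++ [ rootLabel o B ]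

range-node : ∀ o A B → range o (size (node A B)) ≡ range o (size B) ++ rootLabel o B ∷ range (rootLabel o B) (size A)
range-node o A B = range-++ o (size B) (suc (size A))

perm132↭range : ∀ o T → perm132 o T ↭ range o (size T)
perm132↭range o ε          = ↭-refl
perm132↭range o (node A B) = ↭-trans (Permₚ.++-comm (perm132 x A) (perm132 o B ++ [ x ]))
  (↭-trans (↭-reflexive (++-assoc (perm132 o B) [ x ] (perm132 x A)))
    (↭-trans (Permₚ.++⁺ (perm132↭range o B) (prep x (perm132↭range x A))) (↭-reflexive (sym (range-node o A B)))))
  where x = rootLabel o B

perm312↭range : ∀ o T → perm312 o T ↭ range o (size T)
perm312↭range o ε          = ↭-refl
perm312↭range o (node A B) = ↭-trans (Permₚ.++⁺ˡ (perm312 o B) (Permₚ.++-comm (perm312 x A) [ x ]))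
  (↭-trans (Permₚ.++⁺ (perm312↭range o B) (prep x (perm312↭range x A))) (↭-reflexive (sym (range-node o A B))))
  where x = rootLabel o B

perm132-between : ∀ o T → All (Between o (o + size T)) (perm132 o T)
perm132-between o T = All-resp-↭ (↭-sym (perm132↭range o T)) (range-between o (size T))

perm312-between : ∀ o T → All (Between o (o + size T)) (perm312 o T)
perm312-between o T = All-resp-↭ (↭-sym (perm312↭range o T)) (range-between o (size T))

rootLabel+size : ∀ o A B → rootLabel o B + size A ≡ o + size (node A B)
rootLabel+size o A B = trans (sym (+-suc (o + size B) (size A))) (+-assoc o (size B) (suc (size A)))

-- Pattern avoidance and the forest of a 132-avoiding word

both : ∀ {A B : Set} → A → B → A ⇔ B
both a b = mk⇔ (λ _ → b) (λ _ → a)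

neither : ∀ {A B : Set} → ¬ A → ¬ B → A ⇔ B
neither ¬a ¬b = mk⇔ (λ a → ⊥-elim (¬a a)) (λ b → ⊥-elim (¬b b))

3≮2 : ¬ 3 < 2
3≮2 (s≤s (s≤s ()))

Avoids132 : List ℕ → Set
Avoids132 π = ∀ {a b c} → a ∷ c ∷ b ∷ [] ⊆ π → a < b → b < c → ⊥

avoids⇒avoids132 : ∀ {π} → Avoids π p132 → Avoids132 π
avoids⇒avoids132 av sub a<b b<c = av _ sub
  ((both (<-trans a<b b<c) (s≤s (s≤s z≤n)) ∷ both a<b (s≤s (s≤s z≤n)) ∷ []) ,
   (neither (<-asym b<c) 3≮2 ∷ []) , [] , tt)

-- `SameOrder` does not exclude equal entries in a descent of the pattern, hence the weak inequality b ≤ c.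
avoids-p132 : ∀ {π} → (∀ {a b c} → a ∷ c ∷ b ∷ [] ⊆ π → a < b → b ≤ c → ⊥) → Avoids π p132
avoids-p132 free (a ∷ c ∷ b ∷ []) sub ((ac ∷ ab ∷ []) , (cb ∷ []) , _) =
  free sub (Equivalence.from ab (s≤s (s≤s z≤n))) (≮⇒≥ (3≮2 ∘ Equivalence.to cb))

avoids-p312 : ∀ {π} → (∀ {a b c} → c ∷ a ∷ b ∷ [] ⊆ π → a < b → b ≤ c → ⊥) → Avoids π p312
avoids-p312 free (c ∷ a ∷ b ∷ []) sub ((ca ∷ cb ∷ []) , (ab ∷ []) , _) =
  free sub (Equivalence.from ab (s≤s (s≤s z≤n))) (≮⇒≥ (3≮2 ∘ Equivalence.to cb))

⊆-++⁻ : ∀ {xs : List ℕ} ys {zs} → xs ⊆ ys ++ zs → ∃[ us ] ∃[ vs ] xs ≡ us ++ vs × us ⊆ ys × vs ⊆ zs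
⊆-++⁻ []       sub = [] , _ , refl , [] , sub
⊆-++⁻ (y ∷ ys) (.y ∷ʳ sub) with ⊆-++⁻ ys sub
... | us , vs , eq , p , q = us , vs , eq , y ∷ʳ p , q
⊆-++⁻ (y ∷ ys) (refl ∷ sub) with ⊆-++⁻ ys sub
... | us , vs , eq , p , q = y ∷ us , vs , cong (y ∷_) eq , refl ∷ p , q

⊆-singleton : ∀ {b x : ℕ} → [ b ] ⊆ [ x ] → b ≡ x
⊆-singleton (refl ∷ _) = refl

¬two⊆singleton : ∀ {a b x : ℕ} {xs} → ¬ (a ∷ b ∷ xs ⊆ [ x ])
¬two⊆singleton (_ ∷ ())
¬two⊆singleton (_ ∷ʳ ())

-- In the word A B x each letter of A exceeds everything behind the block, so a pattern that begins
-- in A stays in A. A pattern in B x that ends with x is excluded because x exceeds every c in B.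
perm132-avoids : ∀ o T {a b c} → a ∷ c ∷ b ∷ [] ⊆ perm132 o T → a < b → b ≤ c → ⊥
perm132-avoids o (node A B) {a} {b} {c} sub a<b b≤c = outer (⊆-++⁻ (perm132 x A) sub)
  where
  x = rootLabel o B

  high : ∀ {a} → a ∈ perm132 x A → x < a
  high a∈ = proj₁ (All.lookup (perm132-between x A) a∈)

  low : ∀ {y} → y ∈ perm132 o B → y < x
  low y∈ = s≤s (proj₂ (All.lookup (perm132-between o B) y∈))

  low′ : ∀ {y} → y ∈ perm132 o B ++ [ x ] → y ≤ x
  low′ y∈ with ∈-++⁻ (perm132 o B) y∈
  ... | inj₁ y∈B         = <⇒≤ (low y∈B)
  ... | inj₂ (here refl) = ≤-refl

  cross : ∀ {a b} → a ∈ perm132 x A → b ∈ perm132 o B ++ [ x ] → a < b → ⊥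
  cross a∈ b∈ a<b = <-asym (high a∈) (<-≤-trans a<b (low′ b∈))

  inner : _ → ⊥
  inner ([] , _ , refl , _ , q)                          = ¬two⊆singleton q
  inner (_ ∷ [] , _ , refl , _ , q)                      = ¬two⊆singleton q
  inner (_ ∷ _ ∷ [] , _ , refl , p , q)                  = <⇒≱ (low (lookup p (there (here refl)))) (subst (_≤ c) (⊆-singleton q) b≤c)
  inner (_ ∷ _ ∷ _ ∷ [] , _ , refl , p , _)              = perm132-avoids o B p a<b b≤c

  outer : _ → ⊥
  outer ([] , _ , refl , _ , q)             = inner (⊆-++⁻ (perm132 o B) q)
  outer (_ ∷ [] , _ , refl , p , q)         = cross (lookup p (here refl)) (lookup q (there (here refl))) a<b
  outer (_ ∷ _ ∷ [] , _ , refl , p , q)     = cross (lookup p (here refl)) (lookup q (here refl)) a<b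
  outer (_ ∷ _ ∷ _ ∷ [] , _ , refl , p , _) = perm132-avoids x A p a<b b≤c

perm312-avoids : ∀ o T {a b c} → c ∷ a ∷ b ∷ [] ⊆ perm312 o T → a < b → b ≤ c → ⊥
perm312-avoids o (node A B) {a} {b} {c} sub a<b b≤c = outer (⊆-++⁻ (perm312 o B) sub)
  where
  x = rootLabel o B

  high : ∀ {a} → a ∈ perm312 x A → x < a
  high a∈ = proj₁ (All.lookup (perm312-between x A) a∈)

  high′ : ∀ {a} → a ∈ perm312 x A ++ [ x ] → x ≤ a
  high′ y∈ with ∈-++⁻ (perm312 x A) y∈
  ... | inj₁ y∈A         = <⇒≤ (high y∈A)
  ... | inj₂ (here refl) = ≤-refl

  cross : ∀ {c b} → c ∈ perm312 o B → b ∈ perm312 x A ++ [ x ] → b ≤ c → ⊥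
  cross c∈ b∈ b≤c = <⇒≱ (s≤s (proj₂ (All.lookup (perm312-between o B) c∈))) (≤-trans (high′ b∈) b≤c)

  inner : _ → ⊥
  inner ([] , _ , refl , _ , q)             = ¬two⊆singleton q
  inner (_ ∷ [] , _ , refl , _ , q)         = ¬two⊆singleton q
  inner (_ ∷ _ ∷ [] , _ , refl , p , q)     = <-asym (high (lookup p (there (here refl)))) (subst (a <_) (⊆-singleton q) a<b)
  inner (_ ∷ _ ∷ _ ∷ [] , _ , refl , p , _) = perm312-avoids x A p a<b b≤c

  outer : _ → ⊥
  outer ([] , _ , refl , _ , q)             = inner (⊆-++⁻ (perm312 x A) q)
  outer (_ ∷ [] , _ , refl , p , q)         = cross (lookup p (here refl)) (lookup q (there (here refl))) b≤c
  outer (_ ∷ _ ∷ [] , _ , refl , p , q)     = cross (lookup p (here refl)) (lookup q (here refl)) b≤c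
  outer (_ ∷ _ ∷ _ ∷ [] , _ , refl , p , _) = perm312-avoids o B p a<b b≤c

above below : ℕ → List ℕ → List ℕ
above x = filter (x <?_)
below x = filter (_<? x)

-- The excluded pairs are what a following letter x would complete to a 132: before it no smaller
-- letter may precede a larger one.
above++below : ∀ x w → All (_≢ x) w → (∀ {a c} → a ∷ c ∷ [] ⊆ w → a < x → x < c → ⊥) → w ≡ above x w ++ below x w
above++below x []      []          _  = refl
above++below x (y ∷ w) (y≢x ∷ w≢x) free with <-cmp y x
... | tri≈ _ y≡x _ = ⊥-elim (y≢x y≡x)
... | tri> _ _ x<y = trans (cong (y ∷_) (above++below x w w≢x (λ sub → free (y ∷ʳ sub))))
  (cong₂ _++_ (sym (filter-accept (x <?_) x<y)) (sym (filter-reject (_<? x) (<-asym x<y))))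
... | tri< y<x _ _ = trans (cong (y ∷_) (trans (above++below x w w≢x (λ sub → free (y ∷ʳ sub))) (cong (_++ below x w) none)))
  (cong₂ _++_ (sym (trans (filter-reject (x <?_) (<-asym y<x)) none)) (sym (filter-accept (_<? x) y<x)))
  where
  none : above x w ≡ []
  none = filter-none (x <?_) (All.tabulate λ c∈ x<c → free (refl ∷ from∈ c∈) y<x x<c)

module _ {x : ℕ} {lo hi w : List ℕ} (p : w ↭ lo ++ hi) (lo< : All (_< x) lo) (hi> : All (x <_) hi) where

  above-split : above x w ↭ hi
  above-split = ↭-trans (filter-↭ (x <?_) p) (↭-reflexive (trans (filter-++ (x <?_) lo hi)
    (cong₂ _++_ (filter-none (x <?_) (All.map <-asym lo<)) (filter-all (x <?_) hi>))))

  below-split : below x w ↭ lo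
  below-split = ↭-trans (filter-↭ (_<? x) p) (↭-reflexive (trans (filter-++ (_<? x) lo hi)
    (trans (cong₂ _++_ (filter-all (_<? x) lo<) (filter-none (_<? x) (All.map <-asym hi>))) (++-identityʳ lo))))

-- The last letter x is the root label, and avoidance places the larger letters, the block of A,
-- before the smaller ones, the block of B. The bound m drives the recursion; b and a count the
-- letters below and above x.
forest-of : ∀ m o n π → n ≤ m → π ↭ range o n → Avoids132 π → ∃[ T ] size T ≡ n × perm132 o T ≡ π
forest-of m       o zero    π n≤m p av = ε , refl , sym (Permₚ.↭-empty-inv p)
forest-of (suc m) o (suc n) π (s≤s n≤m) p av with initLast π
... | [] = case ↭-length p of λ ()
... | w ∷ʳ′ x = T , sizeT , perm≡
  where
  x∈ : Between o (o + suc n) x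
  x∈ = All.lookup (range-between o (suc n)) (∈-resp-↭ p (∈-++⁺ʳ w (here refl)))

  b = x ∸ suc o
  a = n ∸ b

  x≡ : suc (o + b) ≡ x
  x≡ = m+[n∸m]≡n (proj₁ x∈)

  b≤n : b ≤ n
  b≤n = +-cancelˡ-≤ (suc o) b n (≤-trans (≤-reflexive x≡) (≤-trans (proj₂ x∈) (≤-reflexive (+-suc o n))))

  n≡ : suc n ≡ b + suc a
  n≡ = sym (trans (+-suc b a) (cong suc (m+[n∸m]≡n b≤n)))

  range≡ : range o (suc n) ≡ range o b ++ x ∷ range x a
  range≡ = trans (cong (range o) n≡) (trans (range-++ o b (suc a)) (cong (λ v → range o b ++ v ∷ range v a) x≡))

  w↭ : w ↭ range o b ++ range x a
  w↭ = ↭-trans (↭-reflexive (sym (++-identityʳ w))) (Permₚ.drop-mid w (range o b) (↭-trans p (↭-reflexive range≡)))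

  lo< : All (_< x) (range o b)
  lo< = All.map (λ (_ , u) → ≤-trans (s≤s u) (≤-reflexive x≡)) (range-between o b)

  hi> : All (x <_) (range x a)
  hi> = All.map proj₁ (range-between x a)

  w≢x : All (_≢ x) w
  w≢x = All-resp-↭ (↭-sym w↭) (Allₚ.++⁺ (All.map <⇒≢ lo<) (All.map >⇒≢ hi>))

  w≡ : w ≡ above x w ++ below x w
  w≡ = above++below x w w≢x (λ sub a<x x<c → av (Subₚ.++⁺ sub ⊆-refl) a<x x<c)

  sublist : ∀ {xs} → xs ⊆ w → Avoids132 xs
  sublist xs⊆w sub = av (⊆-trans sub (Subₚ.++⁺ʳ [ x ] xs⊆w))

  recA = forest-of m x a (above x w) (≤-trans (m∸n≤m n b) n≤m) (above-split w↭ lo< hi>) (sublist (Subₚ.filter-⊆ (x <?_) w))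
  recB = forest-of m o b (below x w) (≤-trans b≤n n≤m) (below-split w↭ lo< hi>) (sublist (Subₚ.filter-⊆ (_<? x) w))
  A = proj₁ recA
  B = proj₁ recB

  T = node A B

  sizeT : size T ≡ suc n
  sizeT = trans (cong₂ (λ u v → u + suc v) (proj₁ (proj₂ recB)) (proj₁ (proj₂ recA))) (sym n≡)

  root≡ : rootLabel o B ≡ x
  root≡ = trans (cong (λ v → suc (o + v)) (proj₁ (proj₂ recB))) x≡

  perm≡ : perm132 o T ≡ w ++ [ x ]
  perm≡ = begin
    perm132 (rootLabel o B) A ++ perm132 o B ++ [ rootLabel o B ]   ≡⟨ cong (λ v → perm132 v A ++ perm132 o B ++ [ v ]) root≡ ⟩
    perm132 x A ++ perm132 o B ++ [ x ]                             ≡⟨ cong₂ (λ u v → u ++ v ++ [ x ]) (proj₂ (proj₂ recA)) (proj₂ (proj₂ recB)) ⟩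
    above x w ++ below x w ++ [ x ]                                 ≡⟨ ++-assoc (above x w) (below x w) [ x ] ⟨
    (above x w ++ below x w) ++ [ x ]                               ≡⟨ cong (_++ [ x ]) w≡ ⟨
    w ++ [ x ]                                                      ∎
    where open ≡-Reasoning

-- The operators swlᵢ

<ᵇ-true : ∀ {m n} → m < n → (m <ᵇ n) ≡ true
<ᵇ-true {m} {n} m<n with m <ᵇ n | <⇒<ᵇ m<n
... | true | _ = refl

<ᵇ-false : ∀ {m n} → m ≮ n → (m <ᵇ n) ≡ false
<ᵇ-false {m} {n} m≮n with m <ᵇ n in eq
... | false = refl
... | true  = ⊥-elim (m≮n (<ᵇ⇒< m n (subst Data.Bool.T (sym eq) tt)))
  where import Data.Bool

≡ᵇ-refl : ∀ m → (m ≡ᵇ m) ≡ true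
≡ᵇ-refl zero    = refl
≡ᵇ-refl (suc m) = ≡ᵇ-refl m

≡ᵇ-false : ∀ {m n} → m ≢ n → (m ≡ᵇ n) ≡ false
≡ᵇ-false {zero}  {zero}  m≢n = ⊥-elim (m≢n refl)
≡ᵇ-false {zero}  {suc n} _   = refl
≡ᵇ-false {suc m} {zero}  _   = refl
≡ᵇ-false {suc m} {suc n} m≢n = ≡ᵇ-false (m≢n ∘ cong suc)

Unique-resp-↭ : ∀ {xs ys : List ℕ} → xs ↭ ys → Unique xs → Unique ys
Unique-resp-↭ Perm.refl          u                        = u
Unique-resp-↭ (prep x p)         (x∉ ∷ u)                 = All-resp-↭ p x∉ ∷ Unique-resp-↭ p u
Unique-resp-↭ (swap x y p)       ((x≢y ∷ x∉) ∷ (y∉ ∷ u))  = ((x≢y ∘ sym) ∷ All-resp-↭ p y∉) ∷ All-resp-↭ p x∉ ∷ Unique-resp-↭ p u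
Unique-resp-↭ (Perm.trans p q)   u                        = Unique-resp-↭ q (Unique-resp-↭ p u)

range-unique : ∀ o n → Unique (range o n)
range-unique o zero    = []
range-unique o (suc n) = All.map (λ (l , _) → <⇒≢ l) (range-between (suc o) n) ∷ range-unique (suc o) n

perm-unique : ∀ {o n π} → π ↭ range o n → Unique π
perm-unique {o} {n} p = Unique-resp-↭ (↭-sym p) (range-unique o n)

unique-++⁻ˡ : ∀ (xs : List ℕ) {ys} → Unique (xs ++ ys) → Unique xs
unique-++⁻ˡ []       _        = []
unique-++⁻ˡ (x ∷ xs) (x∉ ∷ u) = Allₚ.++⁻ˡ xs x∉ ∷ unique-++⁻ˡ xs u

unique-++⁻ʳ : ∀ (xs : List ℕ) {ys} → Unique (xs ++ ys) → Unique ys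
unique-++⁻ʳ []       u       = u
unique-++⁻ʳ (x ∷ xs) (_ ∷ u) = unique-++⁻ʳ xs u

unique-disjoint : ∀ (xs : List ℕ) {ys z} → Unique (xs ++ ys) → z ∈ ys → z ∉ xs
unique-disjoint (x ∷ xs) (x∉ ∷ u) z∈ys (here refl) = All.lookup x∉ (∈-++⁺ʳ xs z∈ys) refl
unique-disjoint (x ∷ xs) (x∉ ∷ u) z∈ys (there z∈)  = unique-disjoint xs u z∈ys z∈

-- Positions and inverses

pos-here : ∀ x xs → pos (x ∷ xs) x ≡ 1
pos-here x xs rewrite ≡ᵇ-refl x = refl

pos-there : ∀ {x y} xs → x ≢ y → pos (x ∷ xs) y ≡ suc (pos xs y)
pos-there xs x≢y rewrite ≡ᵇ-false x≢y = refl

pos-∉-++ : ∀ {y} xs ys → y ∉ xs → pos (xs ++ ys) y ≡ length xs + pos ys y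
pos-∉-++ []       ys y∉ = refl
pos-∉-++ (x ∷ xs) ys y∉ = trans (pos-there {x} (xs ++ ys) (λ { refl → y∉ (here refl) })) (cong suc (pos-∉-++ xs ys (y∉ ∘ there)))

pos-mid : ∀ {y} xs ys → y ∉ xs → pos (xs ++ y ∷ ys) y ≡ suc (length xs)
pos-mid {y} xs ys y∉ = trans (pos-∉-++ xs (y ∷ ys) y∉) (trans (cong (length xs +_) (pos-here y ys)) (+-comm (length xs) 1))

pos-≤ : ∀ {y} xs ys → y ∈ xs → pos (xs ++ ys) y ≤ length xs
pos-≤ {y} (x ∷ xs) ys y∈ with x ≟ y
pos-≤ {y} (x ∷ xs) ys y∈          | yes refl = ≤-trans (≤-reflexive (pos-here x (xs ++ ys))) (s≤s z≤n)
pos-≤ {y} (x ∷ xs) ys (here refl) | no x≢y = ⊥-elim (x≢y refl)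
pos-≤ {y} (x ∷ xs) ys (there y∈)  | no x≢y = ≤-trans (≤-reflexive (pos-there (xs ++ ys) x≢y)) (s≤s (pos-≤ xs ys y∈))

pos-positive : ∀ {y xs} → y ∈ xs → 0 < pos xs y
pos-positive {y} {x ∷ xs} y∈ with x ≟ y
... | yes refl = ≤-reflexive (sym (pos-here x xs))
... | no  x≢y  = ≤-trans (s≤s z≤n) (≤-reflexive (sym (pos-there xs x≢y)))

pos-> : ∀ {y} xs ys → y ∉ xs → y ∈ ys → length xs < pos (xs ++ ys) y
pos-> xs ys y∉ y∈ = ≤-trans (≤-reflexive (+-comm 1 (length xs)))
  (≤-trans (+-monoʳ-≤ (length xs) (pos-positive y∈)) (≤-reflexive (sym (pos-∉-++ xs ys y∉))))

pos-injective : ∀ {xs a b} → a ∈ xs → b ∈ xs → pos xs a ≡ pos xs b → a ≡ b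
pos-injective {x ∷ xs} {a} {b} a∈ b∈ eq with x ≟ a | x ≟ b
... | yes refl | yes refl = refl
pos-injective {x ∷ xs} {a} {b} a∈ (here refl) eq | yes refl | no x≢b = refl
pos-injective {x ∷ xs} {a} {b} a∈ (there b∈)  eq | yes refl | no x≢b =
  ⊥-elim (<-irrefl (suc-injective (trans (sym (pos-here x xs)) (trans eq (pos-there xs x≢b)))) (pos-positive b∈))
pos-injective {x ∷ xs} {a} {b} (here refl) b∈ eq | no x≢a | yes refl = refl
pos-injective {x ∷ xs} {a} {b} (there a∈)  b∈ eq | no x≢a | yes refl =
  ⊥-elim (<-irrefl (suc-injective (trans (sym (pos-here x xs)) (trans (sym eq) (pos-there xs x≢a)))) (pos-positive a∈))
pos-injective {x ∷ xs} {a} {b} (here refl) b∈          eq | no x≢a | no x≢b = ⊥-elim (x≢a refl)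
pos-injective {x ∷ xs} {a} {b} (there a∈)  (here refl) eq | no x≢a | no x≢b = ⊥-elim (x≢b refl)
pos-injective {x ∷ xs} {a} {b} (there a∈)  (there b∈)  eq | no x≢a | no x≢b =
  pos-injective a∈ b∈ (suc-injective (trans (sym (pos-there xs x≢a)) (trans eq (pos-there xs x≢b))))

pos-map : ∀ (f : ℕ → ℕ) xs {y} → (∀ {z} → z ∈ xs → f z ≡ f y → z ≡ y) → y ∈ xs → pos (map f xs) (f y) ≡ pos xs y
pos-map f (x ∷ xs) {y} inj y∈ with x ≟ y
... | yes refl = trans (pos-here (f x) (map f xs)) (sym (pos-here x xs))
pos-map f (x ∷ xs) {y} inj (here refl) | no x≢y = ⊥-elim (x≢y refl)
pos-map f (x ∷ xs) {y} inj (there y∈)  | no x≢y =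
  trans (pos-there (map f xs) (x≢y ∘ inj (here refl))) (trans (cong suc (pos-map f xs (inj ∘ there) y∈)) (sym (pos-there xs x≢y)))

map-pos-self : ∀ xs → Unique xs → map (pos xs) xs ≡ range 0 (length xs)
map-pos-self []       _        = refl
map-pos-self (x ∷ xs) (x∉ ∷ u) = cong₂ _∷_ (pos-here x xs)
  (trans (map-cong-local (All.map (pos-there xs) x∉))
    (trans (map-∘ xs) (trans (cong (map suc) (map-pos-self xs u)) (map-suc-range 0 (length xs)))))

pos-range : ∀ o n {y} → y ∈ range o n → o + pos (range o n) y ≡ y
pos-range o (suc n) {y} y∈ with suc o ≟ y
... | yes refl = trans (cong (o +_) (pos-here (suc o) (range (suc o) n))) (+-comm o 1)
pos-range o (suc n) (here refl) | no o≢y = ⊥-elim (o≢y refl)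
pos-range o (suc n) (there y∈)  | no o≢y =
  trans (cong (o +_) (pos-there (range (suc o) n) o≢y)) (trans (+-suc o _) (pos-range (suc o) n y∈))

inv≡ : ∀ {n π} → π ↭ range 0 n → inv π ≡ map (pos π) (range 0 n)
inv≡ {n} {π} p = cong (map (pos π)) (trans (range1≡range (length π)) (cong (range 0) (trans (↭-length p) (length-range 0 n))))

inv-involutive : ∀ {n π} → π ↭ range 0 n → inv (inv π) ≡ π
inv-involutive {n} {π} p = begin
  inv (inv π)                                      ≡⟨ cong (map (pos (inv π))) (trans (range1≡range (length (inv π))) (cong (range 0) length-inv)) ⟩
  map (pos (inv π)) (range 0 (length π))           ≡⟨ cong (map (pos (inv π))) (map-pos-self π (perm-unique p)) ⟨
  map (pos (inv π)) (map (pos π) π)                ≡⟨ map-∘ π ⟨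
  map (λ y → pos (inv π) (pos π y)) π              ≡⟨ map-id-local (All.tabulate step) ⟩
  π                                                ∎
  where
  open ≡-Reasoning
  length-inv : length (inv π) ≡ length π
  length-inv = trans (cong length (inv≡ p)) (trans (length-map (pos π) (range 0 n)) (sym (↭-length p)))
  step : ∀ {y} → y ∈ π → pos (inv π) (pos π y) ≡ y
  step {y} y∈ = trans (cong (λ ρ → pos ρ (pos π y)) (inv≡ p))
    (trans (pos-map (pos π) (range 0 n) (λ z∈ → pos-injective (∈-resp-↭ (↭-sym p) z∈) y∈) (∈-resp-↭ p y∈))
      (pos-range 0 n (∈-resp-↭ p y∈)))

rotInv-rot : ∀ {n π} → π ↭ range 0 n → rotInv (rot π) ≡ π
rotInv-rot {π = π} p = trans (cong inv (reverse-involutive (inv π))) (inv-involutive p)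

splitOn-mid : ∀ i xs ys → i ∉ xs → splitOn i (xs ++ i ∷ ys) ≡ (xs , ys)
splitOn-mid i []       ys i∉ rewrite ≡ᵇ-refl i = refl
splitOn-mid i (x ∷ xs) ys i∉
  rewrite ≡ᵇ-false {x} {i} (λ { refl → i∉ (here refl) }) | splitOn-mid i xs ys (i∉ ∘ there) = refl

countL-↭ : ∀ p {xs ys} → xs ↭ ys → countL p xs ≡ countL p ys
countL-↭ p σ = ↭-length (filter-↭ (λ y → T? (p y)) σ)

countL-++ : ∀ p xs ys → countL p (xs ++ ys) ≡ countL p xs + countL p ys
countL-++ p xs ys = trans (cong length (filter-++ (λ y → T? (p y)) xs ys)) (length-++ (filter (λ y → T? (p y)) xs))

countL-map : ∀ p f xs → countL p (map f xs) ≡ countL (p ∘ f) xs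
countL-map p f []       = refl
countL-map p f (x ∷ xs) with p (f x)
... | true  = cong suc (countL-map p f xs)
... | false = countL-map p f xs

countL-cong : ∀ {p q xs} → All (λ z → p z ≡ q z) xs → countL p xs ≡ countL q xs
countL-cong []                            = refl
countL-cong {p} {q} {x ∷ xs} (eq ∷ eqs) with p x | q x | eq
... | true  | .true  | refl = cong suc (countL-cong eqs)
... | false | .false | refl = countL-cong eqs

countL-false : ∀ {p xs} → All (λ z → p z ≡ false) xs → countL p xs ≡ 0
countL-false []                         = refl
countL-false {p} {x ∷ xs} (eq ∷ eqs) with p x | eq
... | .false | refl = countL-false eqs

countL-above : ∀ x xs → countL (x <ᵇ_) xs ≡ length (above x xs)
countL-above x []       = refl
countL-above x (y ∷ xs) with x <? y
... | yes x<y rewrite <ᵇ-true x<y  = cong suc (countL-above x xs)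
... | no  x≮y rewrite <ᵇ-false x≮y = countL-above x xs

countL-below : ∀ x xs → countL (_<ᵇ x) xs ≡ length (below x xs)
countL-below x []       = refl
countL-below x (y ∷ xs) with y <? x
... | yes y<x rewrite <ᵇ-true y<x  = cong suc (countL-below x xs)
... | no  y≮x rewrite <ᵇ-false y≮x = countL-below x xs

-- A single operator as a stable partition

rankLeft rankRight : ℕ → List ℕ → ℕ → ℕ
rankLeft  i L p = if p <ᵇ i then i ∸ suc (countL (λ q → (q <ᵇ i) ∧ (p <ᵇ q)) L) else p
rankRight i R p = if p <ᵇ i then suc (countL (λ q → (q <ᵇ i) ∧ (q <ᵇ p)) R) else p

swu-split : ∀ i L R → i ∉ L → swu i (L ++ i ∷ R) ≡ map (rankLeft i L) L ++ i ∷ map (rankRight i R) R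
swu-split i L R i∉ rewrite splitOn-mid i L R i∉ = refl

-- `rot` lists the positions of the values in decreasing order of value, so L holds the positions of
-- the letters above x and R of those below x. Among the positions before i, `swu` renumbers those
-- in L downwards from i - 1 and those in R upwards from 1, keeping their order. Thus the larger
-- letters before x move up to x and the smaller ones to the front, which is τ.
module SwipeLeft {n : ℕ} {u : List ℕ} {x : ℕ} {v : List ℕ} (p : u ++ x ∷ v ↭ range 0 n) where

  π τ : List ℕ
  π = u ++ x ∷ v
  τ = below x u ++ above x u ++ x ∷ v

  i = suc (length u)

  unique : Unique π
  unique = perm-unique p

  u-unique : ∀ {z} → z ∈ x ∷ v → z ∉ u
  u-unique = unique-disjoint u unique

  x∉u : x ∉ u
  x∉u = u-unique (here refl)

  u≢x : All (_≢ x) u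
  u≢x = All.tabulate λ { y∈ refl → x∉u y∈ }

  below∪above : ∀ w → All (_≢ x) w → below x w ++ above x w ↭ w
  below∪above []      []          = ↭-refl
  below∪above (y ∷ w) (y≢x ∷ w≢x) with <-cmp y x
  ... | tri< y<x _ _ = ↭-trans (↭-reflexive (cong₂ _++_ (filter-accept (_<? x) y<x) (filter-reject (x <?_) (<-asym y<x))))
                         (prep y (below∪above w w≢x))
  ... | tri≈ _ y≡x _ = ⊥-elim (y≢x y≡x)
  ... | tri> _ _ x<y = ↭-trans (↭-reflexive (cong₂ _++_ (filter-reject (_<? x) (<-asym x<y)) (filter-accept (x <?_) x<y)))
                         (↭-trans (shift y (below x w) (above x w)) (prep y (below∪above w w≢x)))

  τ≡ : τ ≡ (below x u ++ above x u) ++ x ∷ v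
  τ≡ = sym (++-assoc (below x u) (above x u) (x ∷ v))

  τ↭π : τ ↭ π
  τ↭π = ↭-trans (↭-reflexive τ≡) (Permₚ.++⁺ʳ (x ∷ v) (below∪above u u≢x))

  τ↭range : τ ↭ range 0 n
  τ↭range = ↭-trans τ↭π p

  τ-unique : Unique τ
  τ-unique = perm-unique τ↭range

  lengths : length (below x u ++ above x u) ≡ length u
  lengths = ↭-length (below∪above u u≢x)

  pos-x : pos π x ≡ i
  pos-x = pos-mid u v x∉u

  τ-x∉ : ∀ {z} → z ∈ x ∷ v → z ∉ below x u ++ above x u
  τ-x∉ z∈ z∈′ = u-unique z∈ (∈-resp-↭ (below∪above u u≢x) z∈′)

  pos-τ-x : pos τ x ≡ i
  pos-τ-x = trans (cong (λ w → pos w x) τ≡) (trans (pos-mid (below x u ++ above x u) v (τ-x∉ (here refl))) (cong suc lengths))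

  after-pos : ∀ {y} → y ∈ v → pos τ y ≡ pos π y
  after-pos {y} y∈ = trans (cong (λ w → pos w y) τ≡)
    (trans (pos-∉-++ (below x u ++ above x u) (x ∷ v) (τ-x∉ (there y∈)))
      (trans (cong (_+ pos (x ∷ v) y) lengths) (sym (pos-∉-++ u (x ∷ v) (u-unique (there y∈))))))

  after-far : ∀ {y} → y ∈ v → i < pos π y
  after-far {y} y∈ = subst₂ _<_ (trans (length-++ u) (+-comm (length u) 1)) (cong (λ w → pos w y) (++-assoc u [ x ] v))
    (pos-> (u ++ [ x ]) v (unique-disjoint (u ++ [ x ]) (subst Unique (sym (++-assoc u [ x ] v)) unique) y∈) y∈)

  after-not< : ∀ {y} → y ∈ v → (pos π y <ᵇ i) ≡ false
  after-not< y∈ = <ᵇ-false (<-asym (after-far y∈))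

  module Before {u₁ : List ℕ} {y : ℕ} {u₂ : List ℕ} (u≡ : u ≡ u₁ ++ y ∷ u₂) where

    π≡ : π ≡ u₁ ++ y ∷ u₂ ++ x ∷ v
    π≡ = trans (cong (_++ x ∷ v) u≡) (++-assoc u₁ (y ∷ u₂) (x ∷ v))

    unique′ : Unique (u₁ ++ y ∷ u₂ ++ x ∷ v)
    unique′ = subst Unique π≡ unique

    y∉u₁ : y ∉ u₁
    y∉u₁ = unique-disjoint u₁ unique′ (here refl)

    pos-y : pos π y ≡ suc (length u₁)
    pos-y = trans (cong (λ w → pos w y) π≡) (pos-mid u₁ (u₂ ++ x ∷ v) y∉u₁)

    length-u : length u ≡ suc (length u₁ + length u₂)
    length-u = trans (cong length u≡) (trans (length-++ u₁) (+-suc (length u₁) (length u₂)))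

    pos-y< : (pos π y <ᵇ i) ≡ true
    pos-y< = <ᵇ-true (≤-trans (s≤s (≤-reflexive pos-y)) (s≤s (≤-trans (s≤s (m≤m+n (length u₁) (length u₂))) (≤-reflexive (sym length-u)))))

    first : ∀ {z} → z ∈ u₁ → pos π z < pos π y
    first {z} z∈ = subst₂ _<_ (cong (λ w → pos w z) (sym π≡)) (sym pos-y) (s≤s (pos-≤ u₁ (y ∷ u₂ ++ x ∷ v) z∈))

    within : ∀ {z} → z ∈ u → (pos π z <ᵇ i) ≡ true
    within z∈ = <ᵇ-true (s≤s (pos-≤ u (x ∷ v) z∈))

    second : ∀ {z} → z ∈ u₂ → pos π y < pos π z
    second {z} z∈ = subst₂ _<_
      (trans (length-++ u₁) (trans (+-comm (length u₁) 1) (sym pos-y)))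
      (cong (λ w → pos w z) (trans (++-assoc u₁ [ y ] (u₂ ++ x ∷ v)) (sym π≡)))
      (pos-> (u₁ ++ [ y ]) (u₂ ++ x ∷ v)
        (unique-disjoint (u₁ ++ [ y ]) (subst Unique (sym (++-assoc u₁ [ y ] (u₂ ++ x ∷ v))) unique′) (∈-++⁺ˡ z∈))
        (∈-++⁺ˡ z∈))

    in-u₁ : ∀ {z} → z ∈ u₁ → z ∈ u
    in-u₁ z∈ = subst (_ ∈_) (sym u≡) (∈-++⁺ˡ z∈)

    in-u₂ : ∀ {z} → z ∈ u₂ → z ∈ u
    in-u₂ z∈ = subst (_ ∈_) (sym u≡) (∈-++⁺ʳ u₁ (there z∈))

    countL-π : ∀ f → countL f π ≡ countL f u₁ + (countL f [ y ] + (countL f u₂ + (countL f [ x ] + countL f v)))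
    countL-π f = trans (cong (countL f) π≡) (trans (countL-++ f u₁ _) (cong (countL f u₁ +_)
      (trans (countL-++ f [ y ] _) (cong (countL f [ y ] +_)
        (trans (countL-++ f u₂ _) (cong (countL f u₂ +_) (countL-++ f [ x ] v)))))))

    -- The count is the rank of y among the larger letters, taken from x backwards. Outside u₂ some
    -- conjunct fails: a place not after y, the value x itself, or a place behind x.
    after-count : countL (λ z → (x <ᵇ z) ∧ ((pos π z <ᵇ i) ∧ (pos π y <ᵇ pos π z))) π ≡ length (above x u₂)
    after-count = trans (countL-π f) (trans (cong₂ _+_ (countL-false (All.tabulate no₁))
      (cong₂ _+_ (countL-false {f} {[ y ]} (noy ∷ []))
        (cong₂ _+_ (trans (countL-cong (All.tabulate yes₂)) (countL-above x u₂))
          (cong₂ _+_ (countL-false {f} {[ x ]} (nox ∷ [])) (countL-false (All.tabulate no₃))))))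
      (+-identityʳ _))
      where
      f = λ z → (x <ᵇ z) ∧ ((pos π z <ᵇ i) ∧ (pos π y <ᵇ pos π z))
      ∧-false : ∀ a b {c} → c ≡ false → a ∧ (b ∧ c) ≡ false
      ∧-false true  true  eq = eq
      ∧-false true  false _  = refl
      ∧-false false _     _  = refl
      no₁ : ∀ {z} → z ∈ u₁ → f z ≡ false
      no₁ {z} z∈ = ∧-false (x <ᵇ z) (pos π z <ᵇ i) (<ᵇ-false (<-asym (first z∈)))
      noy : f y ≡ false
      noy = ∧-false (x <ᵇ y) (pos π y <ᵇ i) (<ᵇ-false {pos π y} (<-irrefl refl))
      yes₂ : ∀ {z} → z ∈ u₂ → f z ≡ (x <ᵇ z)
      yes₂ {z} z∈ rewrite within (in-u₂ z∈) | <ᵇ-true (second z∈) with x <ᵇ z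
      ... | true  = refl
      ... | false = refl
      nox : f x ≡ false
      nox rewrite <ᵇ-false {x} (<-irrefl refl) = refl
      no₃ : ∀ {z} → z ∈ v → f z ≡ false
      no₃ {z} z∈ rewrite after-not< z∈ with x <ᵇ z
      ... | true  = refl
      ... | false = refl

    before-count : countL (λ z → (z <ᵇ x) ∧ ((pos π z <ᵇ i) ∧ (pos π z <ᵇ pos π y))) π ≡ length (below x u₁)
    before-count = trans (countL-π f) (trans (cong₂ _+_ (trans (countL-cong (All.tabulate yes₁)) (countL-below x u₁))
      (cong₂ _+_ (countL-false {f} {[ y ]} (noy ∷ []))
        (cong₂ _+_ (countL-false (All.tabulate no₂))
          (cong₂ _+_ (countL-false {f} {[ x ]} (nox ∷ [])) (countL-false (All.tabulate no₃))))))
      (+-identityʳ _))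
      where
      f = λ z → (z <ᵇ x) ∧ ((pos π z <ᵇ i) ∧ (pos π z <ᵇ pos π y))
      ∧-false : ∀ a b {c} → c ≡ false → a ∧ (b ∧ c) ≡ false
      ∧-false true  true  eq = eq
      ∧-false true  false _  = refl
      ∧-false false _     _  = refl
      yes₁ : ∀ {z} → z ∈ u₁ → f z ≡ (z <ᵇ x)
      yes₁ {z} z∈ rewrite within (in-u₁ z∈) | <ᵇ-true (first z∈) with z <ᵇ x
      ... | true  = refl
      ... | false = refl
      noy : f y ≡ false
      noy = ∧-false (y <ᵇ x) (pos π y <ᵇ i) (<ᵇ-false {pos π y} (<-irrefl refl))
      no₂ : ∀ {z} → z ∈ u₂ → f z ≡ false
      no₂ {z} z∈ = ∧-false (z <ᵇ x) (pos π z <ᵇ i) (<ᵇ-false (<-asym (second z∈)))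
      nox : f x ≡ false
      nox rewrite <ᵇ-false {x} (<-irrefl refl) = refl
      no₃ : ∀ {z} → z ∈ v → f z ≡ false
      no₃ {z} z∈ rewrite after-not< z∈ with z <ᵇ x
      ... | true  = refl
      ... | false = refl

    pos-τ-above : x < y → pos τ y ≡ length u ∸ length (above x u₂)
    pos-τ-above x<y = begin
      pos τ y
        ≡⟨ cong (λ w → pos w y) τ-split ⟩
      pos ((below x u ++ above x u₁) ++ y ∷ above x u₂ ++ x ∷ v) y
        ≡⟨ pos-mid (below x u ++ above x u₁) _ (unique-disjoint _ (subst Unique τ-split τ-unique) (here refl)) ⟩
      suc (length (below x u ++ above x u₁))
        ≡⟨ m+n∸n≡m _ (length (above x u₂)) ⟨
      suc (length (below x u ++ above x u₁)) + length (above x u₂) ∸ length (above x u₂)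
        ≡⟨ cong (_∸ length (above x u₂)) (trans (sym (trans (length-++ (below x u ++ above x u₁)) (+-suc _ _))) (trans (cong length lo-split) lengths)) ⟩
      length u ∸ length (above x u₂) ∎
      where
      open ≡-Reasoning
      above-u : above x u ≡ above x u₁ ++ y ∷ above x u₂
      above-u = trans (cong (above x) u≡) (trans (filter-++ (x <?_) u₁ (y ∷ u₂)) (cong (above x u₁ ++_) (filter-accept (x <?_) x<y)))
      lo-split : (below x u ++ above x u₁) ++ y ∷ above x u₂ ≡ below x u ++ above x u
      lo-split = trans (++-assoc (below x u) (above x u₁) (y ∷ above x u₂)) (cong (below x u ++_) (sym above-u))
      τ-split : τ ≡ (below x u ++ above x u₁) ++ y ∷ above x u₂ ++ x ∷ v
      τ-split = trans τ≡ (trans (cong (_++ x ∷ v) (sym lo-split)) (++-assoc (below x u ++ above x u₁) (y ∷ above x u₂) (x ∷ v)))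

    pos-τ-below : y < x → pos τ y ≡ suc (length (below x u₁))
    pos-τ-below y<x = trans (cong (λ w → pos w y) τ-split)
      (pos-mid (below x u₁) _ (unique-disjoint _ (subst Unique τ-split τ-unique) (here refl)))
      where
      τ-split : τ ≡ below x u₁ ++ y ∷ below x u₂ ++ above x u ++ x ∷ v
      τ-split = trans (cong (_++ above x u ++ x ∷ v) (trans (cong (below x) u≡)
          (trans (filter-++ (_<? x) u₁ (y ∷ u₂)) (cong (below x u₁ ++_) (filter-accept (_<? x) y<x)))))
        (++-assoc (below x u₁) (y ∷ below x u₂) (above x u ++ x ∷ v))

  x∈range : Between 0 n x
  x∈range = All.lookup (range-between 0 n) (∈-resp-↭ p (∈-++⁺ʳ u (here refl)))

  b = x ∸ 1
  a = n ∸ x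

  x≡ : suc b ≡ x
  x≡ = m+[n∸m]≡n (proj₁ x∈range)

  range≡ : range 0 n ≡ range 0 b ++ x ∷ range x a
  range≡ = trans (cong (range 0) (sym (trans (+-suc b a) (trans (cong (_+ a) x≡) (m+[n∸m]≡n (proj₂ x∈range))))))
    (trans (range-++ 0 b (suc a)) (cong (λ w → range 0 b ++ w ∷ range w a) x≡))

  lo< : All (_< x) (range 0 b)
  lo< = All.map (λ (_ , h) → ≤-trans (s≤s h) (≤-reflexive x≡)) (range-between 0 b)

  hi> : All (x <_) (range x a)
  hi> = All.map proj₁ (range-between x a)

  L R : List ℕ
  L = reverse (map (pos π) (range x a))
  R = reverse (map (pos π) (range 0 b))

  in-π : ∀ {y} → y ∈ range 0 b ++ x ∷ range x a → y ∈ π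
  in-π y∈ = ∈-resp-↭ (↭-sym p) (subst (_ ∈_) (sym range≡) y∈)

  reverse-split : ∀ (f : ℕ → ℕ) → reverse (map f (range 0 n)) ≡ reverse (map f (range x a)) ++ f x ∷ reverse (map f (range 0 b))
  reverse-split f = begin
    reverse (map f (range 0 n))                                        ≡⟨ cong (reverse ∘ map f) range≡ ⟩
    reverse (map f (range 0 b ++ x ∷ range x a))                       ≡⟨ cong reverse (map-++ f (range 0 b) (x ∷ range x a)) ⟩
    reverse (map f (range 0 b) ++ f x ∷ map f (range x a))             ≡⟨ reverse-++ (map f (range 0 b)) (f x ∷ map f (range x a)) ⟩
    reverse (f x ∷ map f (range x a)) ++ reverse (map f (range 0 b))   ≡⟨ cong (_++ reverse (map f (range 0 b))) (unfold-reverse (f x) (map f (range x a))) ⟩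
    (reverse (map f (range x a)) ++ [ f x ]) ++ reverse (map f (range 0 b)) ≡⟨ ++-assoc (reverse (map f (range x a))) [ f x ] _ ⟩
    reverse (map f (range x a)) ++ f x ∷ reverse (map f (range 0 b))   ∎
    where open ≡-Reasoning

  countL-reverse : ∀ q xs → countL q (reverse (map (pos π) xs)) ≡ countL (q ∘ pos π) xs
  countL-reverse q xs = trans (countL-↭ q (↭-reverse (map (pos π) xs))) (countL-map q (pos π) xs)

  countL-range : ∀ q → countL q (range 0 b) + (countL q [ x ] + countL q (range x a)) ≡ countL q π
  countL-range q = sym (trans (countL-↭ q (↭-trans p (↭-reflexive range≡)))
    (trans (countL-++ q (range 0 b) (x ∷ range x a)) (cong (countL q (range 0 b) +_) (countL-++ q [ x ] (range x a)))))

  -- Ranks over positions become counts over the letters of π, which can be split along u₁, y, u₂,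
  -- x, v.
  countL-L : ∀ q → countL q L ≡ countL (λ z → (x <ᵇ z) ∧ q (pos π z)) π
  countL-L q = trans (countL-reverse q (range x a)) (trans (countL-cong (All.map keep hi>))
    (trans (cong₂ _+_ (sym (countL-false {q′} (All.map drop′ lo<))) (cong (_+ countL q′ (range x a)) (sym (countL-false {q′} {[ x ]} (self ∷ [])))))
      (countL-range q′)))
    where
    q′ = λ z → (x <ᵇ z) ∧ q (pos π z)
    keep : ∀ {z} → x < z → q (pos π z) ≡ q′ z
    keep x<z rewrite <ᵇ-true x<z = refl
    drop′ : ∀ {z} → z < x → q′ z ≡ false
    drop′ z<x rewrite <ᵇ-false (<-asym z<x) = refl
    self : q′ x ≡ false
    self rewrite <ᵇ-false {x} (<-irrefl refl) = refl

  countL-R : ∀ q → countL q R ≡ countL (λ z → (z <ᵇ x) ∧ q (pos π z)) π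
  countL-R q = trans (countL-reverse q (range 0 b)) (trans (countL-cong (All.map keep lo<))
    (trans (sym (+-identityʳ _)) (trans (cong (countL q′ (range 0 b) +_)
      (sym (cong₂ _+_ (countL-false {q′} {[ x ]} (self ∷ [])) (countL-false {q′} (All.map drop′ hi>)))))
      (countL-range q′))))
    where
    q′ = λ z → (z <ᵇ x) ∧ q (pos π z)
    keep : ∀ {z} → z < x → q (pos π z) ≡ q′ z
    keep z<x rewrite <ᵇ-true z<x = refl
    drop′ : ∀ {z} → x < z → q′ z ≡ false
    drop′ x<z rewrite <ᵇ-false (<-asym x<z) = refl
    self : q′ x ≡ false
    self rewrite <ᵇ-false {x} (<-irrefl refl) = refl

  rankLeft-pos : ∀ {y} → x < y → y ∈ π → rankLeft i L (pos π y) ≡ pos τ y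
  rankLeft-pos {y} x<y y∈ with ∈-++⁻ u y∈
  ... | inj₂ (here refl) = ⊥-elim (<-irrefl refl x<y)
  ... | inj₂ (there y∈v) rewrite after-not< y∈v = sym (after-pos y∈v)
  ... | inj₁ y∈u with u₁ , u₂ , u≡ ← ∈-∃++ y∈u =
    trans (cong (λ t → if t then i ∸ suc (countL (λ q → (q <ᵇ i) ∧ (pos π y <ᵇ q)) L) else pos π y) pos-y<)
      (trans (cong (length u ∸_) (trans (countL-L (λ q → (q <ᵇ i) ∧ (pos π y <ᵇ q))) after-count)) (sym (pos-τ-above x<y)))
    where open Before u≡

  rankRight-pos : ∀ {y} → y < x → y ∈ π → rankRight i R (pos π y) ≡ pos τ y
  rankRight-pos {y} y<x y∈ with ∈-++⁻ u y∈
  ... | inj₂ (here refl) = ⊥-elim (<-irrefl refl y<x)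
  ... | inj₂ (there y∈v) rewrite after-not< y∈v = sym (after-pos y∈v)
  ... | inj₁ y∈u with u₁ , u₂ , u≡ ← ∈-∃++ y∈u =
    trans (cong (λ t → if t then suc (countL (λ q → (q <ᵇ i) ∧ (q <ᵇ pos π y)) R) else pos π y) pos-y<)
      (trans (cong suc (trans (countL-R (λ q → (q <ᵇ i) ∧ (q <ᵇ pos π y))) before-count)) (sym (pos-τ-below y<x)))
    where open Before u≡

  i∉L : i ∉ L
  i∉L i∈ with z , z∈ , eq ← ∈-map⁻ (pos π) (∈-resp-↭ (↭-reverse (map (pos π) (range x a))) i∈)
    with refl ← pos-injective (∈-++⁺ʳ u (here refl)) (in-π (∈-++⁺ʳ (range 0 b) (there z∈))) (trans pos-x eq)
    = <-irrefl refl (All.lookup hi> z∈)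

  rot-π : rot π ≡ L ++ i ∷ R
  rot-π = trans (cong reverse (inv≡ p)) (trans (reverse-split (pos π)) (cong (λ w → L ++ w ∷ R) pos-x))

  rot-τ : rot τ ≡ reverse (map (pos τ) (range x a)) ++ i ∷ reverse (map (pos τ) (range 0 b))
  rot-τ = trans (cong reverse (inv≡ τ↭range)) (trans (reverse-split (pos τ))
    (cong (λ w → reverse (map (pos τ) (range x a)) ++ w ∷ reverse (map (pos τ) (range 0 b))) pos-τ-x))

  map-reverse : ∀ (f : ℕ → ℕ) xs → All (λ y → f (pos π y) ≡ pos τ y) xs → map f (reverse (map (pos π) xs)) ≡ reverse (map (pos τ) xs)
  map-reverse f xs eqs = trans (reverse-map f (map (pos π) xs)) (cong reverse (trans (sym (map-∘ xs)) (map-cong-local eqs)))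

  swlᵢ≡ : swlᵢ i π ≡ τ
  swlᵢ≡ = begin
    rotInv (swu i (rot π))           ≡⟨ cong (rotInv ∘ swu i) rot-π ⟩
    rotInv (swu i (L ++ i ∷ R))      ≡⟨ cong rotInv (swu-split i L R i∉L) ⟩
    rotInv (map (rankLeft i L) L ++ i ∷ map (rankRight i R) R)
      ≡⟨ cong rotInv (cong₂ (λ l r → l ++ i ∷ r)
           (map-reverse (rankLeft i L) (range x a) (All.tabulate λ y∈ → rankLeft-pos (All.lookup hi> y∈) (in-π (∈-++⁺ʳ (range 0 b) (there y∈)))))
           (map-reverse (rankRight i R) (range 0 b) (All.tabulate λ y∈ → rankRight-pos (All.lookup lo< y∈) (in-π (∈-++⁺ˡ y∈))))) ⟩
    rotInv (reverse (map (pos τ) (range x a)) ++ i ∷ reverse (map (pos τ) (range 0 b))) ≡⟨ cong rotInv rot-τ ⟨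
    rotInv (rot τ)                   ≡⟨ rotInv-rot τ↭range ⟩
    τ                                ∎
    where open ≡-Reasoning

-- The composite operator on the reading 132

composeSwl-∷ʳ : ∀ is i π → composeSwl (is ++ [ i ]) π ≡ composeSwl is (swlᵢ i π)
composeSwl-∷ʳ []       i π = refl
composeSwl-∷ʳ (j ∷ is) i π = cong (swlᵢ j) (composeSwl-∷ʳ is i π)

swlUpTo : ℕ → List ℕ → List ℕ
swlUpTo m = composeSwl (range 0 m)

-- The largest index acts first, so the root of a block, its last letter, is treated before the
-- subtrees.
swlUpTo-suc : ∀ m π → swlUpTo (suc m) π ≡ swlUpTo m (swlᵢ (suc m) π)
swlUpTo-suc m π = trans (cong (λ is → composeSwl is π) (trans (cong (range 0) (+-comm 1 m)) (range-++ 0 m 1))) (composeSwl-∷ʳ (range 0 m) (suc m) π)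

length-perm132 : ∀ o T → length (perm132 o T) ≡ size T
length-perm132 o T = trans (↭-length (perm132↭range o T)) (length-range o (size T))

length-perm312 : ∀ o T → length (perm312 o T) ≡ size T
length-perm312 o T = trans (↭-length (perm312↭range o T)) (length-range o (size T))

perm132↭perm312 : ∀ o T → perm132 o T ↭ perm312 o T
perm132↭perm312 o T = ↭-trans (perm132↭range o T) (↭-sym (perm312↭range o T))

-- The initial part c collects the already sorted smaller blocks.
swlUpTo-perm132 : ∀ {n} o T c v → All (_≤ o) c → c ++ perm132 o T ++ v ↭ range 0 n →
  swlUpTo (length c + size T) (c ++ perm132 o T ++ v) ≡ swlUpTo (length c) (c ++ perm312 o T ++ v)
swlUpTo-perm132 o ε          c v c≤ p = cong (λ m → swlUpTo m (c ++ v)) (+-identityʳ (length c))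
swlUpTo-perm132 {n} o (node A B) c v c≤ p = begin
  swlUpTo (length c + size (node A B)) (c ++ (A′ ++ B′ ++ [ x ]) ++ v)   ≡⟨ cong₂ swlUpTo size≡ word≡ ⟩
  swlUpTo (suc (length u)) (u ++ x ∷ v)                                  ≡⟨ swlUpTo-suc (length u) (u ++ x ∷ v) ⟩
  swlUpTo (length u) (swlᵢ (suc (length u)) (u ++ x ∷ v))                ≡⟨ cong (swlUpTo (length u)) swlᵢ≡ ⟩
  swlUpTo (length u) (below x u ++ above x u ++ x ∷ v)                   ≡⟨ cong₂ swlUpTo length-u (cong₂ (λ l h → l ++ h ++ x ∷ v) below-u above-u) ⟩
  -- The block of A now ends just before x and is sorted next, with the block of B counted among the
  -- smaller letters in front.
  swlUpTo (length (c ++ B′) + size A) ((c ++ B′) ++ A′ ++ x ∷ v)         ≡⟨ swlUpTo-perm132 x A (c ++ B′) (x ∷ v) cB≤ pA ⟩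
  swlUpTo (length (c ++ B′)) ((c ++ B′) ++ A″ ++ x ∷ v)                  ≡⟨ cong₂ swlUpTo length-cB (++-assoc c B′ (A″ ++ x ∷ v)) ⟩
  swlUpTo (length c + size B) (c ++ B′ ++ A″ ++ x ∷ v)                   ≡⟨ swlUpTo-perm132 o B c (A″ ++ x ∷ v) c≤ pB ⟩
  swlUpTo (length c) (c ++ B″ ++ A″ ++ x ∷ v)                            ≡⟨ cong (λ w → swlUpTo (length c) (c ++ w)) (sym assoc″) ⟩
  swlUpTo (length c) (c ++ (B″ ++ A″ ++ [ x ]) ++ v)                     ∎
  where
  open ≡-Reasoning
  x = rootLabel o B
  A′ = perm132 x A
  B′ = perm132 o B
  A″ = perm312 x A
  B″ = perm312 o B
  u = c ++ A′ ++ B′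

  word≡ : c ++ (A′ ++ B′ ++ [ x ]) ++ v ≡ u ++ x ∷ v
  word≡ = begin
    c ++ (A′ ++ B′ ++ [ x ]) ++ v     ≡⟨ cong (λ w → c ++ w ++ v) (++-assoc A′ B′ [ x ]) ⟨
    c ++ ((A′ ++ B′) ++ [ x ]) ++ v   ≡⟨ cong (c ++_) (++-assoc (A′ ++ B′) [ x ] v) ⟩
    c ++ (A′ ++ B′) ++ x ∷ v          ≡⟨ ++-assoc c (A′ ++ B′) (x ∷ v) ⟨
    u ++ x ∷ v                        ∎

  assoc″ : (B″ ++ A″ ++ [ x ]) ++ v ≡ B″ ++ A″ ++ x ∷ v
  assoc″ = trans (++-assoc B″ (A″ ++ [ x ]) v) (cong (B″ ++_) (++-assoc A″ [ x ] v))

  length-cB : length (c ++ B′) ≡ length c + size B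
  length-cB = trans (length-++ c) (cong (length c +_) (length-perm132 o B))

  length-u : length u ≡ length (c ++ B′) + size A
  length-u = trans (length-++ c) (trans (cong (length c +_) (trans (length-++ A′) (trans (+-comm (length A′) (length B′))
    (cong₂ _+_ (length-perm132 o B) (length-perm132 x A))))) (trans (sym (+-assoc (length c) (size B) (size A))) (cong (_+ size A) (sym length-cB))))

  size≡ : length c + size (node A B) ≡ suc (length u)
  size≡ = trans (sym (+-assoc (length c) (size B) (suc (size A)))) (trans (+-suc (length c + size B) (size A))
    (cong suc (sym (trans length-u (cong (_+ size A) length-cB)))))

  B<x : All (_< x) B′
  B<x = All.map (λ (_ , h) → s≤s h) (perm132-between o B)

  c<x : All (_< x) c
  c<x = All.map (λ h → s≤s (≤-trans h (m≤m+n o (size B)))) c≤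

  A>x : All (x <_) A′
  A>x = All.map proj₁ (perm132-between x A)

  cB≤ : All (_≤ x) (c ++ B′)
  cB≤ = Allₚ.++⁺ (All.map <⇒≤ c<x) (All.map <⇒≤ B<x)

  below-u : below x u ≡ c ++ B′
  below-u = trans (filter-++ (_<? x) c (A′ ++ B′)) (cong₂ _++_ (filter-all (_<? x) c<x)
    (trans (filter-++ (_<? x) A′ B′) (cong₂ _++_ (filter-none (_<? x) (All.map <-asym A>x)) (filter-all (_<? x) B<x))))

  above-u : above x u ≡ A′
  above-u = trans (filter-++ (x <?_) c (A′ ++ B′)) (cong₂ _++_ (filter-none (x <?_) (All.map <-asym c<x))
    (trans (filter-++ (x <?_) A′ B′) (trans (cong₂ _++_ (filter-all (x <?_) A>x) (filter-none (x <?_) (All.map <-asym B<x))) (++-identityʳ A′))))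

  p′ : u ++ x ∷ v ↭ range 0 n
  p′ = subst (_↭ range 0 n) word≡ p

  open SwipeLeft {n} {u} {x} {v} p′ using (swlᵢ≡; τ↭range)

  pA : (c ++ B′) ++ A′ ++ x ∷ v ↭ range 0 n
  pA = subst (_↭ range 0 n) (cong₂ (λ l h → l ++ h ++ x ∷ v) below-u above-u) τ↭range

  pB : c ++ B′ ++ A″ ++ x ∷ v ↭ range 0 n
  pB = ↭-trans (↭-trans (↭-reflexive (sym (++-assoc c B′ (A″ ++ x ∷ v))))
    (Permₚ.++⁺ˡ (c ++ B′) (Permₚ.++⁺ʳ (x ∷ v) (↭-sym (perm132↭perm312 x A))))) pA

swl-perm132 : ∀ T → swl (perm132 0 T) ≡ perm312 0 T
swl-perm132 T = begin
  composeSwl (range1 (length (perm132 0 T))) (perm132 0 T)  ≡⟨ cong (λ is → composeSwl is (perm132 0 T)) (trans (range1≡range _) (cong (range 0) (length-perm132 0 T))) ⟩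
  swlUpTo (size T) (perm132 0 T)                            ≡⟨ cong (swlUpTo (size T)) (++-identityʳ (perm132 0 T)) ⟨
  swlUpTo (size T) (perm132 0 T ++ [])                      ≡⟨ swlUpTo-perm132 0 T [] [] [] (↭-trans (↭-reflexive (++-identityʳ _)) (perm132↭range 0 T)) ⟩
  perm312 0 T ++ []                                         ≡⟨ ++-identityʳ (perm312 0 T) ⟩
  perm312 0 T                                               ∎
  where open ≡-Reasoning

-- The words of DL

adjacent : (ℕ → ℕ → Bool) → List ℕ → List Bool
adjacent r []           = []
adjacent r (x ∷ [])     = []
adjacent r (x ∷ y ∷ xs) = r x y ∷ adjacent r (y ∷ xs)

ascent descent : ℕ → ℕ → Bool
ascent  x y = x <ᵇ y
descent x y = y <ᵇ x

lastOr : ℕ → List ℕ → ℕ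
lastOr p []       = p
lastOr p (x ∷ xs) = lastOr x xs

lastOr-++ : ∀ p xs ys → lastOr p (xs ++ ys) ≡ lastOr (lastOr p xs) ys
lastOr-++ p []       ys = refl
lastOr-++ p (x ∷ xs) ys = lastOr-++ x xs ys

lastOr-All : ∀ {P : ℕ → Set} {p xs} → P p → All P xs → P (lastOr p xs)
lastOr-All pp []         = pp
lastOr-All pp (px ∷ pxs) = lastOr-All px pxs

adjacent-∷-++ : ∀ r p xs ys → adjacent r (p ∷ xs ++ ys) ≡ adjacent r (p ∷ xs) ++ adjacent r (lastOr p xs ∷ ys)
adjacent-∷-++ r p []       ys = refl
adjacent-∷-++ r p (x ∷ xs) ys = cong (r p x ∷_) (adjacent-∷-++ r x xs ys)

adjacent-++ : ∀ r xs y ys → adjacent r (xs ++ y ∷ ys) ≡ adjacent r (xs ++ [ y ]) ++ adjacent r (y ∷ ys)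
adjacent-++ r []           y ys = refl
adjacent-++ r (x ∷ [])     y ys = refl
adjacent-++ r (x ∷ z ∷ xs) y ys = cong (r x z ∷_) (adjacent-++ r (z ∷ xs) y ys)

adjacent-reverse : ∀ r xs → adjacent r (reverse xs) ≡ reverse (adjacent (flip r) xs)
adjacent-reverse r []           = refl
adjacent-reverse r (x ∷ [])     = refl
adjacent-reverse r (x ∷ y ∷ xs) = begin
  adjacent r (reverse (x ∷ y ∷ xs))                          ≡⟨ cong (adjacent r) (trans (unfold-reverse x (y ∷ xs)) (cong (_++ [ x ]) (unfold-reverse y xs))) ⟩
  adjacent r ((reverse xs ++ [ y ]) ++ [ x ])                ≡⟨ cong (adjacent r) (++-assoc (reverse xs) [ y ] [ x ]) ⟩
  adjacent r (reverse xs ++ y ∷ [ x ])                       ≡⟨ adjacent-++ r (reverse xs) y [ x ] ⟩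
  adjacent r (reverse xs ++ [ y ]) ++ [ r y x ]              ≡⟨ cong (λ w → adjacent r w ++ [ r y x ]) (unfold-reverse y xs) ⟨
  adjacent r (reverse (y ∷ xs)) ++ [ r y x ]                 ≡⟨ cong (_++ [ r y x ]) (adjacent-reverse r (y ∷ xs)) ⟩
  reverse (adjacent (flip r) (y ∷ xs)) ++ [ r y x ]          ≡⟨ unfold-reverse (r y x) (adjacent (flip r) (y ∷ xs)) ⟨
  reverse (r y x ∷ adjacent (flip r) (y ∷ xs))               ∎
  where open ≡-Reasoning

isDes-adjacent : ∀ π {m} → length π ≡ suc m → map (isDes π) (range 0 m) ≡ adjacent descent π
isDes-adjacent (x ∷ [])     refl = refl
isDes-adjacent (x ∷ y ∷ xs) refl = cong ((y <ᵇ x) ∷_) (begin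
  map (isDes (x ∷ y ∷ xs)) (range 1 m)              ≡⟨ cong (map (isDes (x ∷ y ∷ xs))) (map-suc-range 0 m) ⟨
  map (isDes (x ∷ y ∷ xs)) (map suc (range 0 m))    ≡⟨ map-∘ (range 0 m) ⟨
  map (isDes (x ∷ y ∷ xs) ∘ suc) (range 0 m)        ≡⟨ map-cong-local (All.map (λ { {suc i} _ → refl }) (range-between 0 m)) ⟩
  map (isDes (y ∷ xs)) (range 0 m)                  ≡⟨ isDes-adjacent (y ∷ xs) refl ⟩
  adjacent descent (y ∷ xs)                         ∎)
  where
  open ≡-Reasoning
  m = length xs

map-∸-range : ∀ m → map (suc m ∸_) (range 0 m) ≡ reverse (range 0 m)
map-∸-range zero    = refl
map-∸-range (suc m) = begin
  suc m ∷ map (suc (suc m) ∸_) (range 1 m)            ≡⟨ cong (λ w → suc m ∷ map (suc (suc m) ∸_) w) (map-suc-range 0 m) ⟨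
  suc m ∷ map (suc (suc m) ∸_) (map suc (range 0 m))  ≡⟨ cong (suc m ∷_) (map-∘ (range 0 m)) ⟨
  suc m ∷ map (suc m ∸_) (range 0 m)                  ≡⟨ cong (suc m ∷_) (map-∸-range m) ⟩
  suc m ∷ reverse (range 0 m)                         ≡⟨ reverse-++ (range 0 m) [ suc m ] ⟨
  reverse (range 0 m ++ [ suc m ])                    ≡⟨ cong reverse (trans (sym (range-++ 0 m 1)) (cong (range 0) (+-comm m 1))) ⟩
  reverse (range 0 (suc m))                           ∎
  where open ≡-Reasoning

descentStep ascentStep : Bool → Step
descentStep d = if d then D else U
ascentStep  a = if a then U else D

-- The argument is the forest of children of a vertex: U marks a leaf, D an inner vertex.
colour : Forest → Step
colour ε          = U
colour (node _ _) = D

postColours inColours : Forest → List Step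
postColours ε          = []
postColours (node A B) = postColours B ++ postColours A ++ [ colour A ]
inColours ε          = []
inColours (node A B) = inColours B ++ colour A ∷ inColours A

lastOr-perm312 : ∀ p o A B → lastOr p (perm312 o (node A B)) ≡ rootLabel o B
lastOr-perm312 p o A B = trans (lastOr-++ p (perm312 o B) _) (lastOr-++ (lastOr p (perm312 o B)) (perm312 (rootLabel o B) A) [ rootLabel o B ])

-- If A is not empty, the letter before the root x is the root of A and larger than x; otherwise it
-- lies in B or is p, and is smaller. So descents mark inner vertices. The bound on p settles the
-- case in which no letter of the block precedes.
descents-perm312 : ∀ p o T → p ≤ o → map descentStep (adjacent descent (p ∷ perm312 o T)) ≡ postColours T
descents-perm312 p o ε          _   = refl
descents-perm312 p o (node A B) p≤o = begin
  map descentStep (adjacent descent (p ∷ B′ ++ A′ ++ [ x ]))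
    ≡⟨ cong (map descentStep) (trans (adjacent-∷-++ descent p B′ (A′ ++ [ x ])) (cong (adjacent descent (p ∷ B′) ++_) (adjacent-∷-++ descent q A′ [ x ]))) ⟩
  map descentStep (adjacent descent (p ∷ B′) ++ adjacent descent (q ∷ A′) ++ [ x <ᵇ lastOr q A′ ])
    ≡⟨ trans (map-++ descentStep (adjacent descent (p ∷ B′)) _) (cong (map descentStep (adjacent descent (p ∷ B′)) ++_) (map-++ descentStep (adjacent descent (q ∷ A′)) _)) ⟩
  map descentStep (adjacent descent (p ∷ B′)) ++ map descentStep (adjacent descent (q ∷ A′)) ++ [ descentStep (x <ᵇ lastOr q A′) ]
    ≡⟨ cong₂ _++_ (descents-perm312 p o B p≤o) (cong₂ (λ w c → w ++ [ c ]) (descents-perm312 q x A (m≤n⇒m≤1+n q≤)) (last-step A)) ⟩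
  postColours B ++ postColours A ++ [ colour A ] ∎
  where
  open ≡-Reasoning
  x = rootLabel o B
  A′ = perm312 x A
  B′ = perm312 o B
  q = lastOr p B′

  q≤ : q ≤ o + size B
  q≤ = lastOr-All {P = _≤ o + size B} (≤-trans p≤o (m≤m+n o (size B))) (All.map proj₂ (perm312-between o B))

  last-step : ∀ A → descentStep (x <ᵇ lastOr q (perm312 x A)) ≡ colour A
  last-step ε            = cong descentStep (<ᵇ-false (≤⇒≯ (m≤n⇒m≤1+n q≤)))
  last-step (node A₁ A₂) = cong descentStep (<ᵇ-true (subst (x <_) (sym (lastOr-perm312 q x A₁ A₂)) (s≤s (m≤m+n x (size A₂)))))

-- Unlike in `word`, U follows its run, because in preorder the inner vertices that start at a leaf
-- come before it.
leafWord : List ℕ → List Step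
leafWord []      = []
leafWord (a ∷ g) = replicate a D ++ U ∷ leafWord g

leafWord-++ : ∀ g h → leafWord (g ++ h) ≡ leafWord g ++ leafWord h
leafWord-++ []      h = refl
leafWord-++ (a ∷ g) h = trans (cong (λ w → replicate a D ++ U ∷ w) (leafWord-++ g h)) (sym (++-assoc (replicate a D) (U ∷ leafWord g) (leafWord h)))

U∷leafWord : ∀ g → U ∷ leafWord g ≡ word g ++ [ U ]
U∷leafWord []      = refl
U∷leafWord (a ∷ g) = cong (U ∷_) (trans (cong (replicate a D ++_) (U∷leafWord g)) (sym (++-assoc (replicate a D) (word g) [ U ])))

map-proj₁-incLast : ∀ ps → map proj₁ (incLast ps) ≡ map proj₁ ps
map-proj₁-incLast []           = refl
map-proj₁-incLast (p ∷ [])     = refl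
map-proj₁-incLast (p ∷ q ∷ ps) = cong (proj₁ p ∷_) (map-proj₁-incLast (q ∷ ps))

word-++ : ∀ g h → word (g ++ h) ≡ word g ++ word h
word-++ []      h = refl
word-++ (a ∷ g) h = cong (U ∷_) (trans (cong (replicate a D ++_) (word-++ g h)) (sym (++-assoc (replicate a D) (word g) (word h))))

upper-incLast : ∀ p ps → upper (incLast (p ∷ ps)) ≡ upper (p ∷ ps) ++ [ D ]
upper-incLast (a , b) []       = cong (U ∷_) (trans (sym (replicate-∷ʳ b D [])) (trans (cong (λ w → w ++ [ D ]) (sym (++-identityʳ (replicate b D)))) refl))
upper-incLast (a , b) (q ∷ ps) = cong (U ∷_) (trans (cong (replicate b D ++_) (upper-incLast q ps)) (sym (++-assoc (replicate b D) (upper (q ∷ ps)) [ D ])))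

leafWord-enclose : ∀ A → leafWord (map proj₁ (enclose (peaks A))) ≡ colour A ∷ leafWord (map proj₁ (peaks A))
leafWord-enclose ε            = refl
leafWord-enclose (node A₁ A₂) with peaks (node A₁ A₂) | peaks≢[] A₁ A₂
... | []           | ≢[] = ⊥-elim (≢[] refl)
... | (a , b) ∷ ps | _   = cong leafWord (map-proj₁-incLast ((suc a , b) ∷ ps))

upper-enclose : ∀ A → upper (enclose (peaks A)) ≡ upper (peaks A) ++ [ colour A ]
upper-enclose ε            = refl
upper-enclose (node A₁ A₂) with peaks (node A₁ A₂) | peaks≢[] A₁ A₂
... | []           | ≢[] = ⊥-elim (≢[] refl)
... | (a , b) ∷ ps | _   = upper-incLast (suc a , b) ps

-- Backwards, the order left, right, root becomes root, children, later siblings, which is the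
-- preorder of the forest.
reverse-postColours : ∀ T → reverse (postColours T) ≡ leafWord (map proj₁ (peaks T))
reverse-postColours ε          = refl
reverse-postColours (node A B) = begin
  reverse (postColours B ++ postColours A ++ [ colour A ])
    ≡⟨ reverse-++ (postColours B) _ ⟩
  reverse (postColours A ++ [ colour A ]) ++ reverse (postColours B)
    ≡⟨ cong₂ _++_ (reverse-++ (postColours A) [ colour A ]) (reverse-postColours B) ⟩
  (colour A ∷ reverse (postColours A)) ++ leafWord (map proj₁ (peaks B))
    ≡⟨ cong (λ w → (colour A ∷ w) ++ leafWord (map proj₁ (peaks B))) (reverse-postColours A) ⟩
  (colour A ∷ leafWord (map proj₁ (peaks A))) ++ leafWord (map proj₁ (peaks B))
    ≡⟨ cong (_++ leafWord (map proj₁ (peaks B))) (leafWord-enclose A) ⟨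
  leafWord (map proj₁ (enclose (peaks A))) ++ leafWord (map proj₁ (peaks B))
    ≡⟨ leafWord-++ (map proj₁ (enclose (peaks A))) _ ⟨
  leafWord (map proj₁ (enclose (peaks A)) ++ map proj₁ (peaks B))
    ≡⟨ cong leafWord (map-++ proj₁ (enclose (peaks A)) (peaks B)) ⟨
  leafWord (map proj₁ (enclose (peaks A) ++ peaks B)) ∎
  where open ≡-Reasoning

-- By decreasing labels one meets the children, the root, then the later siblings. This is the
-- postorder of the forest, where a leaf is followed by the inner vertices that end at it.
reverse-inColours : ∀ T → reverse (inColours T) ≡ upper (peaks T)
reverse-inColours ε          = refl
reverse-inColours (node A B) = begin
  reverse (inColours B ++ colour A ∷ inColours A)
    ≡⟨ reverse-++ (inColours B) _ ⟩
  reverse (colour A ∷ inColours A) ++ reverse (inColours B)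
    ≡⟨ cong₂ _++_ (unfold-reverse (colour A) (inColours A)) (reverse-inColours B) ⟩
  (reverse (inColours A) ++ [ colour A ]) ++ upper (peaks B)
    ≡⟨ cong (λ w → (w ++ [ colour A ]) ++ upper (peaks B)) (reverse-inColours A) ⟩
  (upper (peaks A) ++ [ colour A ]) ++ upper (peaks B)
    ≡⟨ cong (_++ upper (peaks B)) (upper-enclose A) ⟨
  upper (enclose (peaks A)) ++ upper (peaks B)
    ≡⟨ word-++ (map proj₂ (enclose (peaks A))) _ ⟨
  word (map proj₂ (enclose (peaks A)) ++ map proj₂ (peaks B))
    ≡⟨ cong word (map-++ proj₂ (enclose (peaks A)) (peaks B)) ⟨
  upper (enclose (peaks A) ++ peaks B) ∎
  where open ≡-Reasoning

-- With f the position in the reading 312, this records that a vertex comes after both of its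
-- subtrees, which determines the ascents of the inverse.
Heap : (ℕ → ℕ) → ℕ → Forest → Set
Heap f o ε          = ⊤
Heap f o (node A B) = All (λ y → f y < f x) (range o (size B)) × All (λ y → f y < f x) (range x (size A)) × Heap f o B × Heap f x A
  where x = rootLabel o B

heap-pos : ∀ o T c v {π} → Unique π → π ≡ c ++ perm312 o T ++ v → Heap (pos π) o T
heap-pos o ε          c v         u eq = tt
heap-pos o (node A B) c v {π} u eq =
  All.tabulate (λ y∈ → below-x (∈-++⁺ˡ (∈-resp-↭ (↭-sym (perm312↭range o B)) y∈))) ,
  All.tabulate (λ y∈ → below-x (∈-++⁺ʳ B′ (∈-resp-↭ (↭-sym (perm312↭range x A)) y∈))) ,
  heap-pos o B c ((A′ ++ [ x ]) ++ v) u (trans eq (cong (c ++_) (++-assoc B′ (A′ ++ [ x ]) v))) ,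
  heap-pos x A (c ++ B′) (x ∷ v) u eqA
  where
  x = rootLabel o B
  A′ = perm312 x A
  B′ = perm312 o B

  eqA : π ≡ (c ++ B′) ++ A′ ++ x ∷ v
  eqA = trans eq (trans (cong (c ++_) (trans (++-assoc B′ (A′ ++ [ x ]) v) (cong (B′ ++_) (++-assoc A′ [ x ] v)))) (sym (++-assoc c B′ (A′ ++ x ∷ v))))

  eqx : π ≡ (c ++ B′ ++ A′) ++ x ∷ v
  eqx = trans eqA (trans (sym (++-assoc (c ++ B′) A′ (x ∷ v))) (cong (_++ x ∷ v) (++-assoc c B′ A′)))

  below-x : ∀ {y} → y ∈ B′ ++ A′ → pos π y < pos π x
  below-x {y} y∈ = subst₂ _<_ (cong (λ w → pos w y) (sym eqx))
    (trans (sym (pos-mid (c ++ B′ ++ A′) v (unique-disjoint _ (subst Unique eqx u) (here refl)))) (cong (λ w → pos w x) (sym eqx)))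
    (s≤s (pos-≤ (c ++ B′ ++ A′) (x ∷ v) (∈-++⁺ʳ c y∈)))

-- If A is not empty, the label after x is the least one of A and has smaller f; otherwise it
-- belongs to an ancestor or lies beyond the block and has larger f. The value z stands for f at the
-- first label beyond the block.
ascents-heap : ∀ f o T z → Heap f o T → All (λ y → f y < z) (range o (size T)) →
               map ascentStep (adjacent ascent (map f (range o (size T)) ++ [ z ])) ≡ inColours T
ascents-heap f o ε          z _                   _  = refl
ascents-heap f o (node A B) z (hB< , hA< , hB , hA) fz = begin
  map ascentStep (adjacent ascent (map f (range o (size (node A B))) ++ [ z ]))
    ≡⟨ cong (λ w → map ascentStep (adjacent ascent w)) (trans (cong (λ w → map f w ++ [ z ]) (range-node o A B))
         (trans (cong (_++ [ z ]) (map-++ f (range o (size B)) _)) (++-assoc (map f (range o (size B))) _ [ z ]))) ⟩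
  map ascentStep (adjacent ascent (map f (range o (size B)) ++ f x ∷ map f (range x (size A)) ++ [ z ]))
    ≡⟨ trans (cong (map ascentStep) (adjacent-++ ascent (map f (range o (size B))) (f x) _)) (map-++ ascentStep (adjacent ascent (map f (range o (size B)) ++ [ f x ])) _) ⟩
  map ascentStep (adjacent ascent (map f (range o (size B)) ++ [ f x ])) ++ map ascentStep (adjacent ascent (f x ∷ map f (range x (size A)) ++ [ z ]))
    ≡⟨ cong₂ _++_ (ascents-heap f o B (f x) hB hB<) (root-step A hA< hA fzA) ⟩
  inColours B ++ colour A ∷ inColours A ∎
  where
  open ≡-Reasoning
  x = rootLabel o B

  fz′ : All (λ y → f y < z) (range o (size B) ++ x ∷ range x (size A))
  fz′ = subst (All (λ y → f y < z)) (range-node o A B) fz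

  fzA : All (λ y → f y < z) (range x (size A))
  fzA = All.tail (Allₚ.++⁻ʳ (range o (size B)) fz′)

  fxz : f x < z
  fxz = All.head (Allₚ.++⁻ʳ (range o (size B)) fz′)

  root-step : ∀ A → All (λ y → f y < f x) (range x (size A)) → Heap f x A → All (λ y → f y < z) (range x (size A)) →
              map ascentStep (adjacent ascent (f x ∷ map f (range x (size A)) ++ [ z ])) ≡ colour A ∷ inColours A
  root-step ε _ _ _ = cong (λ t → ascentStep t ∷ []) (<ᵇ-true fxz)
  root-step A@(node A₁ A₂) hA< hA fzA = trans (go (size A) hA< (trans (+-suc (size A₂) (size A₁)) refl)) (cong (D ∷_) (ascents-heap f x A z hA fzA))
    where
    go : ∀ m {m′} → All (λ y → f y < f x) (range x m) → m ≡ suc m′ →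
         map ascentStep (adjacent ascent (f x ∷ map f (range x m) ++ [ z ])) ≡ D ∷ map ascentStep (adjacent ascent (map f (range x m) ++ [ z ]))
    go (suc m) (h ∷ _) refl = cong (λ t → ascentStep t ∷ map ascentStep (adjacent ascent (map f (range x (suc m)) ++ [ z ]))) (<ᵇ-false (<-asym h))

DL-perm312 : ∀ k T ps → size T ≡ suc (k + k) → peaks T ≡ (0 , 0) ∷ ps → DL k (perm312 0 T) ≡ (lower ps , upper ps)
DL-perm312 k T ps sizeT peaksT = cong₂ _,_ first second
  where
  open ≡-Reasoning
  m = k + k
  π = perm312 0 T

  length-π : length π ≡ suc m
  length-π = trans (length-perm312 0 T) sizeT

  π↭ : π ↭ range 0 (suc m)
  π↭ = subst (λ n → π ↭ range 0 n) sizeT (perm312↭range 0 T)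

  adjacent-0∷ : ∀ w {n} → length w ≡ suc n → adjacent descent (0 ∷ w) ≡ false ∷ adjacent descent w
  adjacent-0∷ (y ∷ w) _ = refl

  first : map (λ i → if isDes π (suc m ∸ i) then D else U) (range1 m) ≡ lower ps
  first = begin
    map (λ i → descentStep (isDes π (suc m ∸ i))) (range1 m)         ≡⟨ cong (map (λ i → descentStep (isDes π (suc m ∸ i)))) (range1≡range m) ⟩
    map (λ i → descentStep (isDes π (suc m ∸ i))) (range 0 m)        ≡⟨ map-∘ (range 0 m) ⟩
    map (descentStep ∘ isDes π) (map (suc m ∸_) (range 0 m))         ≡⟨ cong (map (descentStep ∘ isDes π)) (map-∸-range m) ⟩
    map (descentStep ∘ isDes π) (reverse (range 0 m))                ≡⟨ reverse-map (descentStep ∘ isDes π) (range 0 m) ⟩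
    reverse (map (descentStep ∘ isDes π) (range 0 m))                ≡⟨ cong reverse (map-∘ (range 0 m)) ⟩
    reverse (map descentStep (map (isDes π) (range 0 m)))            ≡⟨ cong (reverse ∘ map descentStep) (isDes-adjacent π length-π) ⟩
    reverse (map descentStep (adjacent descent π))                   ≡⟨ ∷ʳ-injectiveˡ _ _ padded ⟩
    lower ps                                                         ∎
    where
    -- The dummy letter 0 makes the first letter of π an ascent, whose U ends the reversed word. The
    -- leading peak (0 , 0) puts a U in front; `U∷leafWord` moves each U before its run and leaves
    -- one at the end, so the two final letters cancel.
    padded : reverse (map descentStep (adjacent descent π)) ++ [ U ] ≡ lower ps ++ [ U ]
    padded = begin
      reverse (map descentStep (adjacent descent π)) ++ [ U ]   ≡⟨ unfold-reverse U (map descentStep (adjacent descent π)) ⟨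
      reverse (U ∷ map descentStep (adjacent descent π))        ≡⟨ cong (reverse ∘ map descentStep) (adjacent-0∷ π length-π) ⟨
      reverse (map descentStep (adjacent descent (0 ∷ π)))      ≡⟨ cong reverse (descents-perm312 0 0 T z≤n) ⟩
      reverse (postColours T)                                   ≡⟨ reverse-postColours T ⟩
      leafWord (map proj₁ (peaks T))                            ≡⟨ cong (leafWord ∘ map proj₁) peaksT ⟩
      U ∷ leafWord (map proj₁ ps)                               ≡⟨ U∷leafWord (map proj₁ ps) ⟩
      lower ps ++ [ U ]                                         ∎

  positions = map (pos π) (range 0 (suc m))

  rot-π : rot π ≡ reverse positions
  rot-π = cong reverse (inv≡ π↭)

  adjacent-∷ʳ : ∀ x xs z → ∃[ t ] adjacent ascent (x ∷ xs ++ [ z ]) ≡ adjacent ascent (x ∷ xs) ++ [ t ]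
  adjacent-∷ʳ x xs z = _ , adjacent-∷-++ ascent x xs [ z ]

  second : map (λ i → if isDes (rot π) i then U else D) (range1 m) ≡ upper ps
  second = begin
    map (λ i → ascentStep (isDes (rot π) i)) (range1 m)         ≡⟨ cong (map (ascentStep ∘ isDes (rot π))) (range1≡range m) ⟩
    map (ascentStep ∘ isDes (rot π)) (range 0 m)                ≡⟨ map-∘ (range 0 m) ⟩
    map ascentStep (map (isDes (rot π)) (range 0 m))            ≡⟨ cong (map ascentStep) (isDes-adjacent (rot π) length-rot) ⟩
    map ascentStep (adjacent descent (rot π))                   ≡⟨ cong (map ascentStep ∘ adjacent descent) rot-π ⟩
    map ascentStep (adjacent descent (reverse positions))       ≡⟨ cong (map ascentStep) (adjacent-reverse descent positions) ⟩
    map ascentStep (reverse (adjacent ascent positions))        ≡⟨ reverse-map ascentStep (adjacent ascent positions) ⟩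
    reverse (map ascentStep (adjacent ascent positions))        ≡⟨ ∷-injectiveʳ padded ⟩
    upper ps                                                    ∎
    where
    length-rot : length (rot π) ≡ suc m
    length-rot = trans (cong length rot-π) (trans (length-reverse positions) (trans (length-map (pos π) (range 0 (suc m))) (length-range 0 (suc m))))

    -- A value beyond all positions gives the largest label an ascent; its U is that of the leading
    -- leaf and is cancelled.
    z = suc (length π)

    pos<z : All (λ y → pos π y < z) (range 0 (suc m))
    pos<z = All.tabulate λ {y} y∈ → s≤s (subst (λ w → pos w y ≤ length π) (++-identityʳ π) (pos-≤ π [] (∈-resp-↭ (↭-sym π↭) y∈)))

    t = proj₁ (adjacent-∷ʳ (pos π 1) (map (pos π) (range 1 m)) z)

    padded : ascentStep t ∷ reverse (map ascentStep (adjacent ascent positions)) ≡ U ∷ upper ps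
    padded = begin
      ascentStep t ∷ reverse (map ascentStep (adjacent ascent positions))
        ≡⟨ reverse-++ (map ascentStep (adjacent ascent positions)) [ ascentStep t ] ⟨
      reverse (map ascentStep (adjacent ascent positions) ++ [ ascentStep t ])
        ≡⟨ cong reverse (map-++ ascentStep (adjacent ascent positions) [ t ]) ⟨
      reverse (map ascentStep (adjacent ascent positions ++ [ t ]))
        ≡⟨ cong (reverse ∘ map ascentStep) (proj₂ (adjacent-∷ʳ (pos π 1) (map (pos π) (range 1 m)) z)) ⟨
      reverse (map ascentStep (adjacent ascent (positions ++ [ z ])))
        ≡⟨ cong (λ n → reverse (map ascentStep (adjacent ascent (map (pos π) (range 0 n) ++ [ z ])))) sizeT ⟨
      reverse (map ascentStep (adjacent ascent (map (pos π) (range 0 (size T)) ++ [ z ])))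
        ≡⟨ cong reverse (ascents-heap (pos π) 0 T z (heap-pos 0 T [] [] (perm-unique π↭) (sym (++-identityʳ π)))
             (subst (λ n → All (λ y → pos π y < z) (range 0 n)) (sym sizeT) pos<z)) ⟩
      reverse (inColours T)   ≡⟨ reverse-inColours T ⟩
      upper (peaks T)         ≡⟨ cong upper peaksT ⟩
      U ∷ upper ps            ∎

-- Uniquely sorted permutations and stack runs

data LTree : Set where
  nil : LTree
  br  : LTree → ℕ → LTree → LTree

inorder postorder : LTree → List ℕ
inorder nil          = []
inorder (br l x r)   = inorder l ++ x ∷ inorder r
postorder nil        = []
postorder (br l x r) = postorder l ++ postorder r ++ [ x ]

root : LTree → ℕ
root nil        = 0
root (br l x r) = x

Decreasing : LTree → Set
Decreasing nil        = ⊤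
Decreasing (br l x r) = All (_< x) (postorder l) × All (_< x) (postorder r) × Decreasing l × Decreasing r

inorder↭postorder : ∀ t → inorder t ↭ postorder t
inorder↭postorder nil        = ↭-refl
inorder↭postorder (br l x r) = ↭-trans (Permₚ.++⁺ˡ (inorder l) (Permₚ.++-comm [ x ] (inorder r)))
  (Permₚ.++⁺ (inorder↭postorder l) (Permₚ.++⁺ʳ [ x ] (inorder↭postorder r)))

maxL-≤ : ∀ {m xs} → All (_≤ m) xs → maxL xs ≤ m
maxL-≤ []         = z≤n
maxL-≤ (px ∷ pxs) = ⊔-lub px (maxL-≤ pxs)

≤-maxL : ∀ xs → All (_≤ maxL xs) xs
≤-maxL []       = []
≤-maxL (x ∷ xs) = m≤m⊔n x (maxL xs) ∷ All.map (λ h → ≤-trans h (m≤n⊔m x (maxL xs))) (≤-maxL xs)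

maxL∈ : ∀ x xs → maxL (x ∷ xs) ∈ x ∷ xs
maxL∈ x []       = here (⊔-identityʳ x)
maxL∈ x (y ∷ xs) with ⊔-sel x (maxL (y ∷ xs))
... | inj₁ eq = here eq
... | inj₂ eq = there (subst (_∈ y ∷ xs) (sym eq) (maxL∈ y xs))

maxL-mid : ∀ {x} L R → All (_< x) L → All (_< x) R → maxL (L ++ x ∷ R) ≡ x
maxL-mid {x} L R L< R< = ≤-antisym
  (maxL-≤ (Allₚ.++⁺ (All.map <⇒≤ L<) (≤-refl ∷ All.map <⇒≤ R<)))
  (All.lookup (≤-maxL (L ++ x ∷ R)) (∈-++⁺ʳ L (here refl)))

stackSortF-split : ∀ f L x R → All (_< x) L → All (_< x) R →
                   stackSortF (suc f) (L ++ x ∷ R) ≡ stackSortF f L ++ stackSortF f R ++ [ x ]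
stackSortF-split f L x R L< R< = trans (unfold (L ++ x ∷ R) (λ eq → case ++-conicalʳ L (x ∷ R) eq of λ ()))
  (cong₂ (λ m p → stackSortF f (proj₁ p) ++ stackSortF f (proj₂ p) ++ [ m ]) max
    (trans (cong (λ m → splitOn m (L ++ x ∷ R)) max) (splitOn-mid x L R (λ x∈ → <-irrefl refl (All.lookup L< x∈)))))
  where
  max = maxL-mid L R L< R<
  unfold : ∀ ys → ys ≢ [] → stackSortF (suc f) ys ≡
           stackSortF f (proj₁ (splitOn (maxL ys) ys)) ++ stackSortF f (proj₂ (splitOn (maxL ys) ys)) ++ [ maxL ys ]
  unfold []       ≢[] = ⊥-elim (≢[] refl)
  unfold (y ∷ ys) _   = refl

stackSortF-inorder : ∀ f t → Decreasing t → length (inorder t) ≤ f → stackSortF f (inorder t) ≡ postorder t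
stackSortF-inorder zero    nil        _ _ = refl
stackSortF-inorder (suc f) nil        _ _ = refl
stackSortF-inorder zero    (br l x r) _ le = ⊥-elim (n≮0 (≤-trans (≤-reflexive (sym (length-++-sucʳ (inorder l) x (inorder r)))) le))
stackSortF-inorder (suc f) (br l x r) (l< , r< , dl , dr) le =
  trans (stackSortF-split f (inorder l) x (inorder r) (All-resp-↭ (↭-sym (inorder↭postorder l)) l<) (All-resp-↭ (↭-sym (inorder↭postorder r)) r<))
    (cong₂ (λ u v → u ++ v ++ [ x ])
      (stackSortF-inorder f l dl (≤-trans (length-++-≤ˡ (inorder l)) le′))
      (stackSortF-inorder f r dr (≤-trans (length-++-≤ʳ (inorder r) {inorder l}) le′)))
  where
  le′ : length (inorder l ++ inorder r) ≤ f
  le′ = s≤s⁻¹ (≤-trans (≤-reflexive (sym (length-++-sucʳ (inorder l) x (inorder r)))) le)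

s-inorder : ∀ t → Decreasing t → s (inorder t) ≡ postorder t
s-inorder t d = stackSortF-inorder (length (inorder t)) t d ≤-refl

decreasing-tree : ∀ n xs → length xs ≤ n → Unique xs → ∃[ t ] Decreasing t × inorder t ≡ xs
decreasing-tree n       []       _  _ = nil , tt , refl
decreasing-tree (suc n) (x ∷ xs) le u with maxL (x ∷ xs) | maxL∈ x xs | ≤-maxL (x ∷ xs)
... | m | m∈ | ≤m with L , R , eq ← ∈-∃++ m∈ =
  br l m r , (smaller l dl eql (unique-disjointˡ) (Allₚ.++⁻ˡ L ≤m′) , smaller r dr eqr (λ { z∈ refl → All.lookup (mid-unique L u′) z∈ refl }) (All.tail (Allₚ.++⁻ʳ L ≤m′)) , dl , dr) ,
  trans (cong₂ (λ v w → v ++ m ∷ w) eql eqr) (sym eq)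
  where
  u′ : Unique (L ++ m ∷ R)
  u′ = subst Unique eq u
  ≤m′ : All (_≤ m) (L ++ m ∷ R)
  ≤m′ = subst (All (_≤ m)) eq ≤m
  le′ : length (L ++ R) ≤ n
  le′ = s≤s⁻¹ (≤-trans (≤-reflexive (sym (trans (cong length eq) (length-++-sucʳ L m R)))) le)
  mid-unique : ∀ L → Unique (L ++ m ∷ R) → All (m ≢_) R
  mid-unique L u with unique-++⁻ʳ L u
  ... | m∉ ∷ _ = m∉
  tail-unique : Unique R
  tail-unique with unique-++⁻ʳ L u′
  ... | _ ∷ uR = uR
  recL = decreasing-tree n L (≤-trans (length-++-≤ˡ L) le′) (unique-++⁻ˡ L u′)
  recR = decreasing-tree n R (≤-trans (length-++-≤ʳ R {L}) le′) tail-unique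
  l = proj₁ recL
  r = proj₁ recR
  dl = proj₁ (proj₂ recL)
  dr = proj₁ (proj₂ recR)
  eql = proj₂ (proj₂ recL)
  eqr = proj₂ (proj₂ recR)
  unique-disjointˡ : ∀ {z} → z ∈ L → z ≢ m
  unique-disjointˡ z∈ refl = unique-disjoint L u′ (here refl) z∈
  smaller : ∀ t {xs} → Decreasing t → inorder t ≡ xs → (∀ {z} → z ∈ xs → z ≢ m) → All (_≤ m) xs → All (_< m) (postorder t)
  smaller t d refl ≢m ≤m = All-resp-↭ (inorder↭postorder t) (All.tabulate λ z∈ → ≤∧≢⇒< (All.lookup ≤m z∈) (≢m z∈))

headOr0 : List ℕ → ℕ
headOr0 []      = 0
headOr0 (x ∷ _) = x

-- Full decreasing trees in which every left child is a descent of the postorder word.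
data Tight : LTree → Set where
  leaf : ∀ {x} → Tight (br nil x nil)
  fork : ∀ {l x r} → Tight l → Tight r → headOr0 (postorder r) < root l → Tight (br l x r)

postorder≢[] : ∀ l x r → postorder (br l x r) ≢ []
postorder≢[] l x r eq = case ++-conicalʳ (postorder r) [ x ] (++-conicalʳ (postorder l) _ eq) of λ ()

postorder-tight≢[] : ∀ {t} → Tight t → postorder t ≢ []
postorder-tight≢[] {br l x r} _ = postorder≢[] l x r

inorder-tight≢[] : ∀ {t} → Tight t → inorder t ≢ []
inorder-tight≢[] {br l x r} _ eq = case ++-conicalʳ (inorder l) (x ∷ inorder r) eq of λ ()

headOr0-++ : ∀ xs ys → xs ≢ [] → headOr0 (xs ++ ys) ≡ headOr0 xs
headOr0-++ []       ys ≢[] = ⊥-elim (≢[] refl)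
headOr0-++ (x ∷ xs) ys _   = refl

headOr0-All : ∀ {P : ℕ → Set} {xs} → xs ≢ [] → All P xs → P (headOr0 xs)
headOr0-All ≢[] []       = ⊥-elim (≢[] refl)
headOr0-All ≢[] (px ∷ _) = px

≤-root : ∀ t → Decreasing t → All (_≤ root t) (postorder t)
≤-root nil        _                  = []
≤-root (br l x r) (l< , r< , _ , _) = Allₚ.++⁺ (All.map <⇒≤ l<) (Allₚ.++⁺ (All.map <⇒≤ r<) (≤-refl ∷ []))

root∈ : ∀ {t} → Tight t → root t ∈ postorder t
root∈ {br l x r} _ = ∈-++⁺ʳ (postorder l) (∈-++⁺ʳ (postorder r) (here refl))

headOr0∈ : ∀ {xs} → xs ≢ [] → headOr0 xs ∈ xs
headOr0∈ {[]}     ≢[] = ⊥-elim (≢[] refl)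
headOr0∈ {x ∷ xs} _   = here refl

-- The first postorder letter of a tight r is its leftmost leaf. Hung there as left child, l
-- precedes everything in postorder, and all vertices above the leaf carry still larger letters.
graft : ∀ l {r} → Decreasing l → Tight r → Decreasing r → All (_< headOr0 (postorder r)) (postorder l) →
        ∃[ r′ ] Decreasing r′ × postorder r′ ≡ postorder l ++ postorder r
graft l dl (leaf {y}) _ l< = br l y nil , (l< , [] , dl , tt) , refl
graft l {br a y b} dl (fork ta tb _) (a< , b< , da , db) l< =
  br a′ y b , (subst (All (_< y)) (sym eq) (Allₚ.++⁺ (All.map (λ h → <-trans h (headOr0-All (postorder-tight≢[] ta) a<)) l<a) a<) , b< , da′ , db) ,
  trans (cong (_++ postorder b ++ [ y ]) eq) (++-assoc (postorder l) (postorder a) _)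
  where
  l<a : All (_< headOr0 (postorder a)) (postorder l)
  l<a = subst (λ h → All (_< h) (postorder l)) (headOr0-++ (postorder a) _ (postorder-tight≢[] ta)) l<
  rec = graft l dl ta da l<a
  a′ = proj₁ rec
  da′ = proj₁ (proj₂ rec)
  eq = proj₂ (proj₂ rec)

++≢∷ : ∀ {x} xs {ys zs} → xs ≢ [] → All (_< x) xs → xs ++ ys ≢ x ∷ zs
++≢∷ []       ≢[] _        _    = ≢[] refl
++≢∷ (y ∷ xs) _   (y< ∷ _) refl = <-irrefl refl y<

Another : LTree → Set
Another t = ∃[ t′ ] Decreasing t′ × postorder t′ ≡ postorder t × inorder t′ ≢ inorder t

-- An only child can be moved to the other side. If a left child is not a descent, all of l lies
-- below the first letter of r and can be grafted onto r, which leaves the root an only child. The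
-- postorder is kept, while x comes to or leaves the front of the inorder. A change inside a subtree
-- carries over.
tight-or-another : ∀ t → Decreasing t → Unique (postorder t) → t ≡ nil ⊎ Tight t ⊎ Another t
tight-or-another nil _ _ = inj₁ refl
tight-or-another (br l x r) (l< , r< , dl , dr) u
  with tight-or-another l dl (unique-++⁻ˡ (postorder l) u)
     | tight-or-another r dr (unique-++⁻ˡ (postorder r) (unique-++⁻ʳ (postorder l) u))
... | inj₂ (inj₂ (l′ , dl′ , eq , ≢)) | _ =
  inj₂ (inj₂ (br l′ x r , (subst (All (_< x)) (sym eq) l< , r< , dl′ , dr) , cong (_++ postorder r ++ [ x ]) eq ,
    λ eq′ → ≢ (++-cancelʳ (x ∷ inorder r) (inorder l′) (inorder l) eq′)))
... | _ | inj₂ (inj₂ (r′ , dr′ , eq , ≢)) =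
  inj₂ (inj₂ (br l x r′ , (l< , subst (All (_< x)) (sym eq) r< , dl , dr′) , cong (λ w → postorder l ++ w ++ [ x ]) eq ,
    λ eq′ → ≢ (∷-injectiveʳ (++-cancelˡ (inorder l) _ _ eq′))))
... | inj₁ refl | inj₁ refl = inj₂ (inj₁ leaf)
... | inj₁ refl | inj₂ (inj₁ tr) =
  inj₂ (inj₂ (br r x nil , (r< , [] , dr , tt) , refl ,
    ++≢∷ (inorder r) (inorder-tight≢[] tr) (All-resp-↭ (↭-sym (inorder↭postorder r)) r<)))
... | inj₂ (inj₁ tl) | inj₁ refl =
  inj₂ (inj₂ (br nil x l , ([] , l< , tt , dl) , refl ,
    λ eq → ++≢∷ (inorder l) (inorder-tight≢[] tl) (All-resp-↭ (↭-sym (inorder↭postorder l)) l<) (sym eq)))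
... | inj₂ (inj₁ tl) | inj₂ (inj₁ tr) with <-cmp (headOr0 (postorder r)) (root l)
... | tri< h _ _ = inj₂ (inj₁ (fork tl tr h))
... | tri≈ _ h _ = ⊥-elim (unique-disjoint (postorder l) u
        (∈-++⁺ˡ (headOr0∈ (postorder-tight≢[] tr))) (subst (_∈ postorder l) (sym h) (root∈ tl)))
... | tri> _ _ h =
  let r′ , dr′ , eq = graft l dl tr dr (All.map (λ le → ≤-<-trans le h) (≤-root l dl))
  in inj₂ (inj₂ (br nil x r′ , ([] , subst (All (_< x)) (sym eq) (Allₚ.++⁺ l< r<) , tt , dr′) ,
       trans (cong (_++ [ x ]) eq) (++-assoc (postorder l) (postorder r) [ x ]) ,
       λ eq′ → ++≢∷ (inorder l) (inorder-tight≢[] tl) (All-resp-↭ (↭-sym (inorder↭postorder l)) l<) (sym eq′)))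

-- Tightness by counting descents

drop₁ : ℕ → ℕ → ℕ
drop₁ p y = if y <ᵇ p then 1 else 0

descents : ℕ → List ℕ → ℕ
descents p []       = 0
descents p (y ∷ ys) = drop₁ p y + descents y ys

descents-++ : ∀ p xs ys → descents p (xs ++ ys) ≡ descents p xs + descents (lastOr p xs) ys
descents-++ p []       ys = refl
descents-++ p (x ∷ xs) ys = trans (cong (drop₁ p x +_) (descents-++ x xs ys)) (sym (+-assoc (drop₁ p x) (descents x xs) _))

lastOr-postorder : ∀ p t → t ≢ nil → lastOr p (postorder t) ≡ root t
lastOr-postorder p nil        ≢nil = ⊥-elim (≢nil refl)
lastOr-postorder p (br l x r) _    = trans (lastOr-++ p (postorder l) _) (lastOr-++ (lastOr p (postorder l)) (postorder r) [ x ])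

descents-head : ∀ p xs → xs ≢ [] → descents p xs ≡ drop₁ p (headOr0 xs) + descents 0 xs
descents-head p []       ≢[] = ⊥-elim (≢[] refl)
descents-head p (x ∷ xs) _   = refl

descents-br : ∀ l x r → All (_< x) (postorder l) → All (_< x) (postorder r) →
              descents 0 (postorder (br l x r)) ≡ descents 0 (postorder l) + descents (lastOr 0 (postorder l)) (postorder r)
descents-br l x r l< r< = trans (descents-++ 0 (postorder l) _) (cong (descents 0 (postorder l) +_)
  (trans (descents-++ q (postorder r) [ x ]) (trans (cong (descents q (postorder r) +_) last) (+-identityʳ _))))
  where
  q = lastOr 0 (postorder l)
  last : descents (lastOr q (postorder r)) [ x ] ≡ 0
  last = trans (+-identityʳ _) (cong (if_then 1 else 0) (<ᵇ-false (≤⇒≯ (lastOr-All {P = _≤ x} (lastOr-All {P = _≤ x} z≤n (All.map <⇒≤ l<)) (All.map <⇒≤ r<)))))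

length-postorder : ∀ l x r → length (postorder (br l x r)) ≡ length (postorder l) + (length (postorder r) + 1)
length-postorder l x r = trans (length-++ (postorder l)) (cong (length (postorder l) +_) (length-++ (postorder r)))

descents-br₂ : ∀ l x r → All (_< x) (postorder l) → All (_< x) (postorder r) → l ≢ nil → postorder r ≢ [] →
  descents 0 (postorder (br l x r)) ≡
  descents 0 (postorder l) + (drop₁ (root l) (headOr0 (postorder r)) + descents 0 (postorder r))
descents-br₂ l x r l< r< l≢ r≢ = trans (descents-br l x r l< r<) (cong (descents 0 (postorder l) +_)
  (trans (cong (λ q → descents q (postorder r)) (lastOr-postorder 0 l l≢)) (descents-head (root l) (postorder r) r≢)))

tight≢nil : ∀ {t} → Tight t → t ≢ nil
tight≢nil leaf         ()
tight≢nil (fork _ _ _) ()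

-- Each fork brings exactly one descent, from the root of l to the first letter of r, while its own
-- letter is an ascent. A full tree with d forks has 2d + 1 vertices.
tight-length : ∀ t → Decreasing t → Tight t → let d = descents 0 (postorder t) in length (postorder t) ≡ 1 + (d + d)
tight-length t _ leaf = refl
tight-length (br l x r) (l< , r< , dl , dr) (fork tl tr h<) = begin
  length (postorder (br l x r))             ≡⟨ length-postorder l x r ⟩
  length (postorder l) + (length (postorder r) + 1) ≡⟨ cong₂ (λ u v → u + (v + 1)) (tight-length l dl tl) (tight-length r dr tr) ⟩
  1 + (a + a) + (1 + (b + b) + 1)           ≡⟨ regroup a b ⟩
  1 + ((a + (1 + b)) + (a + (1 + b)))       ≡⟨ cong (λ v → 1 + (v + v)) d≡ ⟨
  1 + (d + d)                               ∎
  where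
  open ≡-Reasoning
  a = descents 0 (postorder l)
  b = descents 0 (postorder r)
  d = descents 0 (postorder (br l x r))
  d≡ : d ≡ a + (1 + b)
  d≡ = trans (descents-br₂ l x r l< r< (tight≢nil tl) (postorder-tight≢[] tr)) (cong (λ v → a + (v + b)) (cong (if_then 1 else 0) (<ᵇ-true h<)))
  regroup : ∀ a b → 1 + (a + a) + (1 + (b + b) + 1) ≡ 1 + ((a + (1 + b)) + (a + (1 + b)))
  regroup = solve-∀

TightOrLong : LTree → Set
TightOrLong t = Tight t ⊎ 2 + (d + d) ≤ length (postorder t)
  where d = descents 0 (postorder t)

-- A decreasing tree has at least as many binary vertices as its postorder word has descents.
tight-or-long : ∀ t → Decreasing t → t ≢ nil → TightOrLong t
tight-or-long nil _ ≢nil = ⊥-elim (≢nil refl)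
tight-or-long t@(br l′ x r′) dt@(l< , r< , dl , dr) _ = go l′ r′ refl refl
  where
  weak : ∀ t → Decreasing t → TightOrLong t →
         let d = descents 0 (postorder t) in 1 + (d + d) ≤ length (postorder t)
  weak t dt (inj₁ tight) = ≤-reflexive (sym (tight-length t dt tight))
  weak t dt (inj₂ long)  = <⇒≤ long

  unary : ∀ t′ {m n} → Decreasing t′ → TightOrLong t′ →
          m ≡ descents 0 (postorder t′) → n ≡ length (postorder t′) + 1 → 2 + (m + m) ≤ n
  unary t′ dt′ ih refl refl = ≤-trans (s≤s (weak t′ dt′ ih)) (≤-reflexive (+-comm 1 _))

  go : ∀ l r → l′ ≡ l → r′ ≡ r → TightOrLong (br l′ x r′)
  go nil          nil          refl refl = inj₁ leaf
  go nil          r@(br _ _ _) refl refl =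
    inj₂ (unary r dr (tight-or-long r dr λ ()) (descents-br nil x r l< r<) (length-postorder nil x r))
  go l@(br _ _ _) nil          refl refl =
    inj₂ (unary l dl (tight-or-long l dl λ ()) (trans (descents-br l x nil l< r<) (+-identityʳ _)) (length-postorder l x nil))
  go l@(br _ _ _) r@(br r₁ y r₂) refl refl = binary (tight-or-long l dl λ ()) (tight-or-long r dr λ ()) (headOr0 (postorder r) <? root l)
    where
    open ≤-Reasoning
    ll = length (postorder l)
    lr = length (postorder r)
    a  = descents 0 (postorder l)
    b  = descents 0 (postorder r)
    c  = drop₁ (root l) (headOr0 (postorder r))
    d  = descents 0 (postorder (br l x r))

    d≡ : d ≡ a + (c + b)
    d≡ = descents-br₂ l x r l< r< (λ ()) (postorder≢[] r₁ y r₂)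

    c≤1 : c ≤ 1
    c≤1 with headOr0 (postorder r) <ᵇ root l
    ... | true  = ≤-refl
    ... | false = z≤n

    -- If the junction of l and r is no descent, the weak bounds on both subtrees suffice; otherwise
    -- one subtree has to be long. The last 1 in each constant is the root.
    long : c ≡ 0 × 3 + ((a + a) + (b + b)) ≤ ll + (lr + 1) ⊎ 4 + ((a + a) + (b + b)) ≤ ll + (lr + 1) →
           2 + (d + d) ≤ length (postorder (br l x r))
    long (inj₁ (c≡0 , h)) = begin
      2 + (d + d)                     ≡⟨ cong (λ v → 2 + (v + v)) (trans d≡ (cong (λ v → a + (v + b)) c≡0)) ⟩
      2 + ((a + b) + (a + b))         ≡⟨ regroup a b ⟩
      2 + ((a + a) + (b + b))         ≤⟨ n≤1+n _ ⟩
      3 + ((a + a) + (b + b))         ≤⟨ h ⟩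
      ll + (lr + 1)                   ≡⟨ length-postorder l x r ⟨
      length (postorder (br l x r))   ∎
      where
      regroup : ∀ a b → 2 + ((a + b) + (a + b)) ≡ 2 + ((a + a) + (b + b))
      regroup = solve-∀
    long (inj₂ h) = begin
      2 + (d + d)                                 ≡⟨ cong (λ v → 2 + (v + v)) d≡ ⟩
      2 + ((a + (c + b)) + (a + (c + b)))         ≡⟨ regroup a b c ⟩
      2 + (c + c) + ((a + a) + (b + b))           ≤⟨ +-monoˡ-≤ _ (+-monoʳ-≤ 2 (+-mono-≤ c≤1 c≤1)) ⟩
      4 + ((a + a) + (b + b))                     ≤⟨ h ⟩
      ll + (lr + 1)                               ≡⟨ length-postorder l x r ⟨
      length (postorder (br l x r))               ∎
      where
      regroup : ∀ a b c → 2 + ((a + (c + b)) + (a + (c + b))) ≡ 2 + (c + c) + ((a + a) + (b + b))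
      regroup = solve-∀

    sum₃ : ∀ i j → i + (a + a) ≤ ll → j + (b + b) ≤ lr → i + j + 1 + ((a + a) + (b + b)) ≤ ll + (lr + 1)
    sum₃ i j h h′ = ≤-trans (≤-reflexive (regroup i j (a + a) (b + b))) (+-mono-≤ h (+-monoˡ-≤ 1 h′))
      where
      regroup : ∀ i j a b → i + j + 1 + (a + b) ≡ (i + a) + ((j + b) + 1)
      regroup = solve-∀

    binary : TightOrLong l → TightOrLong r → Dec (headOr0 (postorder r) < root l) → TightOrLong (br l x r)
    binary hl        hr        (no h≮)  = inj₂ (long (inj₁ (cong (if_then 1 else 0) (<ᵇ-false h≮) , sum₃ 1 1 (weak l dl hl) (weak r dr hr))))
    binary (inj₂ hl) hr        (yes _)  = inj₂ (long (inj₂ (sum₃ 2 1 hl (weak r dr hr))))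
    binary (inj₁ tl) (inj₂ hr) (yes _)  = inj₂ (long (inj₂ (sum₃ 1 2 (weak l dl (inj₁ tl)) hr)))
    binary (inj₁ tl) (inj₁ tr) (yes h<) = inj₁ (fork tl tr h<)

-- By `tight-length` and `tight-or-long`, tightness of a decreasing tree is visible in the length
-- and the descents of its postorder word, which the trees share.
tight-resp-postorder : ∀ t t′ → Decreasing t → Decreasing t′ → Tight t → postorder t′ ≡ postorder t → Tight t′
tight-resp-postorder t t′ dt dt′ tight eq with tight-or-long t′ dt′ (λ { refl → postorder-tight≢[] tight (sym eq) })
... | inj₁ tight′ = tight′
... | inj₂ long   = ⊥-elim (<-irrefl refl (≤-trans (subst (λ w → 2 + (descents 0 w + descents 0 w) ≤ length w) eq long)
                      (≤-reflexive (tight-length t dt tight))))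

-- Reads a postorder word of a tight tree, a descent being a leaf and an ascent a binary vertex.
combine : ℕ → List LTree → List LTree
combine y (r ∷ l ∷ st) = br l y r ∷ st
combine y st           = st

rebuild : List LTree → ℕ → List ℕ → List LTree
rebuild st p []       = st
rebuild st p (y ∷ ys) = rebuild (if y <ᵇ p then br nil y nil ∷ st else combine y st) y ys

rebuild-postorder : ∀ t st p v → Decreasing t → Tight t → headOr0 (postorder t) < p →
                    rebuild st p (postorder t ++ v) ≡ rebuild (t ∷ st) (root t) v
rebuild-postorder (br nil x nil) st p v _ leaf h = cong (λ b → rebuild (if b then br nil x nil ∷ st else combine x st) x v) (<ᵇ-true h)
rebuild-postorder (br l x r) st p v (l< , r< , dl , dr) (fork tl tr h<) h = begin
  rebuild st p ((postorder l ++ postorder r ++ [ x ]) ++ v)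
    ≡⟨ cong (rebuild st p) (trans (++-assoc (postorder l) _ v) (cong (postorder l ++_) (++-assoc (postorder r) [ x ] v))) ⟩
  rebuild st p (postorder l ++ postorder r ++ x ∷ v)
    ≡⟨ rebuild-postorder l st p _ dl tl (subst (_< p) (headOr0-++ (postorder l) _ (postorder-tight≢[] tl)) h) ⟩
  rebuild (l ∷ st) (root l) (postorder r ++ x ∷ v)
    ≡⟨ rebuild-postorder r (l ∷ st) (root l) _ dr tr h< ⟩
  rebuild (r ∷ l ∷ st) (root r) (x ∷ v)
    ≡⟨ cong (λ b → rebuild (if b then br nil x nil ∷ r ∷ l ∷ st else br l x r ∷ st) x v) (<ᵇ-false (<-asym (All.lookup r< (root∈ tr)))) ⟩
  rebuild (br l x r ∷ st) x v ∎
  where open ≡-Reasoning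

tight-unique : ∀ t t′ → Decreasing t → Decreasing t′ → Tight t → Tight t′ → postorder t′ ≡ postorder t → t′ ≡ t
tight-unique t t′ dt dt′ tight tight′ eq = ∷-injectiveˡ (begin
  [ t′ ]                              ≡⟨ rebuilt t′ dt′ tight′ ⟨
  rebuild [] (suc (headOr0 (postorder t′))) (postorder t′)    ≡⟨ cong (λ w → rebuild [] (suc (headOr0 w)) w) eq ⟩
  rebuild [] (suc (headOr0 (postorder t))) (postorder t)      ≡⟨ rebuilt t dt tight ⟩
  [ t ]                               ∎)
  where
  open ≡-Reasoning
  -- One more than the first letter, as preceding letter, makes the first letter a descent and so a
  -- leaf.
  rebuilt : ∀ t → Decreasing t → Tight t → rebuild [] (suc (headOr0 (postorder t))) (postorder t) ≡ [ t ]
  rebuilt t d tight = trans (cong (rebuild [] (suc (headOr0 (postorder t)))) (sym (++-identityʳ (postorder t))))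
    (rebuild-postorder t [] _ [] d tight ≤-refl)

isPerm-unique : ∀ {n π} → IsPerm n π → Unique π
isPerm-unique {n} p = perm-unique (↭-trans p (↭-reflexive (range1≡range n)))

uniquelySorted⇒tight : ∀ {n π} → UniquelySorted (suc n) π → ∃[ t ] Decreasing t × Tight t × postorder t ≡ π
uniquelySorted⇒tight {n} {π} (σ , pσ , sσ , only) with decreasing-tree (length σ) σ ≤-refl (isPerm-unique pσ)
... | t , dt , refl with tight-or-another t dt (Unique-resp-↭ (inorder↭postorder t) (isPerm-unique pσ))
... | inj₁ refl = case ↭-length pσ of λ ()
... | inj₂ (inj₁ tight) = t , dt , tight , trans (sym (s-inorder t dt)) sσ
... | inj₂ (inj₂ (t′ , dt′ , eq , ≢)) = ⊥-elim (≢ (only (inorder t′)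
        (↭-trans (↭-trans (inorder↭postorder t′) (↭-trans (↭-reflexive eq) (↭-sym (inorder↭postorder t)))) pσ)
        (trans (s-inorder t′ dt′) (trans eq (trans (sym (s-inorder t dt)) sσ)))))

tight⇒uniquelySorted : ∀ {n} t → Decreasing t → Tight t → IsPerm n (postorder t) → UniquelySorted n (postorder t)
tight⇒uniquelySorted t dt tight p = inorder t , ↭-trans (inorder↭postorder t) p , s-inorder t dt , only
  where
  only : ∀ τ → IsPerm _ τ → s τ ≡ postorder t → τ ≡ inorder t
  only τ pτ sτ with decreasing-tree (length τ) τ ≤-refl (isPerm-unique pτ)
  ... | t′ , dt′ , refl =
    let eq = trans (sym (s-inorder t′ dt′)) sτ
    in cong inorder (tight-unique t t′ dt dt′ tight (tight-resp-postorder t t′ dt dt′ tight eq) eq)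

-- Roots of the stack of trees kept by `rebuild`; p is the preceding letter.
data Run : List ℕ → ℕ → List ℕ → List ℕ → Set where
  done : ∀ {st p} → Run st p [] st
  push : ∀ {st p y w fin} → y < p → Run (y ∷ st) y w fin → Run st p (y ∷ w) fin
  pop  : ∀ {r a st p y w fin} → p < y → a < y → Run (y ∷ st) y w fin → Run (r ∷ a ∷ st) p (y ∷ w) fin

tight⇒run : ∀ t {st p v fin} → Decreasing t → Tight t → headOr0 (postorder t) < p →
            Run (root t ∷ st) (root t) v fin → Run st p (postorder t ++ v) fin
tight⇒run t _ leaf h run = push h run
tight⇒run (br l x r) {st} {p} {v} {fin} (l< , r< , dl , dr) (fork tl tr h<) h run =
  subst (λ w → Run st p w fin) (sym (trans (++-assoc (postorder l) _ v) (cong (postorder l ++_) (++-assoc (postorder r) [ x ] v))))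
    (tight⇒run l dl tl (subst (_< p) (headOr0-++ (postorder l) _ (postorder-tight≢[] tl)) h)
      (tight⇒run r dr tr h< (pop (All.lookup r< (root∈ tr)) (All.lookup l< (root∈ tl)) run)))

Below : ℕ → List ℕ → Set
Below y []      = ⊤
Below y (a ∷ _) = y < a

Top : ℕ → List ℕ → Set
Top p []      = ⊤
Top p (a ∷ _) = a ≡ p

-- `Below`, between the first letter of a tree and the root beneath it, is the inequality that
-- `fork` demands once the two are merged.
data Stacked : List LTree → List ℕ → Set where
  []  : Stacked [] []
  add : ∀ {t ts st} → Decreasing t → Tight t → Below (headOr0 (postorder t)) st → Stacked ts st → Stacked (t ∷ ts) (root t ∷ st)

flatten : List LTree → List ℕ
flatten []       = []
flatten (t ∷ ts) = flatten ts ++ postorder t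

-- The top root is always the last letter read. Hence the condition of a push is `Below`, and the
-- two inequalities of a pop make the merged tree decreasing.
run⇒stacked : ∀ {st p w fin ts} → Run st p w fin → Stacked ts st → Top p st → ∃[ ts′ ] Stacked ts′ fin × flatten ts′ ≡ flatten ts ++ w
run⇒stacked {ts = ts} done stk _ = ts , stk , sym (++-identityʳ (flatten ts))
run⇒stacked {st = st} {ts = ts} (push {y = y} {w = w} y<p run) stk top =
  let ts′ , stk′ , eq = run⇒stacked run (add ([] , [] , tt , tt) leaf (under st top) stk) refl
  in ts′ , stk′ , trans eq (++-assoc (flatten ts) [ y ] w)
  where
  under : ∀ st → Top _ st → Below y st
  under []       _    = tt
  under (a ∷ st) refl = y<p
run⇒stacked (pop {y = y} {w = w} p<y a<y run) (add {r} {ts} dr tr r< (add {l} {ts′} dl tl l< stk)) refl =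
  let ts″ , stk″ , eq = run⇒stacked run (add (All.map (λ h → ≤-<-trans h a<y) (≤-root l dl) , All.map (λ h → ≤-<-trans h p<y) (≤-root r dr) , dl , dr)
                          (fork tl tr r<) (subst (λ h → Below h _) (sym (headOr0-++ (postorder l) _ (postorder-tight≢[] tl))) l<) stk) refl
  in ts″ , stk″ , trans eq (begin
       (flatten ts′ ++ postorder l ++ postorder r ++ [ y ]) ++ w     ≡⟨ cong (_++ w) (++-assoc (flatten ts′) (postorder l) _) ⟨
       ((flatten ts′ ++ postorder l) ++ postorder r ++ [ y ]) ++ w   ≡⟨ cong (_++ w) (++-assoc (flatten ts′ ++ postorder l) (postorder r) [ y ]) ⟨
       (((flatten ts′ ++ postorder l) ++ postorder r) ++ [ y ]) ++ w ≡⟨ ++-assoc ((flatten ts′ ++ postorder l) ++ postorder r) [ y ] w ⟩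
       ((flatten ts′ ++ postorder l) ++ postorder r) ++ y ∷ w        ∎)
  where open ≡-Reasoning

uniquelySorted⇒run : ∀ {n π} → UniquelySorted (suc n) π → ∀ p → All (_< p) π → ∃[ x ] Run [] p π [ x ]
uniquelySorted⇒run us p π<p with t , dt , tight , refl ← uniquelySorted⇒tight us =
  root t , subst (λ w → Run [] p w [ root t ]) (++-identityʳ (postorder t))
    (tight⇒run t dt tight (headOr0-All (postorder-tight≢[] tight) π<p) done)

run⇒uniquelySorted : ∀ {n p π x} → Run [] p π [ x ] → IsPerm n π → UniquelySorted n π
run⇒uniquelySorted run perm with run⇒stacked run [] tt
... | t ∷ [] , add dt tight _ [] , refl = tight⇒uniquelySorted t dt tight perm

-- Number of trees left on the stack by the word perm132 o T.
pending : Forest → ℕ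
pending ε                  = 0
pending (node A ε)         = suc (pending A)
pending (node A B@(node _ _)) = pending B ∸ 1 + pending A

-- A vertex is pushed exactly if it has no later sibling. A nonempty forest has one such vertex at
-- the top and one among the children of each inner vertex; each of the remaining vertices, one
-- fewer than the leaves, lowers the stack by one. `Good` keeps the subtraction in `pending` from
-- truncating.
pending-length : ∀ A B → Good (node A B) → pending (node A B) + length (peaks (node A B)) ≡ 2 + starts (peaks (node A B))

pending≥2 : ∀ A B → Good (node A B) → Balanced (peaks (node A B)) → 2 ≤ pending (node A B)
pending≥2 A B g b = +-cancelʳ-≤ (length (peaks (node A B))) 2 (pending (node A B))
  (≤-trans (+-monoʳ-≤ 2 b) (≤-reflexive (sym (pending-length A B g))))

pending≥2⁻ : ∀ A B → Good (node A B) → 2 ≤ pending (node A B) → Balanced (peaks (node A B))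
pending≥2⁻ A B g h = +-cancelˡ-≤ 2 _ _ (≤-trans (+-monoˡ-≤ _ h) (≤-reflexive (pending-length A B g)))

-- Stated with `enclose` to include the empty forest, for which the count of `pending-length` fails.
pending-enclose : ∀ A → Good A → pending A + length (enclose (peaks A)) ≡ 1 + starts (enclose (peaks A))
pending-enclose ε              _ = refl
pending-enclose A@(node A₁ A₂) g = trans (cong (pending A +_) (length-enclose (peaks A) (peaks≢[] A₁ A₂)))
  (trans (pending-length A₁ A₂ g) (cong suc (sym (starts-enclose (peaks A) (peaks≢[] A₁ A₂)))))

pending-length A ε (gA , _ , _) = begin
  suc (pending A + length (enclose (peaks A) ++ []))   ≡⟨ cong (λ w → suc (pending A + length w)) (++-identityʳ (enclose (peaks A))) ⟩
  suc (pending A + length (enclose (peaks A)))         ≡⟨ cong suc (pending-enclose A gA) ⟩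
  2 + starts (enclose (peaks A))                       ≡⟨ cong (λ w → 2 + starts w) (++-identityʳ (enclose (peaks A))) ⟨
  2 + starts (enclose (peaks A) ++ [])                 ∎
  where open ≡-Reasoning
pending-length A B@(node B₁ B₂) (gA , gB , bB) with pending B | pending≥2 B₁ B₂ gB bB | pending-length B₁ B₂ gB
... | suc zero    | s≤s () | _
... | suc (suc m) | _ | eqB = begin
  suc m + pending A + length (a ++ peaks B)                 ≡⟨ cong (suc m + pending A +_) (length-++ a) ⟩
  suc m + pending A + (length a + length (peaks B))         ≡⟨ regroup m (pending A) (length a) (length (peaks B)) ⟩
  (pending A + length a) + (suc m + length (peaks B))       ≡⟨ cong₂ _+_ (pending-enclose A gA) (suc-injective eqB) ⟩
  (1 + starts a) + (1 + starts (peaks B))                   ≡⟨ cong suc (+-suc (starts a) _) ⟩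
  2 + (starts a + starts (peaks B))                         ≡⟨ cong (2 +_) (starts-++ a (peaks B)) ⟨
  2 + starts (a ++ peaks B)                                 ∎
  where
  open ≡-Reasoning
  a = enclose (peaks A)
  regroup : ∀ m p l k → suc m + p + (l + k) ≡ (p + l) + (suc m + k)
  regroup = solve-∀

pending-positive : ∀ A B → Good (node A B) → 0 < pending (node A B)
pending-positive A ε              g = z<s
pending-positive A B@(node B₁ B₂) (gA , gB , bB) = ≤-trans (s≤s⁻¹ (≤-trans (pending≥2 B₁ B₂ gB bB) (≤-reflexive (sym (m+[n∸m]≡n {1} (<⇒≤ (pending≥2 B₁ B₂ gB bB))))))) (m≤m+n _ (pending A))

-- Stack runs on the two readings

lastOr-perm132 : ∀ p o A B → lastOr p (perm132 o (node A B)) ≡ rootLabel o B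
lastOr-perm132 p o A B = trans (lastOr-++ p (perm132 (rootLabel o B) A) _) (lastOr-++ _ (perm132 o B) [ rootLabel o B ])

run-ascent : ∀ {st p y w fin} → Run st p (y ∷ w) fin → p < y →
             ∃[ r ] ∃[ a ] ∃[ st′ ] st ≡ r ∷ a ∷ st′ × a < y × Run (y ∷ st′) y w fin
run-ascent (push y<p _)    p<y = ⊥-elim (<-asym y<p p<y)
run-ascent (pop _ a<y run) _   = _ , _ , _ , refl , a<y , run

run-descent : ∀ {st p y w fin} → Run st p (y ∷ w) fin → y < p → Run (y ∷ st) y w fin
run-descent (push _ run)  _   = run
run-descent (pop p<y _ _) y<p = ⊥-elim (<-asym y<p p<y)

module _ (o : ℕ) (A B : Forest) where

  private
    x = rootLabel o B

  root<bound : ∀ {p} → o + size (node A B) < p → x < p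
  root<bound h = ≤-<-trans (≤-trans (m≤m+n x (size A)) (≤-reflexive (rootLabel+size o A B))) h

  between-right : ∀ {ys} → All (Between x (x + size A)) ys → All (Between o (o + size (node A B))) ys
  between-right = All.map λ (l , u) → <-trans (s≤s (m≤m+n o (size B))) l , ≤-trans u (≤-reflexive (rootLabel+size o A B))

  between-left : ∀ {ys} → All (Between o (o + size B)) ys → All (Between o (o + size (node A B))) ys
  between-left = All.map λ (l , u) → l , ≤-trans u (+-monoʳ-≤ o (m≤m+n (size B) _))

  between-root : Between o (o + size (node A B)) x
  between-root = s≤s (m≤m+n o (size B)) , ≤-trans (m≤m+n x (size A)) (≤-reflexive (rootLabel+size o A B))

  perm132-node-++ : ∀ v → perm132 o (node A B) ++ v ≡ perm132 x A ++ perm132 o B ++ x ∷ v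
  perm132-node-++ v = trans (++-assoc (perm132 x A) _ v) (cong (perm132 x A ++_) (++-assoc (perm132 o B) [ x ] v))

  perm312-node-++ : ∀ v → perm312 o (node A B) ++ v ≡ perm312 o B ++ perm312 x A ++ x ∷ v
  perm312-node-++ v = trans (++-assoc (perm312 o B) _ v) (cong (perm312 o B ++_) (++-assoc (perm312 x A) [ x ] v))

  afterA> : ∀ {p} → o + size (node A B) < p → x < lastOr p (perm132 x A)
  afterA> h = lastOr-All {P = x <_} (root<bound h) (All.map proj₁ (perm132-between x A))

length-zero : ∀ (st : List ℕ) → length st ≡ 0 → st ≡ []
length-zero [] _ = refl

RunResult : ℕ → Forest → List ℕ → ℕ → List ℕ → List ℕ → Set
RunResult o T st p v fin = Good T × ∃[ st′ ] length st′ ≡ pending T × All (Between o (o + size T)) st′ ×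
  Run (st′ ++ st) (lastOr p (perm132 o T)) v fin

-- If B is empty, x is smaller than the letter before it and is pushed. Otherwise it is an ascent
-- and merges the top two entries; those left by A or lying deeper exceed x, so both must come from
-- B. Two entries pending from B mean that B is balanced.
run⇒good-root : ∀ o A B {st stA p v fin} → o + size (node A B) < p → All (rootLabel o B <_) st →
  Good A → length stA ≡ pending A → All (Between (rootLabel o B) (rootLabel o B + size A)) stA →
  RunResult o B (stA ++ st) (lastOr p (perm132 (rootLabel o B) A)) (rootLabel o B ∷ v) fin →
  RunResult o (node A B) st p v fin
run⇒good-root o A ε {st} {stA} {p} {v} {fin} p> st> gA lenA betA (_ , stB , lenB , _ , runB) =
  (gA , tt , z≤n) , x ∷ stA , cong suc lenA , between-root o A ε ∷ between-right o A ε betA ,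
  subst (λ q → Run (x ∷ stA ++ st) q v fin) (sym (lastOr-perm132 p o A ε))
    (run-descent (subst (λ stk → Run (stk ++ stA ++ st) (lastOr p (perm132 x A)) (x ∷ v) fin) (length-zero stB lenB) runB) (afterA> o A ε p>))
  where x = rootLabel o ε
run⇒good-root o A B@(node B₁ B₂) {st} {stA} {p} {v} {fin} p> st> gA lenA betA (gB , stB , lenB , betB , runB)
  with run-ascent runB (subst (_< rootLabel o B) (sym (lastOr-perm132 _ o B₁ B₂)) (s≤s (proj₂ (between-root o B₁ B₂))))
... | r , a , st₂ , eq , a<x , run = consume stB lenB betB eq
  where
  x = rootLabel o B

  second> : ∀ {u stk} → All (x <_) stk → u ∷ stk ≡ r ∷ a ∷ st₂ → x < a
  second> (x<a ∷ _) refl = x<a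

  consume : ∀ stk → length stk ≡ pending B → All (Between o (o + size B)) stk → stk ++ stA ++ st ≡ r ∷ a ∷ st₂ → RunResult o (node A B) st p v fin
  consume []              lenB _    _    = ⊥-elim (<-irrefl lenB (pending-positive B₁ B₂ gB))
  consume (_ ∷ [])        _    _    eq   = ⊥-elim (<-asym (second> (Allₚ.++⁺ (All.map proj₁ betA) st>) eq) a<x)
  consume (_ ∷ _ ∷ stB′) lenB betB refl =
    (gA , gB , pending≥2⁻ B₁ B₂ gB (≤-trans (s≤s (s≤s z≤n)) (≤-reflexive lenB))) ,
    x ∷ stB′ ++ stA ,
    trans (cong suc (length-++ stB′)) (cong₂ (λ u w → u ∸ 1 + w) lenB lenA) ,
    between-root o A B ∷ Allₚ.++⁺ (between-left o A B (All.tail (All.tail betB))) (between-right o A B betA) ,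
    subst₂ (λ stk q → Run stk q v fin) (cong (x ∷_) (sym (++-assoc stB′ stA st))) (sym (lastOr-perm132 p o A B)) run

-- The stack entries below the block of T are larger than all of T, so that the block cannot consume them.
run⇒good : ∀ o T {st p v fin} → o + size T < p → All (o + size T <_) st → Run st p (perm132 o T ++ v) fin → RunResult o T st p v fin
run⇒good o ε          _   _   run = tt , [] , refl , [] , run
run⇒good o (node A B) {st} {p} {v} {fin} p> st> run
  with gA , stA , lenA , betA , runA ← run⇒good (rootLabel o B) A {st} {p} {perm132 o B ++ rootLabel o B ∷ v} {fin}
         (subst (_< p) (sym (rootLabel+size o A B)) p>)
         (subst (λ b → All (b <_) st) (sym (rootLabel+size o A B)) st>)
         (subst (λ w → Run st p w fin) (perm132-node-++ o A B v) run)
  = run⇒good-root o A B p> st>′ gA lenA betA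
      (run⇒good o B (<-trans ≤-refl (afterA> o A B p>)) (All.map (<-trans ≤-refl) (Allₚ.++⁺ (All.map proj₁ betA) st>′)) runA)
  where
  st>′ : All (rootLabel o B <_) st
  st>′ = All.map (root<bound o A B) st>

-- In continuation form: a run on the rest of the word is extended backwards over the block, so that
-- blocks combine by composing functions.
Runs : ℕ → Forest → ℕ → Set
Runs o T p = ∃[ st′ ] length st′ ≡ pending T × All (Between o (o + size T)) st′ ×
  (∀ {st v fin} → Run (st′ ++ st) (lastOr p (perm132 o T)) v fin → Run st p (perm132 o T ++ v) fin)

good⇒run-root : ∀ o A B {p} → o + size (node A B) < p → Good (node A B) → Runs (rootLabel o B) A p →
  Runs o B (lastOr p (perm132 (rootLabel o B) A)) → Runs o (node A B) p
good⇒run-root o A ε {p} p> _ (stA , lenA , betA , runA) (stB , lenB , _ , runB) =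
  x ∷ stA , cong suc lenA , between-root o A ε ∷ between-right o A ε betA ,
  λ {st} {v} {fin} run → subst (λ w → Run st p w fin) (sym (perm132-node-++ o A ε v))
    (runA (runB (subst (λ stk → Run (stk ++ stA ++ st) (lastOr p (perm132 x A)) (x ∷ v) fin) (sym (length-zero stB lenB))
      (push (afterA> o A ε p>) (subst (λ q → Run (x ∷ stA ++ st) q v fin) (lastOr-perm132 p o A ε) run)))))
  where x = rootLabel o ε
good⇒run-root o A B@(node B₁ B₂) {p} p> (_ , gB , bB) (stA , lenA , betA , runA) (stB , lenB , betB , runB) = consume stB lenB betB runB
  where
  x = rootLabel o B
  pA = lastOr p (perm132 x A)

  consume : ∀ stk → length stk ≡ pending B → All (Between o (o + size B)) stk →
            (∀ {st v fin} → Run (stk ++ st) (lastOr pA (perm132 o B)) v fin → Run st pA (perm132 o B ++ v) fin) → Runs o (node A B) p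
  consume []             lenB _    _    = ⊥-elim (<-irrefl lenB (pending-positive B₁ B₂ gB))
  consume (_ ∷ [])       lenB _    _    = ⊥-elim (<-irrefl lenB (pending≥2 B₁ B₂ gB bB))
  consume (r ∷ a ∷ stB′) lenB betB runB =
    x ∷ stB′ ++ stA ,
    trans (cong suc (length-++ stB′)) (cong₂ (λ u w → u ∸ 1 + w) lenB lenA) ,
    between-root o A B ∷ Allₚ.++⁺ (between-left o A B (All.tail (All.tail betB))) (between-right o A B betA) ,
    λ {st} {v} {fin} run → subst (λ w → Run st p w fin) (sym (perm132-node-++ o A B v))
      (runA (runB (pop (subst (_< x) (sym (lastOr-perm132 pA o B₁ B₂)) (s≤s (proj₂ (between-root o B₁ B₂))))
        (s≤s (proj₂ (All.head (All.tail betB))))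
        (subst₂ (λ stk q → Run stk q v fin) (cong (x ∷_) (++-assoc stB′ stA st)) (lastOr-perm132 p o A B) run))))

good⇒run : ∀ o T {p} → o + size T < p → Good T → Runs o T p
good⇒run o ε          _  _                 = [] , refl , [] , id
good⇒run o (node A B) {p} p> g@(gA , gB , _) = good⇒run-root o A B p> g
  (good⇒run (rootLabel o B) A (subst (_< p) (sym (rootLabel+size o A B)) p>) gA)
  (good⇒run o B (<-trans ≤-refl (afterA> o A B p>)) gB)

-- Heights of the stack of a run along the reversed lower path.
data Walk : ℕ → List Step → ℕ → Set where
  done : ∀ {h} → Walk h [] h
  down : ∀ {h w m} → Walk (suc h) w m → Walk h (D ∷ w) m
  up   : ∀ {h w m} → Walk (suc h) w m → Walk (suc (suc h)) (U ∷ w) m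

-- In the reading 312 an ascent x exceeds everything on the stack, so merging is possible whenever
-- two entries are present. Therefore only the height has to be followed.
WalkRuns : ℕ → Forest → List Step → ℕ → Set
WalkRuns o T w m = ∀ st p → All (_≤ o) st → p ≤ o → Walk (length st) (postColours T ++ w) m →
  ∃[ st′ ] All (_≤ o + size T) st′ × Walk (length st′) w m ×
    (∀ {v fin} → Run st′ (lastOr p (perm312 o T)) v fin → Run st p (perm312 o T ++ v) fin)

lastOr-perm312-≤ : ∀ o T {p} → p ≤ o → lastOr p (perm312 o T) ≤ o + size T
lastOr-perm312-≤ o T p≤ = lastOr-All {P = _≤ o + size T} (≤-trans p≤ (m≤m+n o (size T))) (All.map proj₂ (perm312-between o T))

walk⇒run-leaf : ∀ o B {w m} → WalkRuns o B (U ∷ w) m → WalkRuns o (node ε B) w m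
walk⇒run-leaf o B {w} {m} ihB st p st≤ p≤ walk
  with ihB st p st≤ p≤ (subst (λ u → Walk (length st) u m) (++-assoc (postColours B) [ U ] w) walk)
... | r ∷ a ∷ st₂ , _ ∷ a≤ ∷ st₂≤ , up walk′ , run =
  x ∷ st₂ , proj₂ (between-root o ε B) ∷ All.map (λ h → ≤-trans h (+-monoʳ-≤ o (m≤m+n (size B) 1))) st₂≤ , walk′ ,
  λ {v} {fin} run′ → subst (λ u → Run st p u fin) (sym (perm312-node-++ o ε B v))
    (run (pop (s≤s (lastOr-perm312-≤ o B p≤)) (s≤s a≤) (subst (λ q → Run (x ∷ st₂) q v fin) (lastOr-perm312 p o ε B) run′)))
  where x = rootLabel o B

walk⇒run-inner : ∀ o A₁ A₂ B {w m} (let A = node A₁ A₂) → WalkRuns o B (postColours A ++ D ∷ w) m →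
                 WalkRuns (rootLabel o B) A (D ∷ w) m → WalkRuns o (node A B) w m
walk⇒run-inner o A₁ A₂ B {w} {m} ihB ihA st p st≤ p≤ walk
  with stB , stB≤ , walkB , runB ← ihB st p st≤ p≤ (subst (λ u → Walk (length st) u m)
         (trans (++-assoc (postColours B) _ w) (cong (postColours B ++_) (++-assoc (postColours (node A₁ A₂)) [ D ] w))) walk)
  with ihA stB (lastOr p (perm312 o B)) (All.map m≤n⇒m≤1+n stB≤) (m≤n⇒m≤1+n (lastOr-perm312-≤ o B p≤)) walkB
... | stA , stA≤ , down walkA , runA =
  x ∷ stA , proj₂ (between-root o A B) ∷ All.map (λ h → ≤-trans h (≤-reflexive (rootLabel+size o A B))) stA≤ , walkA ,
  λ {v} {fin} run → subst (λ u → Run st p u fin) (sym (perm312-node-++ o A B v))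
    (runB (runA (push (subst (x <_) (sym (lastOr-perm312 _ x A₁ A₂)) (s≤s (m≤m+n x (size A₂))))
      (subst (λ q → Run (x ∷ stA) q v fin) (lastOr-perm312 p o A B) run))))
  where
  x = rootLabel o B
  A = node A₁ A₂

walk⇒run : ∀ o T {w m} → WalkRuns o T w m
walk⇒run o ε st p st≤ _ walk = st , All.map (λ h → ≤-trans h (m≤m+n o 0)) st≤ , walk , id
walk⇒run o (node ε B)            = walk⇒run-leaf o B (walk⇒run o B)
walk⇒run o (node (node A₁ A₂) B) = walk⇒run-inner o A₁ A₂ B (walk⇒run o B) (walk⇒run (rootLabel o B) (node A₁ A₂))

reverse-replicate : ∀ n (x : Step) → reverse (replicate n x) ≡ replicate n x
reverse-replicate zero    x = refl
reverse-replicate (suc n) x = trans (unfold-reverse x (replicate n x)) (trans (cong (_++ [ x ]) (reverse-replicate n x))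
  (trans (replicate-∷ʳ n x []) (cong (x ∷_) (++-identityʳ (replicate n x)))))

walk-downs : ∀ a {h w m} → Walk (a + h) w m → Walk h (replicate a D ++ w) m
walk-downs zero        walk = walk
walk-downs (suc a) {h} {w} {m} walk = down (walk-downs a (subst (λ n → Walk n w m) (sym (+-suc a h)) walk))

-- The number d is the height once the suffix `ps` has been read from the right, that is 1 + starts
-- - length. Balance keeps it at least 1, so each up-step finds two entries.
walk-lower : ∀ ps → (∀ t → Balanced (drop t ps)) → ∀ {d w m} → d + length ps ≡ 1 + starts ps →
             Walk d w m → Walk 1 (reverse (lower ps) ++ w) m
walk-lower []             bal {w = w} {m} eq walk = subst (λ d → Walk d w m) (trans (sym (+-identityʳ _)) eq) walk
walk-lower ((a , b) ∷ ps) bal {zero}      eq walk = ⊥-elim (<-irrefl eq (s≤s (bal 0)))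
walk-lower ((a , b) ∷ ps) bal {suc d} {w} {m} eq walk =
  subst (λ u → Walk 1 u m) (sym word≡) (walk-lower ps (λ t → bal (suc t)) {d₀} eq₀
    (walk-downs a (subst (λ h → Walk h (U ∷ w) m) (sym (m+[n∸m]≡n a≤)) (up walk))))
  where
  -- The height before this block: a down-steps raise it to `suc (suc d)`, and the up-step lowers it
  -- to `suc d`.
  d₀ = suc (suc d) ∸ a
  open ≡-Reasoning

  a≤ : a ≤ suc (suc d)
  a≤ = +-cancelʳ-≤ (length ps) a (suc (suc d)) (≤-trans (+-monoʳ-≤ a (bal 1))
    (≤-trans (n≤1+n _) (≤-reflexive (trans (sym eq) (cong suc (+-suc d (length ps)))))))

  eq₀ : d₀ + length ps ≡ 1 + starts ps
  eq₀ = +-cancelˡ-≡ a _ _ (begin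
    a + (d₀ + length ps)           ≡⟨ +-assoc a d₀ (length ps) ⟨
    a + d₀ + length ps             ≡⟨ cong (_+ length ps) (m+[n∸m]≡n a≤) ⟩
    suc (suc d) + length ps        ≡⟨ cong suc (+-suc d (length ps)) ⟨
    suc d + suc (length ps)        ≡⟨ eq ⟩
    1 + (a + starts ps)            ≡⟨ +-suc a (starts ps) ⟨
    a + (1 + starts ps)            ∎)

  word≡ : reverse (U ∷ replicate a D ++ lower ps) ++ w ≡ reverse (lower ps) ++ replicate a D ++ U ∷ w
  word≡ = begin
    reverse (U ∷ replicate a D ++ lower ps) ++ w                       ≡⟨ cong (_++ w) (unfold-reverse U (replicate a D ++ lower ps)) ⟩
    (reverse (replicate a D ++ lower ps) ++ [ U ]) ++ w                ≡⟨ ++-assoc (reverse (replicate a D ++ lower ps)) [ U ] w ⟩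
    reverse (replicate a D ++ lower ps) ++ U ∷ w                       ≡⟨ cong (_++ U ∷ w) (trans (reverse-++ (replicate a D) (lower ps)) (cong (reverse (lower ps) ++_) (reverse-replicate a D))) ⟩
    (reverse (lower ps) ++ replicate a D) ++ U ∷ w                     ≡⟨ ++-assoc (reverse (lower ps)) (replicate a D) (U ∷ w) ⟩
    reverse (lower ps) ++ replicate a D ++ U ∷ w                       ∎

-- The first letter of a word pushes on the empty stack; popping the two dummies 0 has the same effect.
run-undummy : ∀ {w fin} → w ≢ [] → Run (0 ∷ 0 ∷ []) 0 w fin → ∃[ p ] Run [] p w fin
run-undummy ≢[] done         = ⊥-elim (≢[] refl)
run-undummy _   (pop _ _ run) = _ , push ≤-refl run

perm312-run : ∀ T ps → peaks T ≡ (0 , 0) ∷ ps → length ps ≡ starts ps → (∀ t → Balanced (drop t ps)) →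
              ∃[ p ] ∃[ x ] Run [] p (perm312 0 T) [ x ]
perm312-run ε ps ()
perm312-run T@(node A B) ps peaksT total bal
  -- The first letter exceeds the preceding letter 0, so its colour is an up-step; the two dummies
  -- provide the height 2 that it takes.
  with walk⇒run 0 T {[]} (0 ∷ 0 ∷ []) 0 (z≤n ∷ z≤n ∷ []) z≤n (subst (λ w → Walk 2 w 1) (sym colours)
         (up (walk-lower ps bal (cong suc total) done)))
  where
  open ≡-Reasoning
  colours : postColours T ++ [] ≡ U ∷ reverse (lower ps) ++ []
  colours = cong (_++ []) (begin
    postColours T                               ≡⟨ reverse-involutive (postColours T) ⟨
    reverse (reverse (postColours T))           ≡⟨ cong reverse (trans (reverse-postColours T) (trans (cong (leafWord ∘ map proj₁) peaksT) (U∷leafWord (map proj₁ ps)))) ⟩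
    reverse (lower ps ++ [ U ])                 ≡⟨ reverse-++ (lower ps) [ U ] ⟩
    U ∷ reverse (lower ps)                      ∎)
... | x ∷ [] , _ , done , run =
  let p , run′ = run-undummy (λ eq → case ++-conicalʳ (perm312 0 B) _ (++-conicalˡ _ [] eq) of λ eq′ → case ++-conicalʳ (perm312 (rootLabel 0 B) A) [ rootLabel 0 B ] eq′ of λ ())
                   (run {[]} done)
  in p , x , subst (λ w → Run [] p w [ x ]) (++-identityʳ (perm312 0 T)) run′

-- Assembling the bijection

size-peaks : ∀ T → size T ≡ length (peaks T) + starts (peaks T)
size-peaks ε          = refl
size-peaks (node A B) = begin
  size B + suc (size A)                                                ≡⟨ cong₂ _+_ (size-peaks B) (closed A) ⟩
  (length b + starts b) + (length a + starts a)                        ≡⟨ regroup (length b) (starts b) (length a) (starts a) ⟩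
  (length a + length b) + (starts a + starts b)                        ≡⟨ cong₂ _+_ (length-++ a) (starts-++ a b) ⟨
  length (a ++ b) + starts (a ++ b)                                    ∎
  where
  open ≡-Reasoning
  a = enclose (peaks A)
  b = peaks B
  regroup : ∀ w x y z → (w + x) + (y + z) ≡ (y + w) + (z + x)
  regroup = solve-∀
  closed : ∀ A → suc (size A) ≡ length (enclose (peaks A)) + starts (enclose (peaks A))
  closed ε              = refl
  closed A@(node A₁ A₂) = trans (cong suc (size-peaks A)) (trans (sym (+-suc _ _))
    (sym (cong₂ _+_ (length-enclose (peaks A) (peaks≢[] A₁ A₂)) (starts-enclose (peaks A) (peaks≢[] A₁ A₂)))))

double-injective : ∀ m k → m + m ≡ k + k → m ≡ k
double-injective m k eq with <-cmp m k
... | tri< m<k _ _ = ⊥-elim (<-irrefl eq (+-mono-< m<k m<k))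
... | tri≈ _ m≡k _ = m≡k
... | tri> _ _ k<m = ⊥-elim (<-irrefl (sym eq) (+-mono-< k<m k<m))

-- Nonempty children A leave at least one tree, and the root together with B leaves at least one
-- more. So the first vertex is a leaf, the surplus peak (0 , 0).
pending-one : ∀ T → Good T → pending T ≡ 1 → ∃[ B ] T ≡ node ε B
pending-one (node ε B)                              _             _  = B , refl
pending-one (node (node A₁ A₂) ε)                   (gA , _)      eq = ⊥-elim (<-irrefl (sym (suc-injective eq)) (pending-positive A₁ A₂ gA))
pending-one (node A@(node A₁ A₂) B@(node B₁ B₂)) (gA , gB , bB) eq =
  ⊥-elim (<-irrefl (sym eq) (+-mono-≤ (∸-monoˡ-≤ 1 (pending≥2 B₁ B₂ gB bB)) (pending-positive A₁ A₂ gA)))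

-- Every suffix of `peaks B` is a proper suffix for `node ε B`, so the suffix lemmas apply to all of
-- them. One pending tree gives as many leaves as inner vertices in B, and the size makes both
-- numbers k.
good⇒interval : ∀ k B → Good (node ε B) → pending (node ε B) ≡ 1 → size (node ε B) ≡ suc (k + k) → Interval k (peaks B)
good⇒interval k B g one sizeT = record
  { length≡       = length≡
  ; starts≡       = starts≡
  ; ends≡         = trans (sym (starts≡ends B)) starts≡
  ; lowerBallot   = lowerBallot
  ; upperBallot   = λ t → ≤-trans (dominated-peaks B t) (lowerBallot t)
  ; returnsBefore = good⇒returnsBefore (node ε B) g
  }
  where
  ps = peaks B

  total : length ps ≡ starts ps
  total = suc-injective (suc-injective (trans (cong (_+ suc (length ps)) (sym one)) (pending-length ε B g)))

  length≡ : length ps ≡ k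
  length≡ = double-injective (length ps) k (trans (cong (length ps +_) total) (suc-injective (trans (sym (size-peaks (node ε B))) sizeT)))

  starts≡ : starts ps ≡ k
  starts≡ = trans (sym total) length≡

  lowerBallot : ∀ t → starts (take t ps) ≤ length (take t ps)
  lowerBallot t = +-cancelʳ-≤ (starts (drop t ps)) _ _ (begin
    starts (take t ps) + starts (drop t ps)   ≡⟨ starts-split t ps ⟩
    starts ps                                 ≡⟨ total ⟨
    length ps                                 ≡⟨ cong length (take++drop≡id t ps) ⟨
    length (take t ps ++ drop t ps)           ≡⟨ length-++ (take t ps) ⟩
    length (take t ps) + length (drop t ps)   ≤⟨ +-monoʳ-≤ _ (good⇒balanced-drop (node ε B) g t) ⟩
    length (take t ps) + starts (drop t ps)   ∎)
    where open ≤-Reasoning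

isPerm : ∀ {n π} T → size T ≡ n → π ↭ range 0 (size T) → IsPerm n π
isPerm {n} T refl p = ↭-trans p (↭-reflexive (sym (range1≡range n)))

run⇒pending-one : ∀ {st p x} → Run (st ++ []) p [] [ x ] → length st ≡ 1
run⇒pending-one {st} run = trans (cong length (sym (++-identityʳ st))) (go run)
  where
  go : ∀ {st p x} → Run st p [] [ x ] → length st ≡ 1
  go done = refl

inU132⇒forest : ∀ k π → InU (suc (k + k)) p132 π →
  ∃[ B ] π ≡ perm132 0 (node ε B) × size (node ε B) ≡ suc (k + k) × Interval k (peaks B)
inU132⇒forest k π (perm , us , av)
  with T , sizeT , refl ← forest-of _ 0 (suc (k + k)) π ≤-refl (↭-trans perm (↭-reflexive (range1≡range (suc (k + k))))) (avoids⇒avoids132 av)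
  -- `suc (size T)` exceeds every letter, so the run begins with a push, and the bound that
  -- `run⇒good` asks of the preceding letter holds.
  with x , run ← uniquelySorted⇒run us (suc (size T)) (All.map (λ (_ , h) → s≤s h) (perm132-between 0 T))
  with g , st , len , _ , run′ ← run⇒good 0 T {[]} {suc (size T)} {[]} {[ x ]} ≤-refl []
         (subst (λ w → Run [] (suc (size T)) w [ x ]) (sym (++-identityʳ (perm132 0 T))) run)
  with B , refl ← pending-one T g (trans (sym len) (run⇒pending-one run′))
  = B , refl , sizeT , good⇒interval k B g (trans (sym len) (run⇒pending-one run′)) sizeT

forest⇒inU132 : ∀ k B → size (node ε B) ≡ suc (k + k) → Good (node ε B) → pending (node ε B) ≡ 1 →
                InU (suc (k + k)) p132 (perm132 0 (node ε B))
forest⇒inU132 k B sizeT g one = perm , us , avoids-p132 (perm132-avoids 0 T)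
  where
  T = node ε B
  perm = isPerm T sizeT (perm132↭range 0 T)
  us : UniquelySorted (suc (k + k)) (perm132 0 T)
  us with good⇒run 0 T {suc (size T)} ≤-refl g
  ... | []         , len , _ , _   = case trans len one of λ ()
  ... | _ ∷ _ ∷ _  , len , _ , _   = case trans len one of λ ()
  ... | x ∷ []     , _   , _ , run = run⇒uniquelySorted (subst (λ w → Run [] (suc (size T)) w [ x ]) (++-identityʳ (perm132 0 T)) (run {[]} {[]} {[ x ]} done)) perm

interval⇒inU132 : ∀ k B → Interval k (peaks B) → InU (suc (k + k)) p132 (perm132 0 (node ε B)) × size (node ε B) ≡ suc (k + k)
interval⇒inU132 k B I = forest⇒inU132 k B sizeT g one , sizeT
  where
  open Interval I
  g : Good (node ε B)
  g = returnsBefore⇒good (node ε B) balanced-drop returnsBefore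
  sizeT : size (node ε B) ≡ suc (k + k)
  sizeT = trans (size-peaks (node ε B)) (cong suc (cong₂ _+_ length≡ starts≡))
  one : pending (node ε B) ≡ 1
  one = +-cancelʳ-≡ (suc k) _ 1 (trans (cong (λ v → pending (node ε B) + suc v) (sym length≡))
    (trans (pending-length ε B g) (cong (2 +_) starts≡)))

forest⇒inU312 : ∀ k B → size (node ε B) ≡ suc (k + k) → Interval k (peaks B) → InU (suc (k + k)) p312 (perm312 0 (node ε B))
forest⇒inU312 k B sizeT I = perm , us , avoids-p312 (perm312-avoids 0 T)
  where
  open Interval I
  T = node ε B
  perm = isPerm T sizeT (perm312↭range 0 T)
  us : UniquelySorted (suc (k + k)) (perm312 0 T)
  us with p , x , run ← perm312-run T (peaks B) refl (trans length≡ (sym starts≡)) balanced-drop = run⇒uniquelySorted run perm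

DL-swl : ∀ k B → size (node ε B) ≡ suc (k + k) → DL k (swl (perm132 0 (node ε B))) ≡ (lower (peaks B) , upper (peaks B))
DL-swl k B sizeT = trans (cong (DL k) (swl-perm132 (node ε B))) (DL-perm312 k (node ε B) (peaks B) sizeT refl)

word-injective : ∀ g h → word g ≡ word h → g ≡ h
word-injective g h eq = trans (sym (gammas-word g)) (trans (cong gammas eq) (gammas-word h))

unzip-injective : ∀ (ps qs : Peaks) → map proj₁ ps ≡ map proj₁ qs → map proj₂ ps ≡ map proj₂ qs → ps ≡ qs
unzip-injective []       []       _   _   = refl
unzip-injective (p ∷ ps) (q ∷ qs) eq₁ eq₂ =
  cong₂ _∷_ (cong₂ _,_ (∷-injectiveˡ eq₁) (∷-injectiveˡ eq₂)) (unzip-injective ps qs (∷-injectiveʳ eq₁) (∷-injectiveʳ eq₂))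

theorem6p4 : (k : ℕ) →
    ((π : List ℕ) → InU (suc (k + k)) p132 π →
    InU (suc (k + k)) p312 (swl π) × InInt k (DL k (swl π)))
    × ((π σ : List ℕ) → InU (suc (k + k)) p132 π → InU (suc (k + k)) p132 σ →
    DL k (swl π) ≡ DL k (swl σ) → π ≡ σ)
    × ((Λ Λ′ : List Step) → InInt k (Λ , Λ′) →
    Σ (List ℕ) λ π → InU (suc (k + k)) p132 π × DL k (swl π) ≡ (Λ , Λ′))
theorem6p4 k = wellDefined , injective , surjective
  where
  module Preimage (π : List ℕ) (u : InU (suc (k + k)) p132 π) where

    B     = proj₁ (inU132⇒forest k π u)
    π≡    = proj₁ (proj₂ (inU132⇒forest k π u))
    size≡ = proj₁ (proj₂ (proj₂ (inU132⇒forest k π u)))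
    I     = proj₂ (proj₂ (proj₂ (inU132⇒forest k π u)))

    swl≡ : swl π ≡ perm312 0 (node ε B)
    swl≡ = trans (cong swl π≡) (swl-perm132 (node ε B))

    DL≡ : DL k (swl π) ≡ (lower (peaks B) , upper (peaks B))
    DL≡ = trans (cong (λ ρ → DL k (swl ρ)) π≡) (DL-swl k B size≡)

  wellDefined : (π : List ℕ) → InU (suc (k + k)) p132 π → InU (suc (k + k)) p312 (swl π) × InInt k (DL k (swl π))
  wellDefined π u =
    subst (InU (suc (k + k)) p312) (sym swl≡) (forest⇒inU312 k B size≡ I) ,
    subst (InInt k) (sym DL≡) (interval⇒InInt I)
    where open Preimage π u

  injective : (π σ : List ℕ) → InU (suc (k + k)) p132 π → InU (suc (k + k)) p132 σ → DL k (swl π) ≡ DL k (swl σ) → π ≡ σ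
  injective π σ u u′ eq = trans P.π≡ (trans (cong (λ B → perm132 0 (node ε B)) (peaks-injective P.B Q.B same)) (sym Q.π≡))
    where
    module P = Preimage π u
    module Q = Preimage σ u′

    words≡ : (lower (peaks P.B) , upper (peaks P.B)) ≡ (lower (peaks Q.B) , upper (peaks Q.B))
    words≡ = trans (sym P.DL≡) (trans eq Q.DL≡)

    same : peaks P.B ≡ peaks Q.B
    same = unzip-injective (peaks P.B) (peaks Q.B)
             (word-injective (map proj₁ (peaks P.B)) (map proj₁ (peaks Q.B)) (cong proj₁ words≡))
             (word-injective (map proj₂ (peaks P.B)) (map proj₂ (peaks Q.B)) (cong proj₂ words≡))

  surjective : (Λ Λ′ : List Step) → InInt k (Λ , Λ′) → Σ (List ℕ) λ π → InU (suc (k + k)) p132 π × DL k (swl π) ≡ (Λ , Λ′)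
  surjective Λ Λ′ int =
    let ps , I , lower≡ , upper≡ = InInt⇒interval int
        -- Equal totals and the containment of the paths, the latter from the Tamari order, let the
        -- parser end with a single forest.
        B , peaks≡ = peaks-surjective ps (trans (Interval.starts≡ I) (sym (Interval.ends≡ I)))
                       (returnsBefore⇒dominated ps (Interval.upperBallot I) (Interval.returnsBefore I))
        inU , size≡ = interval⇒inU132 k B (subst (Interval k) (sym peaks≡) I)
    in perm132 0 (node ε B) , inU ,
       trans (DL-swl k B size≡) (cong₂ _,_ (trans (cong lower peaks≡) lower≡) (trans (cong upper peaks≡) upper≡))
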